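{- There exists a primitive sequence $\mathscr{A} \neq \{1\}$ of positive integers such that $$ \sum_{a \in \mathscr{A}} \frac{\omega(a)}{a \log a} \;>\; \sum_{p \in \mathscr{P}} \frac{\omega(p)}{p \log p} \;=\; \sum_{p \in \mathscr{P}} \frac{1}{p \log p}, $$ where $\mathscr{P}$ denotes the sequence of all prime numbers and $\omega(n)$ denotes the number of distinct prime factors of the positive integer $n$.
   Context: A sequence (regarded as a set of distinct elements, finite or infinite) $\mathscr{A}$ of positive integers is called primitive if no term of $\mathscr{A}$ divides any other term of $\mathscr{A}$. $\mathscr{P}$ is the sequence of the prime numbers. For a positive integer $n$, $\omega(n)$ is the number of prime factors of $n$ counted without multiplicity. $\log$ is the natural logarithm. All sums have non-negative terms. -}

module Defs where

open import Data.Integer.Base as ℤ using (+_)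
import Data.Integer.Properties as ℤₚ
open import Data.List.Base using (List; []; _∷_; foldr; map; filter; length; upTo)
open import Data.List.Relation.Unary.All using (All; [])
open import Data.List.Relation.Unary.Unique.Propositional using (Unique)
open import Data.List.Relation.Unary.AllPairs using ([])
open import Data.Nat.Base as ℕ using (ℕ; zero; suc; pred)
open import Data.Nat.Divisibility using (_∣_; _∣?_)
open import Data.Nat.Primality using (prime?)
import Data.Nat.Properties as ℕₚ
open import Data.Product.Base using (∃-syntax; _×_; _,_; proj₁; proj₂)
open import Data.Rational.Base as ℚ
  using (ℚ; 0ℚ; 1ℚ; ½; mkℚ; *<*; _≤_; _+_; _*_; _-_; -_; _/_; 1/_; _⊔_; ∣_∣; fromℚᵘ; toℚᵘ)
import Data.Rational.Properties as ℚₚ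
open import Data.Rational.Solver using (module +-*-Solver)
open import Data.Rational.Unnormalised.Base as ℚᵘ using (mkℚᵘ; *≡*)
import Data.Rational.Unnormalised.Properties as ℚᵘₚ
open import Data.Sum.Base using (inj₁; inj₂)
open import Level using (0ℓ)
open import Relation.Binary.PropositionalEquality
open import Relation.Nullary.Decidable using (_×-dec_)
open import Relation.Nullary.Negation using (¬_)
open import Relation.Unary using (Pred; _≐_)

open +-*-Solver

∣-∣-bound : ∀ {p b} → p ≤ b → - p ≤ b → ∣ p ∣ ≤ b
∣-∣-bound {p} p≤b -p≤b with ℚₚ.∣p∣≡p∨∣p∣≡-p p
... | inj₁ eq = ℚₚ.≤-trans (ℚₚ.≤-reflexive eq) p≤b
... | inj₂ eq = ℚₚ.≤-trans (ℚₚ.≤-reflexive eq) -p≤b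

*-pos : ∀ {p q} → 0ℚ ℚ.< p → 0ℚ ℚ.< q → 0ℚ ℚ.< p * q
*-pos {p} {q} 0<p 0<q =
  ℚₚ.positive⁻¹ (p * q) {{ℚₚ.pos*pos⇒pos p {{ℚ.positive 0<p}} q {{ℚ.positive 0<q}}}}

+-pos : ∀ {p q} → 0ℚ ℚ.< p → 0ℚ ℚ.< q → 0ℚ ℚ.< p + q
+-pos 0<p 0<q = ℚₚ.+-mono-< 0<p 0<q

0<½ : 0ℚ ℚ.< ½
0<½ = ℚₚ.positive⁻¹ ½

0<1 : 0ℚ ℚ.< 1ℚ
0<1 = ℚₚ.positive⁻¹ 1ℚ

half-pos : ∀ {ε} → 0ℚ ℚ.< ε → 0ℚ ℚ.< ε * ½
half-pos 0<ε = *-pos 0<ε 0<½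

half+half : ∀ ε → ε * ½ + ε * ½ ≡ ε
half+half = solve 1 (λ e → e :* con ½ :+ e :* con ½ := e) refl

⊔-pos : ∀ p {e} → 0ℚ ℚ.< e → 0ℚ ℚ.< p ⊔ e
⊔-pos p {e} 0<e = ℚₚ.<-≤-trans 0<e (ℚₚ.p≤q⊔p p e)

IsCauchy : (ℕ → ℚ) → Set
IsCauchy x = ∀ ε → 0ℚ ℚ.< ε →
  ∃[ N ] ∀ m n → N ℕ.≤ m → N ℕ.≤ n → ∣ x m - x n ∣ ℚ.< ε

record ℝ : Set where
  constructor mkℝ
  field
    seq    : ℕ → ℚ
    cauchy : IsCauchy seq

open ℝ public

infix 4 _<ℝ_

_<ℝ_ : ℝ → ℝ → Set
x <ℝ y = ∃[ ε ] 0ℚ ℚ.< ε × ∃[ N ] ∀ n → N ℕ.≤ n → seq x n + ε ≤ seq y n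

fromℚ : ℚ → ℝ
fromℚ q = mkℝ (λ _ → q) λ ε 0<ε → 0 , λ _ _ _ _ →
  subst (ℚ._< ε) (sym (cong ∣_∣ (ℚₚ.+-inverseʳ q))) 0<ε

fromℕ : ℕ → ℝ
fromℕ n = fromℚ (+ n / 1)

0ℝ : ℝ
0ℝ = fromℚ 0ℚ

infixl 6 _+ℝ_
infixl 7 _*ℝ_

_+ℝ_ : ℝ → ℝ → ℝ
x +ℝ y = mkℝ (λ n → seq x n + seq y n) λ ε 0<ε →
  let (N₁ , h₁) = cauchy x (ε * ½) (half-pos 0<ε)
      (N₂ , h₂) = cauchy y (ε * ½) (half-pos 0<ε)
  in N₁ ℕ.⊔ N₂ , λ m n N≤m N≤n →
    let a = seq x m ; b = seq y m ; c = seq x n ; d = seq y n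
        open ℚₚ.≤-Reasoning in begin-strict
      ∣ (a + b) - (c + d) ∣      ≡⟨ cong ∣_∣ (solve 4 (λ a b c d →
                                      (a :+ b) :- (c :+ d) := (a :- c) :+ (b :- d)) refl a b c d) ⟩
      ∣ (a - c) + (b - d) ∣      ≤⟨ ℚₚ.∣p+q∣≤∣p∣+∣q∣ (a - c) (b - d) ⟩
      ∣ a - c ∣ + ∣ b - d ∣      <⟨ ℚₚ.+-mono-< (h₁ m n (ℕₚ.m⊔n≤o⇒m≤o N₁ N₂ N≤m) (ℕₚ.m⊔n≤o⇒m≤o N₁ N₂ N≤n))
                                                (h₂ m n (ℕₚ.m⊔n≤o⇒n≤o N₁ N₂ N≤m) (ℕₚ.m⊔n≤o⇒n≤o N₁ N₂ N≤n)) ⟩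
      ε * ½ + ε * ½              ≡⟨ half+half ε ⟩
      ε                          ∎

eventually-bounded : ∀ x → ∃[ B ] 0ℚ ℚ.< B × ∃[ N ] ∀ n → N ℕ.≤ n → ∣ seq x n ∣ ≤ B
eventually-bounded x =
  let (N , h) = cauchy x 1ℚ 0<1
      s = seq x N
  in 1ℚ + ∣ s ∣
   , ℚₚ.+-mono-<-≤ 0<1 (ℚₚ.0≤∣p∣ s)
   , N , λ n N≤n →
     let a = seq x n
         open ℚₚ.≤-Reasoning in begin
       ∣ a ∣              ≡⟨ cong ∣_∣ (solve 2 (λ a s → a := (a :- s) :+ s) refl a s) ⟩
       ∣ (a - s) + s ∣    ≤⟨ ℚₚ.∣p+q∣≤∣p∣+∣q∣ (a - s) s ⟩
       ∣ a - s ∣ + ∣ s ∣  ≤⟨ ℚₚ.+-monoˡ-≤ ∣ s ∣ (ℚₚ.<⇒≤ (h n N N≤n ℕₚ.≤-refl)) ⟩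
       1ℚ + ∣ s ∣         ∎

*-cauchy : ∀ x y → IsCauchy (λ n → seq x n * seq y n)
*-cauchy x y ε 0<ε =
  let (B , 0<B , N₁ , hB) = eventually-bounded x
      (C , 0<C , N₂ , hC) = eventually-bounded y
      0<S = +-pos 0<B 0<C
      instance
        S-pos = ℚ.positive 0<S
        S-nz  = ℚₚ.pos⇒nonZero (B + C)
        B-nn  = ℚ.nonNegative (ℚₚ.<⇒≤ 0<B)
        C-pos = ℚ.positive 0<C
        B-pos = ℚ.positive 0<B
      S = B + C
      δ = ε * 1/ S
      0<δ = *-pos 0<ε (ℚₚ.positive⁻¹ (1/ S) {{ℚₚ.1/pos⇒pos S}})
      (N₃ , h₃) = cauchy x δ 0<δ
      (N₄ , h₄) = cauchy y δ 0<δ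
  in (N₁ ℕ.⊔ N₂) ℕ.⊔ (N₃ ℕ.⊔ N₄) , λ m n N≤m N≤n →
    let a = seq x m ; b = seq y m ; c = seq x n ; d = seq y n
        i₁₂ : ∀ {k} → (N₁ ℕ.⊔ N₂) ℕ.⊔ (N₃ ℕ.⊔ N₄) ℕ.≤ k → N₁ ℕ.⊔ N₂ ℕ.≤ k
        i₁₂ = ℕₚ.m⊔n≤o⇒m≤o (N₁ ℕ.⊔ N₂) (N₃ ℕ.⊔ N₄)
        i₃₄ : ∀ {k} → (N₁ ℕ.⊔ N₂) ℕ.⊔ (N₃ ℕ.⊔ N₄) ℕ.≤ k → N₃ ℕ.⊔ N₄ ℕ.≤ k
        i₃₄ = ℕₚ.m⊔n≤o⇒n≤o (N₁ ℕ.⊔ N₂) (N₃ ℕ.⊔ N₄)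
        ∣a∣≤B = hB m (ℕₚ.m⊔n≤o⇒m≤o N₁ N₂ (i₁₂ N≤m))
        ∣d∣≤C = hC n (ℕₚ.m⊔n≤o⇒n≤o N₁ N₂ (i₁₂ N≤n))
        dx = h₃ m n (ℕₚ.m⊔n≤o⇒m≤o N₃ N₄ (i₃₄ N≤m)) (ℕₚ.m⊔n≤o⇒m≤o N₃ N₄ (i₃₄ N≤n))
        dy = h₄ m n (ℕₚ.m⊔n≤o⇒n≤o N₃ N₄ (i₃₄ N≤m)) (ℕₚ.m⊔n≤o⇒n≤o N₃ N₄ (i₃₄ N≤n))
        open ℚₚ.≤-Reasoning in begin-strict
      ∣ a * b - c * d ∣                      ≡⟨ cong ∣_∣ (solve 4 (λ a b c d →
                                                 a :* b :- c :* d := a :* (b :- d) :+ (a :- c) :* d) refl a b c d) ⟩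
      ∣ a * (b - d) + (a - c) * d ∣          ≤⟨ ℚₚ.∣p+q∣≤∣p∣+∣q∣ (a * (b - d)) ((a - c) * d) ⟩
      ∣ a * (b - d) ∣ + ∣ (a - c) * d ∣      ≡⟨ cong₂ _+_ (ℚₚ.∣p*q∣≡∣p∣*∣q∣ a (b - d)) (ℚₚ.∣p*q∣≡∣p∣*∣q∣ (a - c) d) ⟩
      ∣ a ∣ * ∣ b - d ∣ + ∣ a - c ∣ * ∣ d ∣  ≤⟨ ℚₚ.+-mono-≤
                                                 (ℚₚ.*-monoʳ-≤-nonNeg ∣ b - d ∣ {{ℚₚ.∣-∣-nonNeg (b - d)}} ∣a∣≤B)
                                                 (ℚₚ.*-monoˡ-≤-nonNeg ∣ a - c ∣ {{ℚₚ.∣-∣-nonNeg (a - c)}} ∣d∣≤C) ⟩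
      B * ∣ b - d ∣ + ∣ a - c ∣ * C          <⟨ ℚₚ.+-mono-< (ℚₚ.*-monoʳ-<-pos B dy) (ℚₚ.*-monoˡ-<-pos C dx) ⟩
      B * δ + δ * C                          ≡⟨ solve 4 (λ B C e i →
                                                 B :* (e :* i) :+ (e :* i) :* C := e :* (i :* (B :+ C))) refl B C ε (1/ S) ⟩
      ε * (1/ S * S)                         ≡⟨ cong (ε *_) (ℚₚ.*-inverseˡ S) ⟩
      ε * 1ℚ                                 ≡⟨ ℚₚ.*-identityʳ ε ⟩
      ε                                      ∎

_*ℝ_ : ℝ → ℝ → ℝ
x *ℝ y = mkℝ (λ n → seq x n * seq y n) (*-cauchy x y)

recip : ∀ p → 0ℚ ℚ.< p → ℚ
recip p 0<p = (1/ p) {{ℚ.>-nonZero 0<p}}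

recip-diff : ∀ u v (0<u : 0ℚ ℚ.< u) (0<v : 0ℚ ℚ.< v) →
             (recip u 0<u - recip v 0<v) * (u * v) ≡ v - u
recip-diff u v 0<u 0<v = begin
  (i - j) * (u * v)              ≡⟨ solve 4 (λ i j u v → (i :- j) :* (u :* v) :=
                                      (i :* u) :* v :- (j :* v) :* u) refl i j u v ⟩
  (i * u) * v - (j * v) * u      ≡⟨ cong₂ (λ s t → s * v - t * u)
                                      (ℚₚ.*-inverseˡ u {{ℚ.>-nonZero 0<u}})
                                      (ℚₚ.*-inverseˡ v {{ℚ.>-nonZero 0<v}}) ⟩
  1ℚ * v - 1ℚ * u                ≡⟨ cong₂ _-_ (ℚₚ.*-identityˡ v) (ℚₚ.*-identityˡ u) ⟩
  v - u                          ∎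
  where
  open ≡-Reasoning
  i = recip u 0<u
  j = recip v 0<v

⁻¹-cauchy : ∀ y ((e , 0<e , _) : 0ℝ <ℝ y) →
            IsCauchy (λ n → recip (seq y n ⊔ e) (⊔-pos (seq y n) 0<e))
⁻¹-cauchy y (e , 0<e , N₀ , h₀) ε 0<ε =
  let (N₁ , h₁) = cauchy y (ε * (e * e)) (*-pos 0<ε 0<ee)
  in N₀ ℕ.⊔ N₁ , λ m n N≤m N≤n →
    let u = seq y m ⊔ e ; v = seq y n ⊔ e
        0<u = ⊔-pos (seq y m) 0<e
        0<v = ⊔-pos (seq y n) 0<e
        i = recip u 0<u ; j = recip v 0<v
        u≡ = stable m (ℕₚ.m⊔n≤o⇒m≤o N₀ N₁ N≤m)
        v≡ = stable n (ℕₚ.m⊔n≤o⇒m≤o N₀ N₁ N≤n)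
        open ℚₚ.≤-Reasoning
    in ℚₚ.*-cancelʳ-<-nonNeg (e * e) {{ee-nn}} (begin-strict
      ∣ i - j ∣ * (e * e)          ≤⟨ ℚₚ.*-monoˡ-≤-nonNeg ∣ i - j ∣ {{ℚₚ.∣-∣-nonNeg (i - j)}} (ee≤ m n) ⟩
      ∣ i - j ∣ * (u * v)          ≡⟨ cong (∣ i - j ∣ *_) (sym (ℚₚ.0≤p⇒∣p∣≡p (ℚₚ.<⇒≤ (*-pos 0<u 0<v)))) ⟩
      ∣ i - j ∣ * ∣ u * v ∣        ≡⟨ sym (ℚₚ.∣p*q∣≡∣p∣*∣q∣ (i - j) (u * v)) ⟩
      ∣ (i - j) * (u * v) ∣        ≡⟨ cong ∣_∣ (recip-diff u v 0<u 0<v) ⟩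
      ∣ v - u ∣                    ≡⟨ cong ∣_∣ (cong₂ _-_ v≡ u≡) ⟩
      ∣ seq y n - seq y m ∣        <⟨ h₁ n m (ℕₚ.m⊔n≤o⇒n≤o N₀ N₁ N≤n) (ℕₚ.m⊔n≤o⇒n≤o N₀ N₁ N≤m) ⟩
      ε * (e * e)                  ∎)
  where
  0<ee = *-pos 0<e 0<e
  ee-nn = ℚ.nonNegative (ℚₚ.<⇒≤ 0<ee)

  stable : ∀ n → N₀ ℕ.≤ n → seq y n ⊔ e ≡ seq y n
  stable n N≤n = ℚₚ.p≥q⇒p⊔q≡p (subst (_≤ seq y n) (ℚₚ.+-identityˡ e) (h₀ n N≤n))

  ee≤ : ∀ m n → e * e ≤ (seq y m ⊔ e) * (seq y n ⊔ e)
  ee≤ m n = ℚₚ.≤-trans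
    (ℚₚ.*-monoʳ-≤-nonNeg e {{ℚ.nonNegative (ℚₚ.<⇒≤ 0<e)}} (ℚₚ.p≤q⊔p (seq y m) e))
    (ℚₚ.*-monoˡ-≤-nonNeg (seq y m ⊔ e) {{ℚ.nonNegative (ℚₚ.<⇒≤ (⊔-pos (seq y m) 0<e))}}
      (ℚₚ.p≤q⊔p (seq y n) e))

-- A positive real is eventually bounded below by some rational e > 0; cutting
-- its terms off at e makes all of them invertible and changes only finitely many.
inv : (y : ℝ) → 0ℝ <ℝ y → ℝ
inv y y>0@(e , 0<e , _) =
  mkℝ (λ n → recip (seq y n ⊔ e) (⊔-pos (seq y n) 0<e)) (⁻¹-cauchy y y>0)

-- harmonic a l = 1/(a+1) + … + 1/(a+l)
harmonic : ℕ → ℕ → ℚ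
harmonic a zero    = 0ℚ
harmonic a (suc l) = harmonic a l + + 1 / suc (a ℕ.+ l)

frac : ℕ → ℕ → ℚ
frac l d = + l / suc d

frac-≤ : ∀ {l d l′ d′} → l ℕ.* suc d′ ℕ.≤ l′ ℕ.* suc d → frac l d ≤ frac l′ d′
frac-≤ {l} {d} {l′} {d′} h = ℚₚ.toℚᵘ-cancel-≤ (begin
  toℚᵘ (frac l d)   ≃⟨ ℚₚ.toℚᵘ-fromℚᵘ (mkℚᵘ (+ l) d) ⟩
  mkℚᵘ (+ l) d      ≤⟨ ℚᵘ.*≤* (subst₂ ℤ._≤_ (ℤₚ.pos-* l (suc d′)) (ℤₚ.pos-* l′ (suc d)) (ℤ.+≤+ h)) ⟩
  mkℚᵘ (+ l′) d′    ≃⟨ ℚᵘₚ.≃-sym (ℚₚ.toℚᵘ-fromℚᵘ (mkℚᵘ (+ l′) d′)) ⟩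
  toℚᵘ (frac l′ d′) ∎)
  where open ℚᵘₚ.≤-Reasoning

frac-≡ : ∀ {l d l′ d′} → l ℕ.* suc d′ ≡ l′ ℕ.* suc d → frac l d ≡ frac l′ d′
frac-≡ {l} {d} {l′} {d′} h = ℚₚ.≤-antisym
  (frac-≤ {l} {d} {l′} {d′} (ℕₚ.≤-reflexive h))
  (frac-≤ {l′} {d′} {l} {d} (ℕₚ.≤-reflexive (sym h)))

frac-+ : ∀ l l′ d → frac l d + frac l′ d ≡ frac (l ℕ.+ l′) d
frac-+ l l′ d = ℚₚ.toℚᵘ-injective (begin
  toℚᵘ (frac l d + frac l′ d)            ≈⟨ ℚₚ.toℚᵘ-homo-+ (frac l d) (frac l′ d) ⟩
  toℚᵘ (frac l d) ℚᵘ.+ toℚᵘ (frac l′ d)  ≈⟨ ℚᵘₚ.+-cong (ℚₚ.toℚᵘ-fromℚᵘ (mkℚᵘ (+ l) d))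
                                                       (ℚₚ.toℚᵘ-fromℚᵘ (mkℚᵘ (+ l′) d)) ⟩
  mkℚᵘ (+ l) d ℚᵘ.+ mkℚᵘ (+ l′) d        ≈⟨ *≡* lemma ⟩
  mkℚᵘ (+ (l ℕ.+ l′)) d                  ≈⟨ ℚᵘₚ.≃-sym (ℚₚ.toℚᵘ-fromℚᵘ (mkℚᵘ (+ (l ℕ.+ l′)) d)) ⟩
  toℚᵘ (frac (l ℕ.+ l′) d)               ∎)
  where
  open import Relation.Binary.Reasoning.Setoid ℚᵘₚ.≃-setoid
  D = + suc d
  lemma : ((+ l) ℤ.* D ℤ.+ (+ l′) ℤ.* D) ℤ.* D ≡ (+ (l ℕ.+ l′)) ℤ.* (+ (suc d ℕ.* suc d))
  lemma = trans (cong (ℤ._* D) (sym (ℤₚ.*-distribʳ-+ D (+ l) (+ l′))))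
    (trans (ℤₚ.*-assoc (+ l ℤ.+ + l′) D D) (cong ((+ l ℤ.+ + l′) ℤ.*_) (sym (ℤₚ.pos-* (suc d) (suc d)))))

frac-0 : ∀ d → frac 0 d ≡ 0ℚ
frac-0 d = ℚₚ.0/n≡0 (suc d)

0≤frac : ∀ l d → 0ℚ ≤ frac l d
0≤frac l d = ℚₚ.≤-trans (ℚₚ.≤-reflexive (sym (frac-0 0))) (frac-≤ {0} {0} {l} {d} ℕ.z≤n)

harmonic-split : ∀ a l l′ → harmonic a (l ℕ.+ l′) ≡ harmonic a l + harmonic (a ℕ.+ l) l′
harmonic-split a l zero = trans (cong (harmonic a) (ℕₚ.+-identityʳ l)) (sym (ℚₚ.+-identityʳ _))
harmonic-split a l (suc l′) = begin
  harmonic a (l ℕ.+ suc l′)                       ≡⟨ cong (harmonic a) (ℕₚ.+-suc l l′) ⟩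
  harmonic a (l ℕ.+ l′) + frac 1 (a ℕ.+ (l ℕ.+ l′))
    ≡⟨ cong₂ (λ p k → p + frac 1 k) (harmonic-split a l l′) (sym (ℕₚ.+-assoc a l l′)) ⟩
  (harmonic a l + harmonic (a ℕ.+ l) l′) + frac 1 (a ℕ.+ l ℕ.+ l′)
    ≡⟨ ℚₚ.+-assoc (harmonic a l) _ _ ⟩
  harmonic a l + harmonic (a ℕ.+ l) (suc l′)      ∎
  where open ≡-Reasoning

harmonic-nonNeg : ∀ a l → 0ℚ ≤ harmonic a l
harmonic-nonNeg a zero    = ℚₚ.≤-refl
harmonic-nonNeg a (suc l) = ℚₚ.+-mono-≤ (harmonic-nonNeg a l) (0≤frac 1 (a ℕ.+ l))

harmonic-lower : ∀ a l d → a ℕ.+ l ℕ.≤ suc d → frac l d ≤ harmonic a l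
harmonic-lower a zero d h = ℚₚ.≤-reflexive (frac-0 d)
harmonic-lower a (suc l) d h = begin
  frac (suc l) d                     ≡⟨ cong (λ k → frac k d) (ℕₚ.+-comm 1 l) ⟩
  frac (l ℕ.+ 1) d                   ≡⟨ sym (frac-+ l 1 d) ⟩
  frac l d + frac 1 d                ≤⟨ ℚₚ.+-mono-≤
                                         (harmonic-lower a l d (ℕₚ.≤-trans (ℕₚ.+-monoʳ-≤ a (ℕₚ.n≤1+n l)) h))
                                         (frac-≤ {1} {d} {1} {a ℕ.+ l} (ℕₚ.*-monoʳ-≤ 1 (ℕₚ.≤-trans (ℕₚ.≤-reflexive (sym (ℕₚ.+-suc a l))) h))) ⟩
  harmonic a l + frac 1 (a ℕ.+ l)    ∎
  where open ℚₚ.≤-Reasoning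

harmonic-upper : ∀ a l d → d ℕ.≤ a → harmonic a l ≤ frac l d
harmonic-upper a zero d h = ℚₚ.≤-reflexive (sym (frac-0 d))
harmonic-upper a (suc l) d h = begin
  harmonic a l + frac 1 (a ℕ.+ l)    ≤⟨ ℚₚ.+-mono-≤ (harmonic-upper a l d h)
                                         (frac-≤ {1} {a ℕ.+ l} {1} {d} (ℕₚ.*-monoʳ-≤ 1 (ℕ.s≤s (ℕₚ.≤-trans h (ℕₚ.m≤m+n a l))))) ⟩
  frac l d + frac 1 d                ≡⟨ frac-+ l 1 d ⟩
  frac (l ℕ.+ 1) d                   ≡⟨ cong (λ k → frac k d) (ℕₚ.+-comm l 1) ⟩
  frac (suc l) d                     ∎
  where open ℚₚ.≤-Reasoning

block-lower : ∀ a k → frac 1 a ≤ harmonic (a ℕ.* suc k) (suc k)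
block-lower a k = begin
  frac 1 a                          ≡⟨ frac-≡ {1} {a} {suc k} {k ℕ.+ a ℕ.* suc k}
                                        (trans (ℕₚ.*-identityˡ _) (ℕₚ.*-comm (suc a) (suc k))) ⟩
  frac (suc k) (k ℕ.+ a ℕ.* suc k)  ≤⟨ harmonic-lower (a ℕ.* suc k) (suc k) _
                                        (ℕₚ.≤-reflexive (ℕₚ.+-comm (a ℕ.* suc k) (suc k))) ⟩
  harmonic (a ℕ.* suc k) (suc k)    ∎
  where open ℚₚ.≤-Reasoning

block-upper : ∀ a k → harmonic (suc a ℕ.* suc k) (suc k) ≤ frac 1 a
block-upper a k = begin
  harmonic (suc a ℕ.* suc k) (suc k)  ≤⟨ harmonic-upper (suc a ℕ.* suc k) (suc k) _ (ℕₚ.n≤1+n _) ⟩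
  frac (suc k) (k ℕ.+ a ℕ.* suc k)    ≡⟨ sym (frac-≡ {1} {a} {suc k} {k ℕ.+ a ℕ.* suc k}
                                           (trans (ℕₚ.*-identityˡ _) (ℕₚ.*-comm (suc a) (suc k)))) ⟩
  frac 1 a                            ∎
  where open ℚₚ.≤-Reasoning

refine-step : ∀ a l k → harmonic (a ℕ.* suc k) (suc l ℕ.* suc k)
              ≡ harmonic (a ℕ.* suc k) (l ℕ.* suc k) + harmonic ((a ℕ.+ l) ℕ.* suc k) (suc k)
refine-step a l k = begin
  harmonic A (suc k ℕ.+ l ℕ.* suc k)             ≡⟨ cong (harmonic A) (ℕₚ.+-comm (suc k) (l ℕ.* suc k)) ⟩
  harmonic A (l ℕ.* suc k ℕ.+ suc k)             ≡⟨ harmonic-split A (l ℕ.* suc k) (suc k) ⟩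
  harmonic A (l ℕ.* suc k) + harmonic (A ℕ.+ l ℕ.* suc k) (suc k)
    ≡⟨ cong (λ b → harmonic A (l ℕ.* suc k) + harmonic b (suc k)) (sym (ℕₚ.*-distribʳ-+ (suc k) a l)) ⟩
  harmonic A (l ℕ.* suc k) + harmonic ((a ℕ.+ l) ℕ.* suc k) (suc k) ∎
  where
  open ≡-Reasoning
  A = a ℕ.* suc k

refine-lower : ∀ a l k → harmonic a l ≤ harmonic (a ℕ.* suc k) (l ℕ.* suc k)
refine-lower a zero    k = ℚₚ.≤-refl
refine-lower a (suc l) k = ℚₚ.≤-trans
  (ℚₚ.+-mono-≤ (refine-lower a l k) (block-lower (a ℕ.+ l) k))
  (ℚₚ.≤-reflexive (sym (refine-step a l k)))

refine-upper : ∀ a l k → harmonic (suc a ℕ.* suc k) (l ℕ.* suc k) ≤ harmonic a l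
refine-upper a zero    k = ℚₚ.≤-refl
refine-upper a (suc l) k = ℚₚ.≤-trans
  (ℚₚ.≤-reflexive (refine-step (suc a) l k))
  (ℚₚ.+-mono-≤ (refine-upper a l k) (block-upper (a ℕ.+ l) k))

shift : ∀ a l → harmonic a l ≤ harmonic (suc a) l + frac 1 a
shift a l = begin
  harmonic a l                          ≡⟨ sym (ℚₚ.+-identityʳ _) ⟩
  harmonic a l + 0ℚ                     ≤⟨ ℚₚ.+-monoʳ-≤ (harmonic a l) (0≤frac 1 (a ℕ.+ l)) ⟩
  harmonic a (1 ℕ.+ l)                  ≡⟨ harmonic-split a 1 l ⟩
  (0ℚ + frac 1 (a ℕ.+ 0)) + harmonic (a ℕ.+ 1) l
    ≡⟨ cong₂ _+_ (trans (ℚₚ.+-identityˡ _) (cong (frac 1) (ℕₚ.+-identityʳ a)))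
                 (cong (λ b → harmonic b l) (ℕₚ.+-comm a 1)) ⟩
  frac 1 a + harmonic (suc a) l         ≡⟨ ℚₚ.+-comm (frac 1 a) _ ⟩
  harmonic (suc a) l + frac 1 a         ∎
  where open ℚₚ.≤-Reasoning

archimedean : ∀ ε → 0ℚ ℚ.< ε → ∃[ N ] frac 1 N ℚ.< ε
archimedean ε@(mkℚ (+ zero) d _) (*<* (ℤ.+<+ ()))
archimedean ε@(mkℚ (+ suc p) d _) 0<ε = suc d , (begin-strict
  frac 1 (suc d)  <⟨ ℚₚ.toℚᵘ-cancel-< (ℚᵘₚ.<-respˡ-≃ (ℚᵘₚ.≃-sym (ℚₚ.toℚᵘ-fromℚᵘ (mkℚᵘ (+ 1) (suc d))))
                       (ℚᵘ.*<* (subst₂ ℤ._<_ (ℤₚ.pos-* 1 (suc d)) (ℤₚ.pos-* (suc p) (suc (suc d)))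
                         (ℤ.+<+ lt)))) ⟩
  ε               ∎)
  where
  open ℚₚ.≤-Reasoning
  lt : 1 ℕ.* suc d ℕ.< suc p ℕ.* suc (suc d)
  lt = ℕₚ.<-≤-trans (subst (ℕ._< suc (suc d)) (sym (ℕₚ.*-identityˡ (suc d))) (ℕₚ.n<1+n (suc d)))
         (ℕₚ.m≤m+n (suc (suc d)) (p ℕ.* suc (suc d)))
archimedean (mkℚ ℤ.-[1+ p ] d _) (*<* ())

sandwich : ∀ {p q x b} → p ≤ x → x ≤ q + b → p - q ≤ b
sandwich {p} {q} {x} {b} p≤x x≤q+b = begin
  p - q        ≤⟨ ℚₚ.+-monoˡ-≤ (- q) (ℚₚ.≤-trans p≤x x≤q+b) ⟩
  (q + b) - q  ≡⟨ solve 2 (λ q b → (q :+ b) :- q := b) refl q b ⟩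
  b            ∎
  where open ℚₚ.≤-Reasoning

-- The sum of (1/M) · 1/(1 + i/M) over 1 ≤ i ≤ (n-1)M, where M = m+1: the
-- right-endpoint Riemann sum of ∫₁ⁿ dt/t with mesh 1/M.
logSum : ℕ → ℕ → ℚ
logSum n m = harmonic (suc m) (pred n ℕ.* suc m)

log-diff : ∀ n m k → logSum n m - logSum n k ≤ frac 1 k
log-diff n m k = sandwich
  (subst (logSum n m ≤_) eq (refine-lower (suc m) (c ℕ.* suc m) k))
  (ℚₚ.≤-trans (refine-upper k (c ℕ.* suc k) m) (shift k (c ℕ.* suc k)))
  where
  c = pred n
  eq : harmonic (suc m ℕ.* suc k) (c ℕ.* suc m ℕ.* suc k) ≡ harmonic (suc k ℕ.* suc m) (c ℕ.* suc k ℕ.* suc m)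
  eq = cong₂ harmonic (ℕₚ.*-comm (suc m) (suc k))
         (trans (ℕₚ.*-assoc c (suc m) (suc k))
           (trans (cong (c ℕ.*_) (ℕₚ.*-comm (suc m) (suc k))) (sym (ℕₚ.*-assoc c (suc k) (suc m)))))

log-cauchy : ∀ n → IsCauchy (logSum n)
log-cauchy n ε 0<ε =
  let (N , 1/N<ε) = archimedean ε 0<ε
      frac≤ : ∀ {k} → N ℕ.≤ k → frac 1 k ≤ frac 1 N
      frac≤ {k} N≤k = frac-≤ {1} {k} {1} {N} (ℕₚ.*-monoʳ-≤ 1 (ℕ.s≤s N≤k))
  in N , λ m k N≤m N≤k → ℚₚ.≤-<-trans
    (∣-∣-bound
      (ℚₚ.≤-trans (log-diff n m k) (frac≤ N≤k))
      (subst (_≤ frac 1 N)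
        (solve 2 (λ p q → q :- p := :- (p :- q)) refl (logSum n m) (logSum n k))
        (ℚₚ.≤-trans (log-diff n k m) (frac≤ N≤m))))
    1/N<ε

-- The natural logarithm ∫₁ⁿ dt/t of n ≥ 1; log 0 is a filler.
log : ℕ → ℝ
log n = mkℝ (logSum n) (log-cauchy n)

log≥½ : ∀ n m → ½ ≤ logSum (2 ℕ.+ n) m
log≥½ n m = begin
  ½                                   ≡⟨ frac-≡ {1} {1} {suc m} {m ℕ.+ suc m} eq ⟩
  frac (suc m) (m ℕ.+ suc m)          ≤⟨ harmonic-lower (suc m) (suc m) _ ℕₚ.≤-refl ⟩
  harmonic (suc m) (suc m)            ≡⟨ sym (ℚₚ.+-identityʳ _) ⟩
  harmonic (suc m) (suc m) + 0ℚ       ≤⟨ ℚₚ.+-monoʳ-≤ (harmonic (suc m) (suc m)) (harmonic-nonNeg _ (n ℕ.* suc m)) ⟩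
  harmonic (suc m) (suc m) + harmonic (suc m ℕ.+ suc m) (n ℕ.* suc m)
                                      ≡⟨ sym (harmonic-split (suc m) (suc m) (n ℕ.* suc m)) ⟩
  logSum (2 ℕ.+ n) m                  ∎
  where
  open ℚₚ.≤-Reasoning
  eq : 1 ℕ.* suc (m ℕ.+ suc m) ≡ suc m ℕ.* 2
  eq = trans (ℕₚ.*-identityˡ (suc m ℕ.+ suc m))
         (sym (trans (ℕₚ.*-comm (suc m) 2) (cong (suc m ℕ.+_) (ℕₚ.+-identityʳ (suc m)))))

n·log[n]>0 : ∀ n → 0ℝ <ℝ fromℕ (2 ℕ.+ n) *ℝ log (2 ℕ.+ n)
n·log[n]>0 n = ½ , 0<½ , 0 , λ m _ →
  let L = logSum (2 ℕ.+ n) m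
      0≤L = ℚₚ.≤-trans (ℚₚ.<⇒≤ 0<½) (log≥½ n m)
      open ℚₚ.≤-Reasoning in begin
    0ℚ + ½                   ≡⟨ ℚₚ.+-identityˡ ½ ⟩
    ½                        ≤⟨ log≥½ n m ⟩
    L                        ≡⟨ sym (ℚₚ.*-identityˡ L) ⟩
    1ℚ * L                   ≤⟨ ℚₚ.*-monoʳ-≤-nonNeg L {{ℚ.nonNegative 0≤L}}
                                  (frac-≤ {1} {0} {2 ℕ.+ n} {0} (ℕ.s≤s ℕ.z≤n)) ⟩
    (+ (2 ℕ.+ n) / 1) * L    ∎

-- c / (n log n).  For n ≤ 1 it is undefined, and the value 0 is a filler: the
-- only primitive sequence containing 1 is {1}.
_/[_log] : ℕ → ℕ → ℝ
c /[ 0 log]                   = 0ℝ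
c /[ 1 log]                   = 0ℝ
c /[ n@(suc (suc n-2)) log]   = fromℕ c *ℝ inv (fromℕ n *ℝ log n) (n·log[n]>0 n-2)

-- An element of (-∞, +∞], given by the set of rationals strictly below it.
record ℝ∞ : Set₁ where
  field
    cut       : Pred ℚ 0ℓ
    inhabited : ∃[ q ] cut q
    lower     : ∀ {p q} → p ≤ q → cut q → cut p
    rounded   : ∀ {p} → cut p → ∃[ q ] p ℚ.< q × cut q

open ℝ∞ public

infix 4 _>∞_ _≈∞_

-- Some rational lies below x and is at least y.
_>∞_ : ℝ∞ → ℝ∞ → Set
x >∞ y = ∃[ q ] cut x q × ¬ cut y q

_≈∞_ : ℝ∞ → ℝ∞ → Set
x ≈∞ y = cut x ≐ cut y

sumℝ : List ℝ → ℝ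
sumℝ = foldr _+ℝ_ 0ℝ

-- The supremum of the sums over finite subsets of A, which is the sum of f
-- over A whenever f is non-negative on A.
∑ : Pred ℕ 0ℓ → (ℕ → ℝ) → ℝ∞
∑ A f = record
  { cut       = λ q → ∃[ as ] Unique as × All A as × fromℚ q <ℝ sumℝ (map f as)
  ; inhabited = - 1ℚ , [] , [] , [] , 1ℚ , 0<1 , 0 , λ _ _ → ℚₚ.≤-refl
  ; lower     = λ { p≤q (as , u , a , ε , 0<ε , N , h) →
      as , u , a , ε , 0<ε , N , λ n N≤n → ℚₚ.≤-trans (ℚₚ.+-monoˡ-≤ ε p≤q) (h n N≤n) }
  ; rounded   = λ { {p} (as , u , a , ε , 0<ε , N , h) →
      let 0<ε/2 = half-pos 0<ε in
      p + ε * ½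
      , subst (ℚ._< p + ε * ½) (ℚₚ.+-identityʳ p) (ℚₚ.+-monoʳ-< p 0<ε/2)
      , as , u , a , ε * ½ , 0<ε/2 , N , λ n N≤n → ℚₚ.≤-trans
          (ℚₚ.≤-reflexive (trans (ℚₚ.+-assoc p (ε * ½) (ε * ½)) (cong (λ x → p + x) (half+half ε))))
          (h n N≤n) }
  }

Primitive : Pred ℕ 0ℓ → Set
Primitive A = ∀ {a b} → A a → A b → a ∣ b → a ≡ b

ω : ℕ → ℕ
ω n = length (filter (λ p → prime? p ×-dec p ∣? n) (upTo (suc n)))

{-# OPTIONS --safe #-}
module Submission where

-- Fix y = 2^(10h) with h huge, keep the primes up to y and replace the larger
-- ones by the products pq of two primes p, q > y.  As ω(pq) = 2 for p ≠ q and
-- ω(p²) = 1, these products contribute the sum of 1 / (pq log pq) over ordered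
-- pairs.  By Mertens' theorem the primes between 2^(ih) and 2^((i+1)h) have
-- reciprocal sum close to 1/i, so in units of 1 / (h log 2) the products gain
-- about ∑ᵢⱼ 1 / (ij(i+j)), against a loss of about ∑ᵢ 1/i²; already for i, j
-- from 10 to 399 the gain exceeds the whole loss.

open import Defs
open import Data.List.Base using (List; []; _∷_; _++_; map; filter; length; concatMap; upTo)
open import Data.List.Membership.Propositional using (_∈_)
open import Data.List.Membership.Propositional.Properties
  using (∈-∃++; ∈-++⁺ˡ; ∈-++⁺ʳ; ∈-++⁻; ∈-filter⁺; ∈-filter⁻; ∈-map⁻; ∈-upTo⁺)
open import Data.List.Properties using (filter-++; map-++; length-filter)
open import Data.List.Relation.Unary.All as All using (All; []; _∷_)
import Data.List.Relation.Unary.All.Properties as Allₚ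
open import Data.List.Relation.Unary.AllPairs using ([]; _∷_)
open import Data.List.Relation.Unary.Any using (here; there)
open import Data.List.Relation.Unary.Unique.Propositional using (Unique)
import Data.List.Relation.Unary.Unique.Propositional.Properties as Uniqueₚ
open import Data.Nat.Base as ℕ using (ℕ; zero; suc; pred; z≤n; s≤s; z<s; _^_; _∸_; >-nonZero)
open import Data.Nat.Base using (ℕ; _<_)
open import Data.Nat.Divisibility
open import Data.Nat.ListAction using (sum)
open import Data.Nat.Primality
import Data.Nat.Properties as ℕₚ
open import Data.Nat.Tactic.RingSolver using (solve-∀)
open import Data.Product.Base using (∃-syntax; _×_; _,_; proj₁; proj₂)
open import Data.Sum.Base using (_⊎_; inj₁; inj₂)
open import Function.Base using (_∘_)
open import Level using (0ℓ)
open import Relation.Binary.PropositionalEquality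
open import Relation.Nullary.Decidable using (Dec; yes; no; toWitness; _×-dec_)
open import Relation.Nullary.Negation using (¬_; contradiction)
open import Relation.Unary using (Pred; _≐_; ｛_｝)

-- The exchange pays because of one constant. Over buckets from k on the loss is about 1/k, while
-- the gain is about the double integral of 1 / (st(s + t)) over s, t > k, which equals 2 log 2 / k,
-- and 2 log 2 > 1. The factor 2 is the weight `ω`: counted once, the products would gain only log 2
-- / k. Starting at k = 10 keeps the discretisation error small, since lower bounds see 1/(i + 1)
-- where upper bounds see 1/i. The margin left is about one part in a hundred, so Chebyshev bounds
-- with a lost constant factor do not suffice: buckets need both halves of Mertens' theorem with
-- errors of at most 1%. The parameters are nested: relative errors are multiples of 1/a, the factor
-- 2^r absorbs rounding, and `h` is enormous compared with 2^r. Reals are Cauchy sequences, so all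
-- comparisons are made between m-th rational approximations, for every m ≥ 200 and every finite set
-- of primes, with one rational gap independent of both.

module PrimeEstimates where

  open import Data.Nat.Base
  open import Data.Nat.Combinatorics using (k![n∸k]!∣n!)
  open import Data.Nat.DivMod using (m/n*n≤m; m%n<n; m≡m%n+[m/n]*n)
  open import Data.Nat.Induction using (<-rec)
  open import Data.Nat.ListAction using (product)
  open import Data.Nat.ListAction.Properties using (sum-++; ∈⇒∣product)
  open import Data.Nat.Primality.Factorisation using (factorise; PrimeFactorisation)
  open import Data.Nat.Properties

  -- Divisibility by primes and prime powers

  prime⇒1< : ∀ {p} → Prime p → 1 < p
  prime⇒1< pr = nonTrivial⇒n>1 _ {{prime⇒nonTrivial pr}}

  prime∣prime⇒≡ : ∀ {p q} → Prime p → Prime q → p ∣ q → p ≡ q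
  prime∣prime⇒≡ pp pq p∣q with prime⇒irreducible pq p∣q
  ... | inj₁ refl = contradiction pp ¬prime[1]
  ... | inj₂ eq   = eq

  prime∣^⇒∣ : ∀ {p a} → Prime p → ∀ k → p ∣ a ^ k → p ∣ a
  prime∣^⇒∣ pp zero p∣1 = contradiction (subst Prime (∣1⇒≡1 p∣1) pp) ¬prime[1]
  prime∣^⇒∣ {a = a} pp (suc k) d with euclidsLemma a (a ^ k) pp d
  ... | inj₁ d₁ = d₁
  ... | inj₂ d₂ = prime∣^⇒∣ pp k d₂

  prime-∤⇒^∣-cancel : ∀ {p b c} → Prime p → p ∤ b → ∀ k → p ^ k ∣ b * c → p ^ k ∣ c
  prime-∤⇒^∣-cancel pp p∤b zero _ = 1∣ _
  prime-∤⇒^∣-cancel {p} {b} pp p∤b (suc k) d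
    with prime-∤⇒^∣-cancel pp p∤b k (∣-trans (n∣m*n p) d)
  ... | divides c′ refl
    with euclidsLemma b c′ pp (*-cancelʳ-∣ (p ^ k) {{p^k≢0}} (subst (p * p ^ k ∣_) (sym (*-assoc b c′ (p ^ k))) d))
    where p^k≢0 = m^n≢0 p k {{prime⇒nonZero pp}}
  ... | inj₁ p∣b  = contradiction p∣b p∤b
  ... | inj₂ p∣c′ = *-monoˡ-∣ (p ^ k) p∣c′

  -- Powers of distinct primes are coprime, so divisors multiply.
  ∏^-∣ : ∀ (e : ℕ → ℕ) {Q} ps → Unique ps → All Prime ps → All (λ p → p ^ e p ∣ Q) ps →
         product (map (λ p → p ^ e p) ps) ∣ Q
  ∏^-∣ e [] _ _ _ = 1∣ _
  ∏^-∣ e (p ∷ ps) (p∉ps ∷ u) (pp ∷ prs) (divides c refl ∷ ds) =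
    subst (p ^ e p * product (map (λ p → p ^ e p) ps) ∣_) (*-comm (p ^ e p) c)
      (*-monoʳ-∣ (p ^ e p) (∏^-∣ e ps u prs
        (All.tabulate λ {q} q∈ps → prime-∤⇒^∣-cancel (All.lookup prs q∈ps)
          (λ d → All.lookup p∉ps q∈ps (sym (prime∣prime⇒≡ (All.lookup prs q∈ps) pp (prime∣^⇒∣ (All.lookup prs q∈ps) (e p) d))))
          (e q) (subst (q ^ e q ∣_) (*-comm c (p ^ e p)) (All.lookup ds q∈ps)))))

  -- Truncated quotient, with the junk value n div 0 = n.
  infixl 7 _div_
  _div_ : ℕ → ℕ → ℕ
  n div zero  = n
  n div suc d = n / suc d

  div-*-≤ : ∀ n p → 0 < p → n div p * p ≤ n
  div-*-≤ n (suc p) _ = m/n*n≤m n (suc p)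

  <-suc-div-* : ∀ n p → 0 < p → n < suc (n div p) * p
  <-suc-div-* n (suc p) _ = subst (_< suc (n / suc p) * suc p) (sym (m≡m%n+[m/n]*n n (suc p)))
    (+-monoˡ-< (n / suc p * suc p) (m%n<n n (suc p)))

  ≤-div : ∀ t n p → 0 < p → t * p ≤ n → t ≤ n div p
  ≤-div t n p 0<p h = s≤s⁻¹ (*-cancelʳ-< p t (suc (n div p)) (≤-<-trans h (<-suc-div-* n p 0<p)))

  -- Factorials, multinomial coefficients and the upper half of Mertens' theorem

  ^∣[*]! : ∀ p .{{_ : NonZero p}} q → p ^ q ∣ (q * p) !
  ^∣[*]! p zero = 1∣ _
  ^∣[*]! p@(suc p′) (suc q) = *-pres-∣ {p} {suc q * p} {p ^ q}
    (n∣m*n (suc q)) (∣-trans (^∣[*]! p q) (m≤n⇒m!∣n! (m≤n+m (q * p) p′)))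

  ^div∣! : ∀ n p → 0 < p → p ^ (n div p) ∣ n !
  ^div∣! n p 0<p = ∣-trans (^∣[*]! p {{>-nonZero 0<p}} (n div p)) (m≤n⇒m!∣n! (div-*-≤ n p 0<p))

  -- The quotient is a multinomial coefficient: each further block of size x multiplies it by a
  -- binomial coefficient.
  !^∣[*]! : ∀ x k → (x !) ^ k ∣ (k * x) !
  !^∣[*]! x zero = 1∣ _
  !^∣[*]! x (suc k) = ∣-trans (*-monoʳ-∣ (x !) (!^∣[*]! x k))
    (subst (λ m → x ! * m ! ∣ (x + k * x) !) (m+n∸m≡n x (k * x)) (k![n∸k]!∣n! (m≤m+n x (k * x))))

  [+]!≤ : ∀ m n → (m + n) ! ≤ (m + n) ^ m * n !
  [+]!≤ zero n = ≤-reflexive (sym (+-identityʳ (n !)))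
  [+]!≤ (suc m) n = begin
    suc (m + n) * (m + n) !                 ≤⟨ *-monoʳ-≤ (suc (m + n)) ([+]!≤ m n) ⟩
    suc (m + n) * ((m + n) ^ m * n !)       ≤⟨ *-monoʳ-≤ (suc (m + n)) (*-monoˡ-≤ (n !) (^-monoˡ-≤ m (n≤1+n (m + n)))) ⟩
    suc (m + n) * (suc (m + n) ^ m * n !)   ≡⟨ *-assoc (suc (m + n)) (suc (m + n) ^ m) (n !) ⟨
    suc (m + n) ^ suc m * n !               ∎
    where open ≤-Reasoning

  [*]^ : ∀ a b k → (a * b) ^ k ≡ a ^ k * b ^ k
  [*]^ a b zero = refl
  [*]^ a b (suc k) = trans (cong (a * b *_) ([*]^ a b k)) (lem a b (a ^ k) (b ^ k))
    where
    lem : ∀ a b c d → a * b * (c * d) ≡ a * c * (b * d)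
    lem = solve-∀

  -- Passing from x to x + 1 adds k factors to (kx)!, each at most k(x + 1); the product k^k (x +
  -- 1)^k is exactly the growth of the right-hand side.
  [*]!≤ : ∀ k x → (k * x) ! ≤ k ^ (k * x) * (x !) ^ k
  [*]!≤ k zero = begin
    (k * 0) !                  ≡⟨ cong _! (*-zeroʳ k) ⟩
    1                          ≡⟨ cong₂ (λ a b → k ^ a * b) (*-zeroʳ k) (^-zeroˡ k) ⟨
    k ^ (k * 0) * 1 ^ k        ∎
    where open ≤-Reasoning
  [*]!≤ k (suc x) = begin
    (k * suc x) !                                        ≡⟨ cong _! (*-suc k x) ⟩
    (k + k * x) !                                        ≤⟨ [+]!≤ k (k * x) ⟩
    (k + k * x) ^ k * (k * x) !                          ≤⟨ *-mono-≤ (≤-reflexive (trans (cong (_^ k) (sym (*-suc k x))) ([*]^ k (suc x) k))) ([*]!≤ k x) ⟩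
    k ^ k * suc x ^ k * (k ^ (k * x) * (x !) ^ k)        ≡⟨ lem (k ^ k) (suc x ^ k) (k ^ (k * x)) ((x !) ^ k) ⟩
    k ^ k * k ^ (k * x) * (suc x ^ k * (x !) ^ k)        ≡⟨ cong₂ _*_ (^-distribˡ-+-* k k (k * x)) ([*]^ (suc x) (x !) k) ⟨
    k ^ (k + k * x) * (suc x !) ^ k                      ≡⟨ cong (λ a → k ^ a * (suc x !) ^ k) (*-suc k x) ⟨
    k ^ (k * suc x) * (suc x !) ^ k                      ∎
    where
    open ≤-Reasoning
    lem : ∀ a b c d → a * b * (c * d) ≡ a * c * (b * d)
    lem = solve-∀

  ∤! : ∀ {p} → Prime p → ∀ n → n < p → p ∤ n !
  ∤! pp zero _ d = contradiction (subst Prime (∣1⇒≡1 d) pp) ¬prime[1]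
  ∤! pp (suc n) n<p d with euclidsLemma (suc n) (n !) pp d
  ... | inj₁ p∣1+n = >⇒∤ n<p p∣1+n
  ... | inj₂ p∣n!  = ∤! pp n (<-trans (n<1+n n) n<p) p∣n!

  -- The product divides the multinomial coefficient (kx)! / (x!)ᵏ ≤ kᵏˣ, because
  -- the primes exceed x.
  ∏^div≤ : ∀ k x ps → Unique ps → All Prime ps → All (x <_) ps →
           product (map (λ p → p ^ ((k * x) div p)) ps) ≤ k ^ (k * x)
  ∏^div≤ k x ps u prs x<ps with !^∣[*]! x k
  ... | divides Q eq = ≤-trans (∣⇒≤ {{≢-nonZero Q≢0}} (∏^-∣ ((k * x) div_) ps u prs (All.tabulate ∣Q)))
      (*-cancelʳ-≤ Q (k ^ (k * x)) ((x !) ^ k) {{m^n≢0 (x !) k {{x !≢0}}}} (≤-trans (≤-reflexive (sym eq)) ([*]!≤ k x)))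
    where
    Q≢0 : Q ≢ 0
    Q≢0 refl = <⇒≢ (1≤n! (k * x)) (sym eq)
    ∣Q : ∀ {p} → p ∈ ps → p ^ ((k * x) div p) ∣ Q
    ∣Q {p} p∈ = prime-∤⇒^∣-cancel pp (λ d → ∤! pp x (All.lookup x<ps p∈) (prime∣^⇒∣ pp k d)) ((k * x) div p)
      (subst (p ^ ((k * x) div p) ∣_) (trans eq (*-comm Q _)) (^div∣! (k * x) p (<-trans z<s (prime⇒1< pp))))
      where pp = All.lookup prs p∈

  n<2^n : ∀ n → n < 2 ^ n
  n<2^n zero = z<s
  n<2^n (suc n) = +-mono-≤ (m^n>0 2 n) (≤-trans (n<2^n n) (m≤m+n (2 ^ n) 0))

  2^-cancel-≤ : ∀ {a b} → 2 ^ a ≤ 2 ^ b → a ≤ b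
  2^-cancel-≤ {a} {b} h with a ≤? b
  ... | yes a≤b = a≤b
  ... | no a≰b = contradiction h (<⇒≱ (^-monoʳ-< 2 (s≤s z<s) (≰⇒> a≰b)))

  2^sum≤∏ : ∀ (w e : ℕ → ℕ) ps → All (λ p → 2 ^ w p ≤ p) ps →
            2 ^ sum (map (λ p → w p * e p) ps) ≤ product (map (λ p → p ^ e p) ps)
  2^sum≤∏ w e [] _ = ≤-refl
  2^sum≤∏ w e (p ∷ ps) (h ∷ hs) = begin
    2 ^ (w p * e p + sum (map (λ p → w p * e p) ps))       ≡⟨ ^-distribˡ-+-* 2 (w p * e p) _ ⟩
    2 ^ (w p * e p) * 2 ^ sum (map (λ p → w p * e p) ps)   ≡⟨ cong (_* _) (^-*-assoc 2 (w p) (e p)) ⟨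
    (2 ^ w p) ^ e p * 2 ^ sum (map (λ p → w p * e p) ps)   ≤⟨ *-mono-≤ (^-monoˡ-≤ (e p) h) (2^sum≤∏ w e ps hs) ⟩
    p ^ e p * product (map (λ p → p ^ e p) ps)             ∎
    where open ≤-Reasoning

  -- The upper half of Mertens' theorem in base-2 logarithms: divided by n = 2^κ x, it says that ∑
  -- log p / p over primes p > x is at most κ, up to rounding. The number 2^κ of blocks is free,
  -- which keeps the leading constant 1. `w p` may be any lower bound for the logarithm of p, so
  -- both `lg p` and a constant on a bucket qualify.
  ∑log*div≤ : ∀ κ x (w : ℕ → ℕ) ps → Unique ps → All Prime ps → All (x <_) ps → All (λ p → 2 ^ w p ≤ p) ps →
              sum (map (λ p → w p * ((2 ^ κ * x) div p)) ps) ≤ κ * (2 ^ κ * x)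
  ∑log*div≤ κ x w ps u prs x<ps hs = 2^-cancel-≤ (begin
    2 ^ sum (map (λ p → w p * (n div p)) ps)   ≤⟨ 2^sum≤∏ w (n div_) ps hs ⟩
    product (map (λ p → p ^ (n div p)) ps)     ≤⟨ ∏^div≤ (2 ^ κ) x ps u prs x<ps ⟩
    (2 ^ κ) ^ n                                ≡⟨ ^-*-assoc 2 κ n ⟩
    2 ^ (κ * n)                                ∎)
    where
    open ≤-Reasoning
    n = 2 ^ κ * x

  -- Legendre: n = qp + r gives n! = p^q q! u with p ∤ u.
  !-decompose : ∀ {p} → Prime p → ∀ q r → r < p → ∃[ u ] p ∤ u × (r + q * p) ! ≡ p ^ q * q ! * u
  !-decompose pp zero zero _ = 1 , (λ d → contradiction (subst Prime (∣1⇒≡1 d) pp) ¬prime[1]) , refl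
  !-decompose {suc p′} pp (suc q) zero _ with !-decompose pp q p′ ≤-refl
  ... | u , p∤u , eq = u , p∤u , trans (cong (suc q * suc p′ *_) eq) (lem (suc p′) (suc q) (suc p′ ^ q) (q !) u)
    where
    lem : ∀ p q a b u → q * p * (a * b * u) ≡ p * a * (q * b) * u
    lem = solve-∀
  !-decompose {p} pp q (suc r) r<p with !-decompose pp q r (<-trans (n<1+n r) r<p)
  ... | u , p∤u , eq = suc (r + q * p) * u , p∤ , trans (cong (suc (r + q * p) *_) eq) (lem (suc (r + q * p)) (p ^ q * q !) u)
    where
    lem : ∀ a b u → a * (b * u) ≡ b * (a * u)
    lem = solve-∀
    p∤ : p ∤ suc (r + q * p) * u
    p∤ d with euclidsLemma (suc (r + q * p)) u pp d
    ... | inj₁ d₁ = >⇒∤ r<p (∣m+n∣m⇒∣n (subst (p ∣_) (+-comm (suc r) (q * p)) d₁) (n∣m*n q))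
    ... | inj₂ d₂ = p∤u d₂

  -- Quantifying over all v with p^v dividing n! avoids a valuation function. With q = n / p and v ≥
  -- q, the decomposition leaves p^(v - q) dividing q!, and induction gives v(p - 1) ≤ q(p - 1) + q
  -- = qp ≤ n.
  legendre : ∀ {p} → Prime p → ∀ n v → p ^ v ∣ n ! → v * pred p ≤ n
  legendre {p} pp = <-rec (λ n → ∀ v → p ^ v ∣ n ! → v * pred p ≤ n) step
    where
    0<p = <-trans z<s (prime⇒1< pp)
    step : ∀ n → (∀ {m} → m < n → ∀ v → p ^ v ∣ m ! → v * pred p ≤ m) → ∀ v → p ^ v ∣ n ! → v * pred p ≤ n
    step n rec v d with !-decompose pp ((n / p) {{prime⇒nonZero pp}}) ((n % p) {{prime⇒nonZero pp}}) (m%n<n n p {{prime⇒nonZero pp}})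
    ... | u , p∤u , eq = go v (prime-∤⇒^∣-cancel pp p∤u v
            (subst (p ^ v ∣_) (trans (trans (cong _! n≡) eq) (*-comm _ u)) d)) (≤-total v q)
      where
      instance _ = prime⇒nonZero pp
      q = n / p
      n≡ = m≡m%n+[m/n]*n n p
      qp≤n : q * p ≤ n
      qp≤n = m/n*n≤m n p
      go : ∀ v → p ^ v ∣ p ^ q * q ! → v ≤ q ⊎ q ≤ v → v * pred p ≤ n
      go v d (inj₁ v≤q) = ≤-trans (*-mono-≤ v≤q pred[n]≤n) qp≤n
      go v d (inj₂ q≤v) = lem (v ∸ q) (sym (m+[n∸m]≡n q≤v)) (q ≟ 0)
        where
        open ≤-Reasoning
        lem : ∀ w → v ≡ q + w → Dec (q ≡ 0) → v * pred p ≤ n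
        lem w refl (no q≢0) = begin
          (q + w) * pred p          ≡⟨ *-distribʳ-+ (pred p) q w ⟩
          q * pred p + w * pred p   ≤⟨ +-monoʳ-≤ (q * pred p) (rec q<n w (*-cancelˡ-∣ (p ^ q) {{m^n≢0 p q}}
                                         (subst (_∣ p ^ q * q !) (^-distribˡ-+-* p q w) d))) ⟩
          q * pred p + q            ≡⟨ +-comm (q * pred p) q ⟩
          q + q * pred p            ≡⟨ *-suc q (pred p) ⟨
          q * suc (pred p)          ≡⟨ cong (q *_) (suc-pred p) ⟩
          q * p                     ≤⟨ qp≤n ⟩
          n                         ∎
          where
          q<n : q < n
          q<n = <-≤-trans (subst (_< q * p) (*-identityʳ q) (*-monoʳ-< q {{≢-nonZero q≢0}} (prime⇒1< pp))) qp≤n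
        -- If q = 0, then q < n may fail, so no recursive call is made: p^w divides 0! = 1, which
        -- forces w = 0.
        lem zero refl (yes q≡0) rewrite q≡0 = z≤n
        lem (suc w) refl (yes q≡0) = contradiction (subst Prime (∣1⇒≡1 (∣-trans (m∣m*n (p ^ w)) p^w∣1)) pp) ¬prime[1]
          where
          p^w∣1 : p ^ suc w ∣ 1
          p^w∣1 = subst (λ q → p ^ (q + suc w) ∣ p ^ q * q !) q≡0 d

  -- Sums over lists, integer logarithms and lists of primes

  sum-map-mono : ∀ {g h : ℕ → ℕ} xs → (∀ {x} → x ∈ xs → g x ≤ h x) → sum (map g xs) ≤ sum (map h xs)
  sum-map-mono [] _ = z≤n
  sum-map-mono (x ∷ xs) le = +-mono-≤ (le (here refl)) (sum-map-mono xs (le ∘ there))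

  sum-map-+ : ∀ (g h : ℕ → ℕ) xs → sum (map (λ x → g x + h x) xs) ≡ sum (map g xs) + sum (map h xs)
  sum-map-+ g h [] = refl
  sum-map-+ g h (x ∷ xs) = trans (cong (g x + h x +_) (sum-map-+ g h xs)) (lem (g x) (h x) (sum (map g xs)) (sum (map h xs)))
    where
    lem : ∀ a b c d → a + b + (c + d) ≡ a + c + (b + d)
    lem = solve-∀

  sum-map-*ˡ : ∀ k (g : ℕ → ℕ) xs → sum (map (λ x → k * g x) xs) ≡ k * sum (map g xs)
  sum-map-*ˡ k g [] = sym (*-zeroʳ k)
  sum-map-*ˡ k g (x ∷ xs) = trans (cong (k * g x +_) (sum-map-*ˡ k g xs)) (sym (*-distribˡ-+ k (g x) (sum (map g xs))))

  sum-map-≤-length : ∀ {g : ℕ → ℕ} {k} xs → (∀ {x} → x ∈ xs → g x ≤ k) → sum (map g xs) ≤ length xs * k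
  sum-map-≤-length [] _ = z≤n
  sum-map-≤-length (x ∷ xs) le = +-mono-≤ (le (here refl)) (sum-map-≤-length xs (le ∘ there))

  -- The integer part of the base-2 logarithm, with the default value `lg 0 = 0`.
  lg : ℕ → ℕ
  lg zero = 0
  lg (suc n) with 2 ^ suc (lg n) ≤? suc n
  ... | yes _ = suc (lg n)
  ... | no  _ = lg n

  2^lg≤ : ∀ n → 2 ^ lg (suc n) ≤ suc n
  2^lg≤ n with 2 ^ suc (lg n) ≤? suc n
  2^lg≤ n       | yes h = h
  2^lg≤ zero    | no _  = ≤-refl
  2^lg≤ (suc n) | no _  = m≤n⇒m≤1+n (2^lg≤ n)

  <2^suc-lg : ∀ n → n < 2 ^ suc (lg n)
  <2^suc-lg zero = z<s
  <2^suc-lg (suc n) with 2 ^ suc (lg n) ≤? suc n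
  ... | no h  = ≰⇒> h
  ... | yes _ = ≤-<-trans (<2^suc-lg n) (^-monoʳ-< 2 (s≤s z<s) (n<1+n (suc (lg n))))

  2^≤⇒≤lg : ∀ {k n} → 2 ^ k ≤ n → k ≤ lg n
  2^≤⇒≤lg {k} {n} h = s≤s⁻¹ (≰⇒> λ le → <⇒≱ (<2^suc-lg n) (≤-trans (^-monoʳ-≤ 2 le) h))

  ≤2^⇒lg≤ : ∀ {k n} → 0 < n → n ≤ 2 ^ k → lg n ≤ k
  ≤2^⇒lg≤ {n = suc n} _ h = 2^-cancel-≤ (≤-trans (2^lg≤ n) h)

  range : ℕ → ℕ → List ℕ
  range a zero    = []
  range a (suc l) = suc a ∷ range (suc a) l

  range-++ : ∀ a l m → range a (l + m) ≡ range a l ++ range (a + l) m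
  range-++ a zero m = cong (λ b → range b m) (sym (+-identityʳ a))
  range-++ a (suc l) m = cong (suc a ∷_) (trans (range-++ (suc a) l m) (cong (λ b → range (suc a) l ++ range b m) (sym (+-suc a l))))

  length-range : ∀ a l → length (range a l) ≡ l
  length-range a zero = refl
  length-range a (suc l) = cong suc (length-range (suc a) l)

  ∈-range⁻ : ∀ {x} a l → x ∈ range a l → a < x × x ≤ a + l
  ∈-range⁻ a (suc l) (here refl) = ≤-refl , subst (suc a ≤_) (sym (+-suc a l)) (s≤s (m≤m+n a l))
  ∈-range⁻ {x} a (suc l) (there x∈) with ∈-range⁻ (suc a) l x∈
  ... | a<x , x≤ = <-trans (n<1+n a) a<x , subst (x ≤_) (sym (+-suc a l)) x≤

  ∈-range⁺ : ∀ {x} a l → a < x → x ≤ a + l → x ∈ range a l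
  ∈-range⁺ {x} a zero a<x x≤ = contradiction (subst (x ≤_) (+-identityʳ a) x≤) (<⇒≱ a<x)
  ∈-range⁺ {x} a (suc l) a<x x≤ with x ≟ suc a
  ... | yes refl = here refl
  ... | no x≢    = there (∈-range⁺ (suc a) l (≤∧≢⇒< a<x (x≢ ∘ sym)) (subst (x ≤_) (+-suc a l) x≤))

  range-unique : ∀ a l → Unique (range a l)
  range-unique a zero = []
  range-unique a (suc l) = All.tabulate (λ x∈ → <⇒≢ (proj₁ (∈-range⁻ (suc a) l x∈))) ∷ range-unique (suc a) l

  -- The half-open interval a < p ≤ b.
  primes : ℕ → ℕ → List ℕ
  primes a b = filter prime? (range a (b ∸ a))

  primes-unique : ∀ a b → Unique (primes a b)
  primes-unique a b = Uniqueₚ.filter⁺ prime? (range-unique a (b ∸ a))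

  primes-++ : ∀ {a b c} → a ≤ b → b ≤ c → primes a c ≡ primes a b ++ primes b c
  primes-++ {a} {b} {c} a≤b b≤c = begin
    filter prime? (range a (c ∸ a))                                 ≡⟨ cong (filter prime? ∘ range a) eq ⟩
    filter prime? (range a ((b ∸ a) + (c ∸ b)))                     ≡⟨ cong (filter prime?) (range-++ a (b ∸ a) (c ∸ b)) ⟩
    filter prime? (range a (b ∸ a) ++ range (a + (b ∸ a)) (c ∸ b))  ≡⟨ filter-++ prime? (range a (b ∸ a)) _ ⟩
    primes a b ++ filter prime? (range (a + (b ∸ a)) (c ∸ b))       ≡⟨ cong (λ d → primes a b ++ filter prime? (range d (c ∸ b))) (m+[n∸m]≡n a≤b) ⟩
    primes a b ++ primes b c                                        ∎
    where
    open ≡-Reasoning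
    eq : c ∸ a ≡ (b ∸ a) + (c ∸ b)
    eq = +-cancelˡ-≡ a _ _ (trans (m+[n∸m]≡n (≤-trans a≤b b≤c))
           (sym (trans (sym (+-assoc a (b ∸ a) (c ∸ b))) (trans (cong (_+ (c ∸ b)) (m+[n∸m]≡n a≤b)) (m+[n∸m]≡n b≤c)))))

  ∈-primes⁻ : ∀ {a b p} → a ≤ b → p ∈ primes a b → Prime p × a < p × p ≤ b
  ∈-primes⁻ {a} {b} {p} a≤b p∈ with ∈-filter⁻ prime? {xs = range a (b ∸ a)} p∈
  ... | p∈r , pp with ∈-range⁻ a (b ∸ a) p∈r
  ... | a<p , p≤ = pp , a<p , subst (p ≤_) (m+[n∸m]≡n a≤b) p≤

  ∈-primes⁺ : ∀ {a b p} → Prime p → a < p → p ≤ b → p ∈ primes a b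
  ∈-primes⁺ {a} {b} {p} pp a<p p≤b = ∈-filter⁺ prime?
    (∈-range⁺ a (b ∸ a) a<p (subst (p ≤_) (sym (m+[n∸m]≡n (<⇒≤ (<-≤-trans a<p p≤b)))) p≤b)) pp

  length-primes≤ : ∀ b → length (primes 0 b) ≤ b
  length-primes≤ b = ≤-trans (length-filter prime? (range 0 b)) (≤-reflexive (length-range 0 b))

  -- The prime factorisation of a factorial

  indicator : ℕ → ℕ → ℕ
  indicator p q with p ≟ q
  ... | yes _ = 1
  ... | no  _ = 0

  multiplicity : ℕ → List ℕ → ℕ
  multiplicity p fs = sum (map (indicator p) fs)

  ^multiplicity∣product : ∀ p fs → p ^ multiplicity p fs ∣ product fs
  ^multiplicity∣product p [] = ∣-refl
  ^multiplicity∣product p (f ∷ fs) with p ≟ f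
  ... | yes refl = *-monoʳ-∣ p (^multiplicity∣product p fs)
  ... | no _     = ∣n⇒∣m*n f (^multiplicity∣product p fs)

  sum≤∑multiplicity : ∀ (w : ℕ → ℕ) ps fs → (∀ {f} → f ∈ fs → f ∈ ps) →
                      sum (map w fs) ≤ sum (map (λ p → multiplicity p fs * w p) ps)
  sum≤∑multiplicity w ps [] _ = z≤n
  sum≤∑multiplicity w ps (f ∷ fs) fs⊆ps = begin
    w f + sum (map w fs)
      ≤⟨ +-mono-≤ (single ps (fs⊆ps (here refl))) (sum≤∑multiplicity w ps fs (fs⊆ps ∘ there)) ⟩
    sum (map (λ p → indicator p f * w p) ps) + sum (map (λ p → multiplicity p fs * w p) ps)
      ≡⟨ sum-map-+ (λ p → indicator p f * w p) (λ p → multiplicity p fs * w p) ps ⟨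
    sum (map (λ p → indicator p f * w p + multiplicity p fs * w p) ps)
      ≤⟨ sum-map-mono ps (λ {p} _ → ≤-reflexive (sym (*-distribʳ-+ (w p) (indicator p f) (multiplicity p fs)))) ⟩
    sum (map (λ p → multiplicity p (f ∷ fs) * w p) ps) ∎
    where
    open ≤-Reasoning
    single : ∀ qs → f ∈ qs → w f ≤ sum (map (λ p → indicator p f * w p) qs)
    single (q ∷ qs) (here refl) with f ≟ f
    ... | yes _   = ≤-trans (m≤m+n (w f) 0) (m≤m+n (w f + 0) _)
    ... | no f≢f  = contradiction refl f≢f
    single (q ∷ qs) (there f∈) = m≤n⇒m≤o+n _ (single qs f∈)

  product≤2^∑lg : ∀ fs → All Prime fs → product fs ≤ 2 ^ sum (map (suc ∘ lg) fs)
  product≤2^∑lg [] _ = ≤-refl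
  product≤2^∑lg (f ∷ fs) (_ ∷ prs) = ≤-trans (*-mono-≤ (<⇒≤ (<2^suc-lg f)) (product≤2^∑lg fs prs))
    (≤-reflexive (sym (^-distribˡ-+-* 2 (suc (lg f)) _)))

  ^*!≤[+]! : ∀ n m → n ^ m * n ! ≤ (m + n) !
  ^*!≤[+]! n zero = ≤-reflexive (+-identityʳ (n !))
  ^*!≤[+]! n (suc m) = ≤-trans (≤-reflexive (*-assoc n (n ^ m) (n !)))
    (*-mono-≤ (m≤n⇒m≤1+n (m≤n+m n m)) (^*!≤[+]! n m))

  -- A weak Stirling bound n log n - 2 n ≤ log n!, for n a power of 2.
  [2^]!-lower : ∀ j → 2 ^ (j * 2 ^ j) ≤ 2 ^ (2 * 2 ^ j) * (2 ^ j) !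
  [2^]!-lower zero = s≤s z≤n
  [2^]!-lower (suc j) = begin
    2 ^ (suc j * (2 * N))                        ≡⟨ cong (2 ^_) (e₁ j N) ⟩
    2 ^ (2 * N + j * N + j * N)                  ≡⟨ trans (^-distribˡ-+-* 2 (2 * N + j * N) (j * N)) (cong (_* 2 ^ (j * N)) (^-distribˡ-+-* 2 (2 * N) (j * N))) ⟩
    2 ^ (2 * N) * 2 ^ (j * N) * 2 ^ (j * N)      ≤⟨ *-monoʳ-≤ (2 ^ (2 * N) * 2 ^ (j * N)) ([2^]!-lower j) ⟩
    2 ^ (2 * N) * 2 ^ (j * N) * (2 ^ (2 * N) * N !)  ≡⟨ e₂ (2 ^ (2 * N)) (2 ^ (j * N)) (N !) ⟩
    2 ^ (2 * N) * 2 ^ (2 * N) * (2 ^ (j * N) * N !)  ≡⟨ cong₂ (λ a b → a * (b * N !)) (trans (sym (^-distribˡ-+-* 2 (2 * N) (2 * N))) (cong (2 ^_) (e₃ N))) (sym (^-*-assoc 2 j N)) ⟩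
    2 ^ (2 * (2 * N)) * (N ^ N * N !)            ≤⟨ *-monoʳ-≤ (2 ^ (2 * (2 * N))) (^*!≤[+]! N N) ⟩
    2 ^ (2 * (2 * N)) * (N + N) !                ≡⟨ cong (λ m → 2 ^ (2 * (2 * N)) * m !) (cong (N +_) (sym (+-identityʳ N))) ⟩
    2 ^ (2 * (2 * N)) * (2 * N) !                ∎
    where
    open ≤-Reasoning
    N = 2 ^ j
    e₁ : ∀ j N → suc j * (2 * N) ≡ 2 * N + j * N + j * N
    e₁ = solve-∀
    e₂ : ∀ a b c → a * b * (a * c) ≡ a * a * (b * c)
    e₂ = solve-∀
    e₃ : ∀ N → 2 * N + 2 * N ≡ 2 * (2 * N)
    e₃ = solve-∀

  -- The logarithm of n! for n = 2^j is bounded from below by the weak Stirling bound and from above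
  -- through its prime factorisation, with log f rounded up to `lg f + 1`. The rounding is cheap
  -- later, because p > 2^r has `lg p` ≥ r. The function `v` gives the exponents in n!, of which
  -- only Legendre's bound is passed on.
  ∑valuation-lower : ∀ j → ∃[ v ] (∀ {p} → Prime p → v p * pred p ≤ 2 ^ j) ×
                     j * 2 ^ j ≤ 2 * 2 ^ j + sum (map (λ p → v p * suc (lg p)) (primes 0 (2 ^ j)))
  ∑valuation-lower j = (λ p → multiplicity p fs) , bound , (begin
      j * n                                 ≤⟨ 2^-cancel-≤ (begin
        2 ^ (j * n)                           ≤⟨ [2^]!-lower j ⟩
        2 ^ (2 * n) * n !                     ≡⟨ cong (2 ^ (2 * n) *_) (isFactorisation F) ⟩
        2 ^ (2 * n) * product fs              ≤⟨ *-monoʳ-≤ (2 ^ (2 * n)) (product≤2^∑lg fs (factorsPrime F)) ⟩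
        2 ^ (2 * n) * 2 ^ sum (map (suc ∘ lg) fs)   ≡⟨ ^-distribˡ-+-* 2 (2 * n) _ ⟨
        2 ^ (2 * n + sum (map (suc ∘ lg) fs)) ∎) ⟩
      2 * n + sum (map (suc ∘ lg) fs)       ≤⟨ +-monoʳ-≤ (2 * n) (sum≤∑multiplicity (suc ∘ lg) (primes 0 n) fs fs⊆) ⟩
      2 * n + sum (map (λ p → multiplicity p fs * suc (lg p)) (primes 0 n)) ∎)
    where
    open ≤-Reasoning
    open PrimeFactorisation
    n = 2 ^ j
    F = factorise (n !) {{n !≢0}}
    fs = factors F
    bound : ∀ {p} → Prime p → multiplicity p fs * pred p ≤ n
    bound {p} pp = legendre pp n (multiplicity p fs) (subst (p ^ multiplicity p fs ∣_) (sym (isFactorisation F)) (^multiplicity∣product p fs))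
    fs⊆ : ∀ {f} → f ∈ fs → f ∈ primes 0 n
    fs⊆ {f} f∈ = ∈-primes⁺ pf (<-trans z<s (prime⇒1< pf))
      (≮⇒≥ λ n<f → ∤! pf n n<f (subst (f ∣_) (sym (isFactorisation F)) (∈⇒∣product f∈)))
      where pf = All.lookup (factorsPrime F) f∈

  -- v (p - 1) ≤ n and n′ < (f + 1) p turn v into f · n / n′ up to factors 1 + 1/2ʳ.
  valuation≤quotient : ∀ {v p n′ f} R T d → v * pred p ≤ d * n′ → n′ < suc f * p → R < p → T ≤ f →
                       v * R * T ≤ d * f * (suc R * suc T)
  valuation≤quotient {v} {suc p} {n′} {f} R T d vp≤ n′< R<p T≤f = *-cancelʳ-≤ _ _ (suc p) (begin
    v * R * T * suc p               ≡⟨ e₁ v R T p ⟩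
    v * T * (p * R + R)             ≤⟨ *-monoʳ-≤ (v * T) (+-monoʳ-≤ (p * R) (s≤s⁻¹ R<p)) ⟩
    v * T * (p * R + p)             ≡⟨ e₂ v R T p ⟩
    T * suc R * (v * p)             ≤⟨ *-monoʳ-≤ (T * suc R) (≤-trans vp≤ (*-monoʳ-≤ d (<⇒≤ n′<))) ⟩
    T * suc R * (d * (suc f * suc p)) ≡⟨ e₃ R T d f p ⟩
    (T + T * f) * (suc R * d * suc p) ≤⟨ *-monoˡ-≤ (suc R * d * suc p) (+-monoˡ-≤ (T * f) T≤f) ⟩
    (f + T * f) * (suc R * d * suc p) ≡⟨ e₄ R T d f p ⟩
    d * f * (suc R * suc T) * suc p ∎)
    where
    open ≤-Reasoning
    e₁ : ∀ v R T p → v * R * T * suc p ≡ v * T * (p * R + R)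
    e₁ = solve-∀
    e₂ : ∀ v R T p → v * T * (p * R + p) ≡ T * suc R * (v * p)
    e₂ = solve-∀
    e₃ : ∀ R T d f p → T * suc R * (d * (suc f * suc p)) ≡ (T + T * f) * (suc R * d * suc p)
    e₃ = solve-∀
    e₄ : ∀ R T d f p → (f + T * f) * (suc R * d * suc p) ≡ d * f * (suc R * suc T) * suc p
    e₄ = solve-∀

  -- The lower half of Mertens' theorem, for primes between 2^e and 2^j

  module _ (r e j : ℕ) (r≤e : r ≤ e) (e+r≤j : e + r ≤ j)
           (v : ℕ → ℕ) (v-bound : ∀ {p} → Prime p → v p * pred p ≤ 2 ^ j) where

    private
      R = 2 ^ r
      N = 2 ^ j
      T : ℕ → ℕ
      T p = v p * suc (lg p)
      ∑T : ℕ → ℕ → ℕ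
      ∑T a b = sum (map T (primes a b))

      R≤x : R ≤ 2 ^ e
      R≤x = ^-monoʳ-≤ 2 r≤e
      e≤j : e ≤ j
      e≤j = ≤-trans (m≤m+n e r) e+r≤j
      x≤N : 2 ^ e ≤ N
      x≤N = ^-monoʳ-≤ 2 e≤j

    -- Crude on purpose: after division by `N` only a constant depending on r remains, and h is
    -- later taken much larger than it.
    small-primes : ∑T 0 R ≤ R * (N * suc r)
    small-primes = ≤-trans (sum-map-≤-length (primes 0 R) bound) (*-monoˡ-≤ (N * suc r) (length-primes≤ R))
      where
      bound : ∀ {p} → p ∈ primes 0 R → T p ≤ N * suc r
      bound {p} p∈ with ∈-primes⁻ z≤n p∈
      ... | pp , 0<p , p≤R = *-mono-≤ (≤-trans (m≤m*n (v p) (pred p) {{>-nonZero (pred-mono-≤ (prime⇒1< pp))}}) (v-bound pp))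
                               (s≤s (≤2^⇒lg≤ 0<p p≤R))

    -- These primes are to be discarded, so their share is bounded from above, by `∑log*div≤` with x
    -- = 1. It is applied to `n′` = 2^(e + r) instead of `N`: with `N` it would give jN, about the
    -- whole logarithm of N!, whereas rescaling from `n′` by `D` gives about (e + r)N. The extra 2^r
    -- keeps every quotient n′ / p at least `R`. The three factors of `K` pay for p - 1 against p,
    -- for rounding the quotient, and for `lg p + 1` against `lg p`.
    mid-primes : R * R * r * ∑T R (2 ^ e) ≤ N * (suc R * suc R * suc r) * (e + r)
    mid-primes = begin
      R * R * r * ∑T R (2 ^ e)                                   ≡⟨ sum-map-*ˡ (R * R * r) T ps ⟨
      sum (map (λ p → R * R * r * T p) ps)                       ≤⟨ sum-map-mono ps bound ⟩
      sum (map (λ p → D * K * (lg p * (n′ div p))) ps)           ≡⟨ sum-map-*ˡ (D * K) (λ p → lg p * (n′ div p)) ps ⟩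
      D * K * sum (map (λ p → lg p * (n′ div p)) ps)             ≤⟨ *-monoʳ-≤ (D * K) (∑log*div≤ (e + r) 1 lg ps (primes-unique R (2 ^ e))
                                                                      (All.tabulate (proj₁ ∘ mem)) (All.tabulate (prime⇒1< ∘ proj₁ ∘ mem))
                                                                      (All.tabulate λ { {suc p} _ → 2^lg≤ p ; {zero} p∈ → contradiction₀ p∈ })) ⟩
      D * K * ((e + r) * n′)                                     ≡⟨ e₂ D K (e + r) n′ ⟩
      D * n′ * K * (e + r)                                       ≡⟨ cong (λ m → m * K * (e + r)) D*n′≡N ⟩
      N * K * (e + r)                                            ∎
      where
      open ≤-Reasoning
      ps = primes R (2 ^ e)
      K = suc R * suc R * suc r
      D = 2 ^ (j ∸ (e + r))
      n′ = 2 ^ (e + r) * 1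
      e₂ : ∀ D K s n → D * K * (s * n) ≡ D * n * K * s
      e₂ = solve-∀
      D*n′≡N : D * n′ ≡ N
      D*n′≡N = trans (cong (D *_) (*-identityʳ _)) (trans (sym (^-distribˡ-+-* 2 (j ∸ (e + r)) (e + r))) (cong (2 ^_) (m∸n+n≡m e+r≤j)))
      mem : ∀ {p} → p ∈ ps → Prime p × R < p × p ≤ 2 ^ e
      mem = ∈-primes⁻ R≤x
      contradiction₀ : zero ∈ ps → 2 ^ 0 ≤ 0
      contradiction₀ p∈ with proj₁ (proj₂ (mem p∈))
      ... | ()
      bound : ∀ {p} → p ∈ ps → R * R * r * T p ≤ D * K * (lg p * (n′ div p))
      bound {p} p∈ with mem p∈
      ... | pp , R<p , p≤x = begin
        R * R * r * (v p * suc l)                     ≡⟨ e₃ R r (v p) l ⟩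
        v p * R * R * (r * l + r)                     ≤⟨ *-mono-≤ (valuation≤quotient {v p} {p} {n′} {q} R R D
                                                           (subst (v p * pred p ≤_) (sym D*n′≡N) (v-bound pp))
                                                           (<-suc-div-* n′ p 0<p) R<p
                                                           (≤-div R n′ p 0<p R*p≤n′))
                                                         (+-monoʳ-≤ (r * l) (2^≤⇒≤lg {r} {p} (<⇒≤ R<p))) ⟩
        D * q * (suc R * suc R) * (r * l + l)         ≡⟨ e₄ D q (suc R * suc R) r l ⟩
        D * K * (l * q)                               ∎
        where
        l = lg p
        q = n′ div p
        0<p = <-trans z<s (prime⇒1< pp)
        R*p≤n′ : R * p ≤ n′
        R*p≤n′ = begin
          R * p               ≤⟨ *-monoʳ-≤ R p≤x ⟩
          R * 2 ^ e           ≡⟨ *-comm R (2 ^ e) ⟩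
          2 ^ e * R           ≡⟨ ^-distribˡ-+-* 2 e r ⟨
          2 ^ (e + r)         ≡⟨ *-identityʳ _ ⟨
          n′                  ∎
        e₃ : ∀ R r v l → R * R * r * (v * suc l) ≡ v * R * R * (r * l + r)
        e₃ = solve-∀
        e₄ : ∀ D q K r l → D * q * K * (r * l + l) ≡ D * (K * suc r) * (l * q)
        e₄ = solve-∀

    large-primes : ∑T (2 ^ e) N ≤ suc j * sum (map v (primes (2 ^ e) N))
    large-primes = ≤-trans (sum-map-mono (primes (2 ^ e) N) bound) (≤-reflexive (sum-map-*ˡ (suc j) v (primes (2 ^ e) N)))
      where
      bound : ∀ {p} → p ∈ primes (2 ^ e) N → T p ≤ suc j * v p
      bound {p} p∈ with ∈-primes⁻ x≤N p∈
      ... | pp , _ , p≤N = ≤-trans (*-monoʳ-≤ (v p) (s≤s (≤2^⇒lg≤ (<-trans z<s (prime⇒1< pp)) p≤N))) (≤-reflexive (*-comm (v p) (suc j)))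

    ∑T-split : ∑T 0 N ≡ ∑T 0 R + ∑T R (2 ^ e) + ∑T (2 ^ e) N
    ∑T-split = begin
      sum (map T (primes 0 N))                                 ≡⟨ cong (sum ∘ map T) (trans (primes-++ z≤n (≤-trans R≤x x≤N)) (cong (primes 0 R ++_) (primes-++ R≤x x≤N))) ⟩
      sum (map T (primes 0 R ++ primes R (2 ^ e) ++ primes (2 ^ e) N))  ≡⟨ split (primes 0 R) _ ⟩
      ∑T 0 R + sum (map T (primes R (2 ^ e) ++ primes (2 ^ e) N))       ≡⟨ cong (∑T 0 R +_) (split (primes R (2 ^ e)) _) ⟩
      ∑T 0 R + (∑T R (2 ^ e) + ∑T (2 ^ e) N)                   ≡⟨ +-assoc (∑T 0 R) _ _ ⟨
      ∑T 0 R + ∑T R (2 ^ e) + ∑T (2 ^ e) N                     ∎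
      where
      open ≡-Reasoning
      split : ∀ xs ys → sum (map T (xs ++ ys)) ≡ sum (map T xs) + sum (map T ys)
      split xs ys = trans (cong sum (map-++ T xs ys)) (sum-++ (map T xs) (map T ys))

    -- All primes up to 2^j carry about jN, those up to 2^e at most about eN, so the others carry
    -- about (j - e)N or more. As their logarithms are at most j, this bounds the sum of their
    -- exponents from below.
    mertens-lower : j * N ≤ 2 * N + ∑T 0 N →
      R * R * r * (j * N) ≤ R * R * r * (2 * N + R * (N * suc r) + suc j * sum (map v (primes (2 ^ e) N)))
                            + N * (suc R * suc R * suc r) * (e + r)
    mertens-lower h = begin
      R * R * r * (j * N)                                      ≤⟨ *-monoʳ-≤ K h ⟩
      K * (2 * N + ∑T 0 N)                                     ≡⟨ cong (λ s → K * (2 * N + s)) ∑T-split ⟩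
      K * (2 * N + (∑T 0 R + ∑T R (2 ^ e) + ∑T (2 ^ e) N))     ≡⟨ lem K N (∑T 0 R) (∑T R (2 ^ e)) (∑T (2 ^ e) N) ⟩
      K * (2 * N + ∑T 0 R + ∑T (2 ^ e) N) + K * ∑T R (2 ^ e)   ≤⟨ +-mono-≤ (*-monoʳ-≤ K (+-mono-≤ (+-monoʳ-≤ (2 * N) small-primes) large-primes)) mid-primes ⟩
      K * (2 * N + R * (N * suc r) + suc j * sum (map v (primes (2 ^ e) N))) + N * (suc R * suc R * suc r) * (e + r) ∎
      where
      open ≤-Reasoning
      K = R * R * r
      lem : ∀ K N a b c → K * (2 * N + (a + b + c)) ≡ K * (2 * N + a + c) + K * b
      lem = solve-∀

open PrimeEstimates

open import Data.Rational.Base as ℚ using (ℚ; 0ℚ; 1ℚ; ½; _+_; _*_; _≤_; _-_; -_; ∣_∣; _⊔_; positive; nonNegative)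
import Data.Rational.Properties as ℚₚ
open import Data.Rational.Solver using (module +-*-Solver)
open +-*-Solver using (solve; _:=_; _:+_; _:*_; _:-_; con)

-- Rational casts, reciprocals and finite rational sums

abstract
  -- Abstract, so that casts of numerals such as 10^9 and their reciprocals stay atoms for the ring
  -- solver and are not normalised as fractions. `constants` stands inside the block because it
  -- evaluates them.
  ι : ℕ → ℚ
  ι n = frac n 0

  -- The reciprocal, with the junk value ⅟ 0 = 1.
  ⅟ : ℕ → ℚ
  ⅟ n = frac 1 (pred n)

  ι≡frac : ∀ n → ι n ≡ frac n 0
  ι≡frac n = refl

  ⅟≡frac : ∀ d → ⅟ (suc d) ≡ frac 1 d
  ⅟≡frac d = refl

  ι1 : ι 1 ≡ 1ℚ
  ι1 = refl

  ι-+ : ∀ m n → ι (m ℕ.+ n) ≡ ι m + ι n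
  ι-+ m n = sym (frac-+ m n 0)

  ι-* : ∀ m n → ι (m ℕ.* n) ≡ ι m * ι n
  ι-* zero n = trans (frac-0 0) (sym (trans (cong (_* ι n) (frac-0 0)) (ℚₚ.*-zeroˡ (ι n))))
  ι-* (suc m) n = begin
    ι (n ℕ.+ m ℕ.* n)        ≡⟨ ι-+ n (m ℕ.* n) ⟩
    ι n + ι (m ℕ.* n)        ≡⟨ cong (ι n +_) (ι-* m n) ⟩
    ι n + ι m * ι n          ≡⟨ solve 2 (λ a b → b :+ a :* b := (con 1ℚ :+ a) :* b) refl (ι m) (ι n) ⟩
    (1ℚ + ι m) * ι n         ≡⟨ cong (_* ι n) (ι-+ 1 m) ⟨
    ι (suc m) * ι n          ∎
    where open ≡-Reasoning

  ι-mono : ∀ {m n} → m ℕ.≤ n → ι m ≤ ι n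
  ι-mono {m} {n} h = frac-≤ {m} {0} {n} {0} (ℕₚ.*-monoˡ-≤ 1 h)

  0≤ι : ∀ n → 0ℚ ≤ ι n
  0≤ι n = 0≤frac n 0

  0≤⅟ : ∀ n → 0ℚ ≤ ⅟ n
  0≤⅟ n = 0≤frac 1 (pred n)

  ι*⅟ : ∀ {n} → 0 ℕ.< n → ι n * ⅟ n ≡ 1ℚ
  ι*⅟ {suc d} _ = trans (scale (suc d)) (frac-≡ {suc d} {d} {1} {0} (ℕₚ.*-comm (suc d) 1))
    where
    scale : ∀ k → ι k * frac 1 d ≡ frac k d
    scale zero = trans (cong (_* frac 1 d) (frac-0 0)) (trans (ℚₚ.*-zeroˡ (frac 1 d)) (sym (frac-0 d)))
    scale (suc k) = begin
      ι (suc k) * frac 1 d               ≡⟨ cong (_* frac 1 d) (ι-+ 1 k) ⟩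
      (1ℚ + ι k) * frac 1 d              ≡⟨ solve 2 (λ a b → (con 1ℚ :+ a) :* b := b :+ a :* b) refl (ι k) (frac 1 d) ⟩
      frac 1 d + ι k * frac 1 d          ≡⟨ cong (frac 1 d +_) (scale k) ⟩
      frac 1 d + frac k d                ≡⟨ frac-+ 1 k d ⟩
      frac (suc k) d                     ∎
      where open ≡-Reasoning

  -- Bucket sums are controlled up to factors 99/100 and 101/100, and log (pq) up
  -- to 101/100; 2/19 bounds ∑ 1/i² over i ≥ 10 and 0.111 the double sum from below.
  constants : ι 101 * ⅟ 100 * (ι 2 * ⅟ 19) + ⅟ 1000 ≤
              ι 100 * ⅟ 101 * (ι 99 * ⅟ 100 * (ι 99 * ⅟ 100 * (ι 111000000 * ⅟ 1000000000)))
  constants = toWitness {a? = _ ℚₚ.≤? _} _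

0<ι : ∀ {n} → 0 ℕ.< n → 0ℚ ℚ.< ι n
0<ι {n} h = ℚₚ.<-≤-trans 0<1 (subst (_≤ ι n) ι1 (ι-mono h))

*-monoˡ : ∀ {r p q} → 0ℚ ≤ r → p ≤ q → r * p ≤ r * q
*-monoˡ {r} 0≤r = ℚₚ.*-monoˡ-≤-nonNeg r {{nonNegative 0≤r}}

*-monoʳ : ∀ {r p q} → 0ℚ ≤ r → p ≤ q → p * r ≤ q * r
*-monoʳ {r} 0≤r = ℚₚ.*-monoʳ-≤-nonNeg r {{nonNegative 0≤r}}

*-cancelˡ : ∀ {r p q} → 0ℚ ℚ.< r → r * p ≤ r * q → p ≤ q
*-cancelˡ {r} 0<r = ℚₚ.*-cancelˡ-≤-pos r {{positive 0<r}}

*-nonNeg : ∀ {p q} → 0ℚ ≤ p → 0ℚ ≤ q → 0ℚ ≤ p * q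
*-nonNeg {p} {q} 0≤p 0≤q = subst (_≤ p * q) (ℚₚ.*-zeroʳ p) (*-monoˡ 0≤p 0≤q)

+-nonNeg : ∀ {p q} → 0ℚ ≤ p → 0ℚ ≤ q → 0ℚ ≤ p + q
+-nonNeg = ℚₚ.+-mono-≤

p≤p+q : ∀ {p q} → 0ℚ ≤ q → p ≤ p + q
p≤p+q {p} {q} 0≤q = subst (_≤ p + q) (ℚₚ.+-identityʳ p) (ℚₚ.+-monoʳ-≤ p 0≤q)

module _ {A : Set} where

  sumℚ : List A → (A → ℚ) → ℚ
  sumℚ []       f = 0ℚ
  sumℚ (x ∷ xs) f = f x + sumℚ xs f

  sumℚ-++ : ∀ f xs ys → sumℚ (xs ++ ys) f ≡ sumℚ xs f + sumℚ ys f
  sumℚ-++ f [] ys = sym (ℚₚ.+-identityˡ _)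
  sumℚ-++ f (x ∷ xs) ys = trans (cong (f x +_) (sumℚ-++ f xs ys)) (sym (ℚₚ.+-assoc (f x) _ _))

  sumℚ-mono : ∀ {f g} xs → (∀ {x} → x ∈ xs → f x ≤ g x) → sumℚ xs f ≤ sumℚ xs g
  sumℚ-mono [] _ = ℚₚ.≤-refl
  sumℚ-mono (x ∷ xs) le = ℚₚ.+-mono-≤ (le (here refl)) (sumℚ-mono xs (le ∘ there))

  sumℚ-nonNeg : ∀ {f} xs → (∀ {x} → x ∈ xs → 0ℚ ≤ f x) → 0ℚ ≤ sumℚ xs f
  sumℚ-nonNeg [] _ = ℚₚ.≤-refl
  sumℚ-nonNeg (x ∷ xs) nn = +-nonNeg (nn (here refl)) (sumℚ-nonNeg xs (nn ∘ there))

  sumℚ-cong : ∀ {f g} xs → (∀ {x} → x ∈ xs → f x ≡ g x) → sumℚ xs f ≡ sumℚ xs g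
  sumℚ-cong [] _ = refl
  sumℚ-cong (x ∷ xs) eq = cong₂ _+_ (eq (here refl)) (sumℚ-cong xs (eq ∘ there))

  sumℚ-*ˡ : ∀ k f xs → sumℚ xs (λ x → k * f x) ≡ k * sumℚ xs f
  sumℚ-*ˡ k f [] = sym (ℚₚ.*-zeroʳ k)
  sumℚ-*ˡ k f (x ∷ xs) = trans (cong (k * f x +_) (sumℚ-*ˡ k f xs)) (sym (ℚₚ.*-distribˡ-+ k (f x) _))

  sumℚ-+ : ∀ f g xs → sumℚ xs (λ x → f x + g x) ≡ sumℚ xs f + sumℚ xs g
  sumℚ-+ f g [] = refl
  sumℚ-+ f g (x ∷ xs) = trans (cong (f x + g x +_) (sumℚ-+ f g xs))
    (solve 4 (λ a b c d → a :+ b :+ (c :+ d) := a :+ c :+ (b :+ d)) refl (f x) (g x) (sumℚ xs f) (sumℚ xs g))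

  sumℚ-⊆ : ∀ {f} → (∀ x → 0ℚ ≤ f x) → ∀ {xs} ys → Unique xs → (∀ {x} → x ∈ xs → x ∈ ys) → sumℚ xs f ≤ sumℚ ys f
  sumℚ-⊆ 0≤f {[]} ys _ _ = sumℚ-nonNeg ys (λ _ → 0≤f _)
  sumℚ-⊆ {f} 0≤f {x ∷ xs} ys (x∉xs ∷ u) sub with ∈-∃++ (sub (here refl))
  ... | as , bs , refl = begin
    f x + sumℚ xs f                  ≤⟨ ℚₚ.+-monoʳ-≤ (f x) (sumℚ-⊆ 0≤f (as ++ bs) u sub′) ⟩
    f x + sumℚ (as ++ bs) f          ≡⟨ cong (f x +_) (sumℚ-++ f as bs) ⟩
    f x + (sumℚ as f + sumℚ bs f)    ≡⟨ solve 3 (λ x a b → x :+ (a :+ b) := a :+ (x :+ b)) refl (f x) (sumℚ as f) (sumℚ bs f) ⟩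
    sumℚ as f + sumℚ (x ∷ bs) f      ≡⟨ sumℚ-++ f as (x ∷ bs) ⟨
    sumℚ (as ++ x ∷ bs) f            ∎
    where
    open ℚₚ.≤-Reasoning
    sub′ : ∀ {y} → y ∈ xs → y ∈ as ++ bs
    sub′ {y} y∈ with ∈-++⁻ as (sub (there y∈))
    ... | inj₁ y∈as         = ∈-++⁺ˡ y∈as
    ... | inj₂ (here refl)  = contradiction refl (All.lookup x∉xs y∈)
    ... | inj₂ (there y∈bs) = ∈-++⁺ʳ as y∈bs

sumℚ-map : ∀ {A B : Set} f (g : A → B) xs → sumℚ (map g xs) f ≡ sumℚ xs (f ∘ g)
sumℚ-map f g [] = refl
sumℚ-map f g (x ∷ xs) = cong (f (g x) +_) (sumℚ-map f g xs)

sumℚ-concatMap : ∀ {A B : Set} f (g : A → List B) xs → sumℚ (concatMap g xs) f ≡ sumℚ xs (λ x → sumℚ (g x) f)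
sumℚ-concatMap f g [] = refl
sumℚ-concatMap f g (x ∷ xs) = trans (sumℚ-++ f (g x) (concatMap g xs)) (cong (sumℚ (g x) f +_) (sumℚ-concatMap f g xs))

ι-sum : ∀ (g : ℕ → ℕ) xs → ι (sum (map g xs)) ≡ sumℚ xs (ι ∘ g)
ι-sum g [] = trans (ι≡frac 0) (frac-0 0)
ι-sum g (x ∷ xs) = trans (ι-+ (g x) _) (cong (ι (g x) +_) (ι-sum g xs))

ι*⅟-≤ : ∀ {A B p} → 0 ℕ.< p → A ℕ.≤ B ℕ.* p → ι A * ⅟ p ≤ ι B
ι*⅟-≤ {A} {B} {p} 0<p h = begin
  ι A * ⅟ p            ≤⟨ *-monoʳ (0≤⅟ p) (ι-mono h) ⟩
  ι (B ℕ.* p) * ⅟ p    ≡⟨ trans (cong (_* ⅟ p) (ι-* B p)) (ℚₚ.*-assoc (ι B) (ι p) (⅟ p)) ⟩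
  ι B * (ι p * ⅟ p)    ≡⟨ trans (cong (ι B *_) (ι*⅟ 0<p)) (ℚₚ.*-identityʳ (ι B)) ⟩
  ι B                  ∎
  where open ℚₚ.≤-Reasoning

ι-≤-ι*⅟ : ∀ {A B p} → 0 ℕ.< p → B ℕ.* p ℕ.≤ A → ι B ≤ ι A * ⅟ p
ι-≤-ι*⅟ {A} {B} {p} 0<p h = begin
  ι B                  ≡⟨ trans (cong (ι B *_) (ι*⅟ 0<p)) (ℚₚ.*-identityʳ (ι B)) ⟨
  ι B * (ι p * ⅟ p)    ≡⟨ trans (cong (_* ⅟ p) (ι-* B p)) (ℚₚ.*-assoc (ι B) (ι p) (⅟ p)) ⟨
  ι (B ℕ.* p) * ⅟ p    ≤⟨ *-monoʳ (0≤⅟ p) (ι-mono h) ⟩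
  ι A * ⅟ p            ∎
  where open ℚₚ.≤-Reasoning

*-mono-scaled : ∀ c d {x y x′ y′} → c ℕ.* x ℕ.≤ d ℕ.* y → c ℕ.* x′ ℕ.≤ d ℕ.* y′ →
                c ℕ.* c ℕ.* (x ℕ.* x′) ℕ.≤ d ℕ.* d ℕ.* (y ℕ.* y′)
*-mono-scaled c d {x} {y} {x′} {y′} h h′ = ℕₚ.≤-trans (ℕₚ.≤-reflexive (lem c x x′))
  (ℕₚ.≤-trans (ℕₚ.*-mono-≤ h h′) (ℕₚ.≤-reflexive (sym (lem d y y′))))
  where
  lem : ∀ c x y → c ℕ.* c ℕ.* (x ℕ.* y) ≡ c ℕ.* x ℕ.* (c ℕ.* y)
  lem = solve-∀

scaled-+ : ∀ c {x y} → c ℕ.* y ℕ.≤ x → c ℕ.* (x ℕ.+ y) ℕ.≤ suc c ℕ.* x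
scaled-+ c {x} {y} h = begin
  c ℕ.* (x ℕ.+ y)          ≡⟨ ℕₚ.*-distribˡ-+ c x y ⟩
  c ℕ.* x ℕ.+ c ℕ.* y      ≤⟨ ℕₚ.+-monoʳ-≤ (c ℕ.* x) h ⟩
  c ℕ.* x ℕ.+ x            ≡⟨ ℕₚ.+-comm (c ℕ.* x) x ⟩
  suc c ℕ.* x              ∎
  where open ℕₚ.≤-Reasoning

-- The shape in which the lower bound of Mertens' theorem arrives, with
-- K = R² r and R = 2ʳ; everything but the terms in h and S is negligible.
mertens-simplify : ∀ a r R h i N S → 1000 ℕ.≤ a → a ℕ.≤ r → a ℕ.≤ R → 7000 ℕ.* i ℕ.≤ 3 ℕ.* a →
  1000 ℕ.* (2 ℕ.+ R ℕ.* suc r ℕ.+ 8 ℕ.* r) ℕ.≤ h → 1000 ℕ.≤ h →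
  let e = i ℕ.* h ; j = h ℕ.+ e in
  R ℕ.* R ℕ.* r ℕ.* (j ℕ.* N) ℕ.≤ R ℕ.* R ℕ.* r ℕ.* (2 ℕ.* N ℕ.+ R ℕ.* (N ℕ.* suc r) ℕ.+ suc j ℕ.* S)
                                   ℕ.+ N ℕ.* (suc R ℕ.* suc R ℕ.* suc r) ℕ.* (e ℕ.+ r) →
  996 ℕ.* N ℕ.≤ 1001 ℕ.* (suc i ℕ.* S)
mertens-simplify a r R h i N S 1000≤a a≤r a≤R 7000i≤3a h-large 1000≤h hyp =
  ℕₚ.*-cancelˡ-≤ (a ℕ.* h) {{>-nonZero (ℕₚ.*-mono-≤ 0<a 0<h)}} (begin
    a ℕ.* h ℕ.* (996 ℕ.* N)                 ≤⟨ step₅ ⟩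
    1000 ℕ.* (a ℕ.* (suc j ℕ.* S))          ≡⟨ f₁ 1000 a (suc j) S ⟩
    1000 ℕ.* suc j ℕ.* (a ℕ.* S)            ≤⟨ ℕₚ.*-monoˡ-≤ (a ℕ.* S) (ℕₚ.≤-trans (ℕₚ.≤-reflexive (cong (1000 ℕ.*_) (ℕₚ.+-comm 1 j))) (scaled-+ 1000 {j} {1} (ℕₚ.≤-trans 1000≤h (ℕₚ.m≤m+n h e)))) ⟩
    1001 ℕ.* (suc i ℕ.* h) ℕ.* (a ℕ.* S)    ≡⟨ f₂ 1001 (suc i) h a S ⟩
    a ℕ.* h ℕ.* (1001 ℕ.* (suc i ℕ.* S))    ∎)
  where
  open ℕₚ.≤-Reasoning
  e = i ℕ.* h
  j = h ℕ.+ e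
  K = R ℕ.* R ℕ.* r
  M = suc R ℕ.* suc R ℕ.* suc r
  c = 2 ℕ.+ R ℕ.* suc r
  X = c ℕ.* N ℕ.+ suc j ℕ.* S
  0<a = ℕₚ.≤-trans (s≤s z≤n) 1000≤a
  0<h = ℕₚ.≤-trans (s≤s z≤n) 1000≤h
  0<K : 0 ℕ.< K
  0<K = ℕₚ.*-mono-≤ (ℕₚ.*-mono-≤ (ℕₚ.≤-trans 0<a a≤R) (ℕₚ.≤-trans 0<a a≤R)) (ℕₚ.≤-trans 0<a a≤r)
  f₁ : ∀ d a j S → d ℕ.* (a ℕ.* (j ℕ.* S)) ≡ d ℕ.* j ℕ.* (a ℕ.* S)
  f₁ = solve-∀
  f₂ : ∀ d i h a S → d ℕ.* (i ℕ.* h) ℕ.* (a ℕ.* S) ≡ a ℕ.* h ℕ.* (d ℕ.* (i ℕ.* S))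
  f₂ = solve-∀
  ratio : ∀ {x} → a ℕ.≤ x → a ℕ.* suc x ℕ.≤ suc a ℕ.* x
  ratio {x} a≤x = ℕₚ.≤-trans (ℕₚ.≤-reflexive (ℕₚ.*-suc a x)) (ℕₚ.+-monoˡ-≤ (a ℕ.* x) a≤x)
  cube : a ℕ.* a ℕ.* a ℕ.* M ℕ.≤ suc a ℕ.* suc a ℕ.* suc a ℕ.* K
  cube = begin
    a ℕ.* a ℕ.* a ℕ.* M                                    ≡⟨ f a (suc R) (suc r) ⟩
    a ℕ.* suc R ℕ.* (a ℕ.* suc R) ℕ.* (a ℕ.* suc r)        ≤⟨ ℕₚ.*-mono-≤ (ℕₚ.*-mono-≤ (ratio a≤R) (ratio a≤R)) (ratio a≤r) ⟩
    suc a ℕ.* R ℕ.* (suc a ℕ.* R) ℕ.* (suc a ℕ.* r)        ≡⟨ f (suc a) R r ⟨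
    suc a ℕ.* suc a ℕ.* suc a ℕ.* K                        ∎
    where
    f : ∀ a R r → a ℕ.* a ℕ.* a ℕ.* (R ℕ.* R ℕ.* r) ≡ a ℕ.* R ℕ.* (a ℕ.* R) ℕ.* (a ℕ.* r)
    f = solve-∀
  -- That is, (1 + 1/a)³ ≤ 1 + 7/a, where 7 = 3 + 3 + 1.
  cube′ : suc a ℕ.* suc a ℕ.* suc a ℕ.≤ a ℕ.* a ℕ.* (a ℕ.+ 7)
  cube′ = begin
    suc a ℕ.* suc a ℕ.* suc a                                 ≡⟨ f a ⟩
    a ℕ.* a ℕ.* a ℕ.+ 3 ℕ.* (a ℕ.* a) ℕ.+ 3 ℕ.* (a ℕ.* 1) ℕ.+ 1 ℕ.* 1  ≤⟨ ℕₚ.+-mono-≤ (ℕₚ.+-monoʳ-≤ (a ℕ.* a ℕ.* a ℕ.+ 3 ℕ.* (a ℕ.* a)) (ℕₚ.*-monoʳ-≤ 3 (ℕₚ.*-monoʳ-≤ a 0<a))) (ℕₚ.*-mono-≤ 0<a 0<a) ⟩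
    a ℕ.* a ℕ.* a ℕ.+ 3 ℕ.* (a ℕ.* a) ℕ.+ 3 ℕ.* (a ℕ.* a) ℕ.+ a ℕ.* a  ≡⟨ g a ⟩
    a ℕ.* a ℕ.* (a ℕ.+ 7)                                     ∎
    where
    f : ∀ a → suc a ℕ.* suc a ℕ.* suc a ≡ a ℕ.* a ℕ.* a ℕ.+ 3 ℕ.* (a ℕ.* a) ℕ.+ 3 ℕ.* (a ℕ.* 1) ℕ.+ 1 ℕ.* 1
    f = solve-∀
    g : ∀ a → a ℕ.* a ℕ.* a ℕ.+ 3 ℕ.* (a ℕ.* a) ℕ.+ 3 ℕ.* (a ℕ.* a) ℕ.+ a ℕ.* a ≡ a ℕ.* a ℕ.* (a ℕ.+ 7)
    g = solve-∀
  step₃ : a ℕ.* (j ℕ.* N) ℕ.≤ a ℕ.* X ℕ.+ (a ℕ.+ 7) ℕ.* (N ℕ.* (e ℕ.+ r))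
  step₃ = ℕₚ.*-cancelˡ-≤ (K ℕ.* (a ℕ.* a)) {{>-nonZero (ℕₚ.*-mono-≤ 0<K (ℕₚ.*-mono-≤ 0<a 0<a))}} (begin
    K ℕ.* (a ℕ.* a) ℕ.* (a ℕ.* (j ℕ.* N))                     ≡⟨ g₁ K a (j ℕ.* N) ⟩
    a ℕ.* a ℕ.* a ℕ.* (K ℕ.* (j ℕ.* N))                       ≤⟨ ℕₚ.*-monoʳ-≤ (a ℕ.* a ℕ.* a) hyp ⟩
    a ℕ.* a ℕ.* a ℕ.* (K ℕ.* (2 ℕ.* N ℕ.+ R ℕ.* (N ℕ.* suc r) ℕ.+ suc j ℕ.* S) ℕ.+ N ℕ.* M ℕ.* (e ℕ.+ r))
                                                              ≡⟨ cong (λ x → a ℕ.* a ℕ.* a ℕ.* (K ℕ.* (x ℕ.+ suc j ℕ.* S) ℕ.+ N ℕ.* M ℕ.* (e ℕ.+ r))) (g₂ N R r) ⟩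
    a ℕ.* a ℕ.* a ℕ.* (K ℕ.* X ℕ.+ N ℕ.* M ℕ.* (e ℕ.+ r))     ≡⟨ g₃ a K X N M (e ℕ.+ r) ⟩
    K ℕ.* (a ℕ.* a) ℕ.* (a ℕ.* X) ℕ.+ a ℕ.* a ℕ.* a ℕ.* M ℕ.* (N ℕ.* (e ℕ.+ r))
                                                              ≤⟨ ℕₚ.+-monoʳ-≤ (K ℕ.* (a ℕ.* a) ℕ.* (a ℕ.* X)) (ℕₚ.*-monoˡ-≤ (N ℕ.* (e ℕ.+ r)) (ℕₚ.≤-trans cube (ℕₚ.*-monoˡ-≤ K cube′))) ⟩
    K ℕ.* (a ℕ.* a) ℕ.* (a ℕ.* X) ℕ.+ a ℕ.* a ℕ.* (a ℕ.+ 7) ℕ.* K ℕ.* (N ℕ.* (e ℕ.+ r))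
                                                              ≡⟨ g₄ a (a ℕ.+ 7) K X (N ℕ.* (e ℕ.+ r)) ⟩
    K ℕ.* (a ℕ.* a) ℕ.* (a ℕ.* X ℕ.+ (a ℕ.+ 7) ℕ.* (N ℕ.* (e ℕ.+ r))) ∎)
    where
    g₁ : ∀ K a x → K ℕ.* (a ℕ.* a) ℕ.* (a ℕ.* x) ≡ a ℕ.* a ℕ.* a ℕ.* (K ℕ.* x)
    g₁ = solve-∀
    g₂ : ∀ N R r → 2 ℕ.* N ℕ.+ R ℕ.* (N ℕ.* suc r) ≡ (2 ℕ.+ R ℕ.* suc r) ℕ.* N
    g₂ = solve-∀
    g₃ : ∀ a K X N M e → a ℕ.* a ℕ.* a ℕ.* (K ℕ.* X ℕ.+ N ℕ.* M ℕ.* e) ≡ K ℕ.* (a ℕ.* a) ℕ.* (a ℕ.* X) ℕ.+ a ℕ.* a ℕ.* a ℕ.* M ℕ.* (N ℕ.* e)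
    g₃ = solve-∀
    g₄ : ∀ a b K X y → K ℕ.* (a ℕ.* a) ℕ.* (a ℕ.* X) ℕ.+ a ℕ.* a ℕ.* b ℕ.* K ℕ.* y ≡ K ℕ.* (a ℕ.* a) ℕ.* (a ℕ.* X ℕ.+ b ℕ.* y)
    g₄ = solve-∀
  step₄ : a ℕ.* h ℕ.* N ℕ.≤ a ℕ.* (suc j ℕ.* S) ℕ.+ N ℕ.* (a ℕ.* (c ℕ.+ r) ℕ.+ 7 ℕ.* (e ℕ.+ r))
  step₄ = ℕₚ.+-cancelʳ-≤ (a ℕ.* e ℕ.* N) _ _ (begin
    a ℕ.* h ℕ.* N ℕ.+ a ℕ.* e ℕ.* N                           ≡⟨ g₁ a h e N ⟩
    a ℕ.* (j ℕ.* N)                                           ≤⟨ step₃ ⟩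
    a ℕ.* X ℕ.+ (a ℕ.+ 7) ℕ.* (N ℕ.* (e ℕ.+ r))               ≡⟨ g₂ a c N (suc j ℕ.* S) e r ⟩
    a ℕ.* (suc j ℕ.* S) ℕ.+ N ℕ.* (a ℕ.* (c ℕ.+ r) ℕ.+ 7 ℕ.* (e ℕ.+ r)) ℕ.+ a ℕ.* e ℕ.* N ∎)
    where
    g₁ : ∀ a h e N → a ℕ.* h ℕ.* N ℕ.+ a ℕ.* e ℕ.* N ≡ a ℕ.* ((h ℕ.+ e) ℕ.* N)
    g₁ = solve-∀
    g₂ : ∀ a c N s e r → a ℕ.* (c ℕ.* N ℕ.+ s) ℕ.+ (a ℕ.+ 7) ℕ.* (N ℕ.* (e ℕ.+ r)) ≡ a ℕ.* s ℕ.+ N ℕ.* (a ℕ.* (c ℕ.+ r) ℕ.+ 7 ℕ.* (e ℕ.+ r)) ℕ.+ a ℕ.* e ℕ.* N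
    g₂ = solve-∀
  -- Of the 4 parts in 1000 lost here, one pays for the terms without `e`, through `h-large`, and
  -- three pay for 7e, through `7000i≤3a`.
  error : 1000 ℕ.* (a ℕ.* (c ℕ.+ r) ℕ.+ 7 ℕ.* (e ℕ.+ r)) ℕ.≤ 4 ℕ.* (a ℕ.* h)
  error = begin
    1000 ℕ.* (a ℕ.* (c ℕ.+ r) ℕ.+ 7 ℕ.* (e ℕ.+ r))              ≡⟨ g₁ 1000 a c r 7 e ⟩
    1000 ℕ.* (a ℕ.* (c ℕ.+ r) ℕ.+ 7 ℕ.* (1 ℕ.* r)) ℕ.+ 1000 ℕ.* (7 ℕ.* e)
      ≤⟨ ℕₚ.+-mono-≤ (ℕₚ.*-monoʳ-≤ 1000 (ℕₚ.+-monoʳ-≤ (a ℕ.* (c ℕ.+ r)) (ℕₚ.*-monoʳ-≤ 7 (ℕₚ.*-monoˡ-≤ r 0<a)))) (ℕₚ.≤-reflexive (trans (sym (ℕₚ.*-assoc 1000 7 e)) (sym (ℕₚ.*-assoc 7000 i h)))) ⟩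
    1000 ℕ.* (a ℕ.* (c ℕ.+ r) ℕ.+ 7 ℕ.* (a ℕ.* r)) ℕ.+ 7000 ℕ.* i ℕ.* h
      ≡⟨ cong (ℕ._+ 7000 ℕ.* i ℕ.* h) (g₂ 1000 a c r 7) ⟩
    a ℕ.* (1000 ℕ.* (c ℕ.+ 8 ℕ.* r)) ℕ.+ 7000 ℕ.* i ℕ.* h       ≤⟨ ℕₚ.+-mono-≤ (ℕₚ.*-monoʳ-≤ a h-large) (ℕₚ.*-monoˡ-≤ h 7000i≤3a) ⟩
    a ℕ.* h ℕ.+ 3 ℕ.* a ℕ.* h                                   ≡⟨ cong (a ℕ.* h ℕ.+_) (ℕₚ.*-assoc 3 a h) ⟩
    4 ℕ.* (a ℕ.* h)                                             ∎
    where
    g₁ : ∀ d a c r s e → d ℕ.* (a ℕ.* (c ℕ.+ r) ℕ.+ s ℕ.* (e ℕ.+ r)) ≡ d ℕ.* (a ℕ.* (c ℕ.+ r) ℕ.+ s ℕ.* (1 ℕ.* r)) ℕ.+ d ℕ.* (s ℕ.* e)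
    g₁ = solve-∀
    g₂ : ∀ d a c r s → d ℕ.* (a ℕ.* (c ℕ.+ r) ℕ.+ s ℕ.* (a ℕ.* r)) ≡ a ℕ.* (d ℕ.* (c ℕ.+ suc s ℕ.* r))
    g₂ = solve-∀
  step₅ : a ℕ.* h ℕ.* (996 ℕ.* N) ℕ.≤ 1000 ℕ.* (a ℕ.* (suc j ℕ.* S))
  step₅ = ℕₚ.+-cancelʳ-≤ (4 ℕ.* (a ℕ.* h) ℕ.* N) _ _ (begin
    a ℕ.* h ℕ.* (996 ℕ.* N) ℕ.+ 4 ℕ.* (a ℕ.* h) ℕ.* N            ≡⟨ g₁ 996 4 (a ℕ.* h) N ⟩
    1000 ℕ.* (a ℕ.* h ℕ.* N)                                     ≤⟨ ℕₚ.*-monoʳ-≤ 1000 step₄ ⟩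
    1000 ℕ.* (a ℕ.* (suc j ℕ.* S) ℕ.+ N ℕ.* (a ℕ.* (c ℕ.+ r) ℕ.+ 7 ℕ.* (e ℕ.+ r)))
                                                                 ≡⟨ g₂ 1000 (a ℕ.* (suc j ℕ.* S)) N (a ℕ.* (c ℕ.+ r) ℕ.+ 7 ℕ.* (e ℕ.+ r)) ⟩
    1000 ℕ.* (a ℕ.* (suc j ℕ.* S)) ℕ.+ 1000 ℕ.* (a ℕ.* (c ℕ.+ r) ℕ.+ 7 ℕ.* (e ℕ.+ r)) ℕ.* N
                                                                 ≤⟨ ℕₚ.+-monoʳ-≤ (1000 ℕ.* (a ℕ.* (suc j ℕ.* S))) (ℕₚ.*-monoˡ-≤ N error) ⟩
    1000 ℕ.* (a ℕ.* (suc j ℕ.* S)) ℕ.+ 4 ℕ.* (a ℕ.* h) ℕ.* N     ∎)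
    where
    g₁ : ∀ d s x N → x ℕ.* (d ℕ.* N) ℕ.+ s ℕ.* x ℕ.* N ≡ (d ℕ.+ s) ℕ.* (x ℕ.* N)
    g₁ = solve-∀
    g₂ : ∀ d x N y → d ℕ.* (x ℕ.+ N ℕ.* y) ≡ d ℕ.* x ℕ.+ d ℕ.* y ℕ.* N
    g₂ = solve-∀

-- Reciprocal sums of the primes in a bucket

module Buckets (a r h : ℕ) (1000≤a : 1000 ℕ.≤ a) (a≤r : a ℕ.≤ r)
               (h-large : 1000 ℕ.* (2 ℕ.+ 2 ^ r ℕ.* suc r ℕ.+ 8 ℕ.* r) ℕ.≤ h) where

  bucket : ℕ → List ℕ
  bucket i = primes (2 ^ (i ℕ.* h)) (2 ^ (suc i ℕ.* h))

  bucketSum : ℕ → ℚ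
  bucketSum i = sumℚ (bucket i) ⅟

  private
    R = 2 ^ r
    r≤R : r ℕ.≤ R
    r≤R = ℕₚ.<⇒≤ (n<2^n r)
    a≤R : a ℕ.≤ R
    a≤R = ℕₚ.≤-trans a≤r r≤R
    1000r≤h : 1000 ℕ.* r ℕ.≤ h
    1000r≤h = ℕₚ.≤-trans (ℕₚ.*-monoʳ-≤ 1000 (ℕₚ.≤-trans (ℕₚ.m≤n*m r 8) (ℕₚ.m≤n+m (8 ℕ.* r) (2 ℕ.+ R ℕ.* suc r)))) h-large
    1000≤h : 1000 ℕ.≤ h
    1000≤h = ℕₚ.≤-trans (ℕₚ.*-monoʳ-≤ 1000 (ℕₚ.≤-trans (ℕₚ.≤-trans (s≤s z≤n) 1000≤a) a≤r)) 1000r≤h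
    0<a = ℕₚ.≤-trans (s≤s z≤n) 1000≤a
    0<h : 0 ℕ.< h
    0<h = ℕₚ.≤-trans (s≤s z≤n) 1000≤h
    r≤h : r ℕ.≤ h
    r≤h = ℕₚ.≤-trans (ℕₚ.m≤n*m r 1000) 1000r≤h
    1000*suc[a]≤ : 1000 ℕ.* suc a ℕ.≤ 1001 ℕ.* a
    1000*suc[a]≤ = ℕₚ.≤-trans (ℕₚ.≤-reflexive (cong (1000 ℕ.*_) (ℕₚ.+-comm 1 a))) (scaled-+ 1000 {a} {1} 1000≤a)

  bucket-bounds : ∀ i → 2 ^ (i ℕ.* h) ℕ.≤ 2 ^ (suc i ℕ.* h)
  bucket-bounds i = ℕₚ.^-monoʳ-≤ 2 (ℕₚ.m≤n+m (i ℕ.* h) h)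

  ∈-bucket⁻ : ∀ i {p} → p ∈ bucket i → Prime p × 2 ^ (i ℕ.* h) ℕ.< p × p ℕ.≤ 2 ^ (suc i ℕ.* h)
  ∈-bucket⁻ i = ∈-primes⁻ (bucket-bounds i)

  -- Primes of bucket i have base-2 logarithm at least ih, so the upper Mertens bound at x = 2^(ih)
  -- and n = 2^(h + r) x gives ih ∑ ⌊n/p⌋ ≤ (h + r)n. The surplus 2^r makes each ⌊n/p⌋ at least a,
  -- so that rounding costs a factor 1 + 1/a.
  bucketSum-upper : ∀ i → ι 100 * (ι i * bucketSum i) ≤ ι 101
  bucketSum-upper i = *-cancelˡ (0<ι (ℕₚ.*-mono-≤ 0<h (ℕₚ.*-mono-≤ 0<a 0<n))) (let open ℚₚ.≤-Reasoning in begin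
    ι A * (ι 100 * (ι i * s))                      ≡⟨ rearrange ⟩
    ι 100 * (ι (i ℕ.* h) * (ι (a ℕ.* n) * s))      ≤⟨ *-monoˡ (0≤ι 100) (*-monoˡ (0≤ι (i ℕ.* h)) ∑≤) ⟩
    ι 100 * (ι (i ℕ.* h) * ι (suc a ℕ.* Q))        ≡⟨ trans (cong (ι 100 *_) (sym (ι-* (i ℕ.* h) (suc a ℕ.* Q)))) (sym (ι-* 100 _)) ⟩
    ι (100 ℕ.* (i ℕ.* h ℕ.* (suc a ℕ.* Q)))        ≤⟨ ι-mono final ⟩
    ι (A ℕ.* 101)                                  ≡⟨ ι-* A 101 ⟩
    ι A * ι 101                                    ∎)
    where
    s = bucketSum i
    ps = bucket i
    n = 2 ^ (h ℕ.+ r) ℕ.* 2 ^ (i ℕ.* h)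
    q : ℕ → ℕ
    q p = n div p
    Q = sum (map q ps)
    A = h ℕ.* (a ℕ.* n)
    0<n : 0 ℕ.< n
    0<n = ℕₚ.*-mono-≤ (ℕₚ.m^n>0 2 (h ℕ.+ r)) (ℕₚ.m^n>0 2 (i ℕ.* h))
    rearrange : ι A * (ι 100 * (ι i * s)) ≡ ι 100 * (ι (i ℕ.* h) * (ι (a ℕ.* n) * s))
    rearrange = trans (cong (_* (ι 100 * (ι i * s))) (ι-* h (a ℕ.* n)))
      (trans (solve 5 (λ h m c i s → h :* m :* (c :* (i :* s)) := c :* (i :* h :* (m :* s))) refl (ι h) (ι (a ℕ.* n)) (ι 100) (ι i) s)
        (cong (λ x → ι 100 * (x * (ι (a ℕ.* n) * s))) (sym (ι-* i h))))
    an≤ : ∀ {p} → p ∈ ps → a ℕ.* n ℕ.≤ suc a ℕ.* q p ℕ.* p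
    an≤ {p} p∈ with ∈-bucket⁻ i p∈
    ... | pp , _ , p≤ = let open ℕₚ.≤-Reasoning in begin
      a ℕ.* n                            ≤⟨ ℕₚ.*-monoʳ-≤ a (ℕₚ.<⇒≤ (<-suc-div-* n p 0<p)) ⟩
      a ℕ.* (suc (q p) ℕ.* p)            ≡⟨ trans (sym (ℕₚ.*-assoc a (suc (q p)) p)) (cong (ℕ._* p) (ℕₚ.*-suc a (q p))) ⟩
      (a ℕ.+ a ℕ.* q p) ℕ.* p            ≤⟨ ℕₚ.*-monoˡ-≤ p (ℕₚ.+-monoˡ-≤ (a ℕ.* q p) a≤q) ⟩
      suc a ℕ.* q p ℕ.* p                ∎
      where
      0<p = ℕₚ.<-trans z<s (prime⇒1< pp)
      R*p≤n : R ℕ.* p ℕ.≤ n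
      R*p≤n = ℕₚ.≤-trans (ℕₚ.*-monoʳ-≤ R p≤) (ℕₚ.≤-reflexive (trans (sym (ℕₚ.^-distribˡ-+-* 2 r (suc i ℕ.* h)))
        (trans (cong (2 ^_) (lem r h (i ℕ.* h))) (ℕₚ.^-distribˡ-+-* 2 (h ℕ.+ r) (i ℕ.* h)))))
        where
        lem : ∀ r h k → r ℕ.+ (h ℕ.+ k) ≡ h ℕ.+ r ℕ.+ k
        lem = solve-∀
      a≤q : a ℕ.≤ q p
      a≤q = ℕₚ.≤-trans a≤R (≤-div R n p 0<p R*p≤n)
    ∑≤ : ι (a ℕ.* n) * s ≤ ι (suc a ℕ.* Q)
    ∑≤ = let open ℚₚ.≤-Reasoning in begin
      ι (a ℕ.* n) * s                          ≡⟨ sumℚ-*ˡ (ι (a ℕ.* n)) ⅟ ps ⟨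
      sumℚ ps (λ p → ι (a ℕ.* n) * ⅟ p)        ≤⟨ sumℚ-mono ps (λ {p} p∈ → ι*⅟-≤ (ℕₚ.<-trans z<s (prime⇒1< (proj₁ (∈-bucket⁻ i p∈)))) (an≤ p∈)) ⟩
      sumℚ ps (λ p → ι (suc a ℕ.* q p))        ≡⟨ ι-sum (λ p → suc a ℕ.* q p) ps ⟨
      ι (sum (map (λ p → suc a ℕ.* q p) ps))   ≡⟨ cong ι (sum-map-*ˡ (suc a) q ps) ⟩
      ι (suc a ℕ.* Q)                          ∎
    ihQ≤ : i ℕ.* h ℕ.* Q ℕ.≤ (h ℕ.+ r) ℕ.* n
    ihQ≤ = ℕₚ.≤-trans (ℕₚ.≤-reflexive (sym (sum-map-*ˡ (i ℕ.* h) q ps)))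
      (∑log*div≤ (h ℕ.+ r) (2 ^ (i ℕ.* h)) (λ _ → i ℕ.* h) ps (primes-unique (2 ^ (i ℕ.* h)) (2 ^ (suc i ℕ.* h)))
        (All.tabulate (proj₁ ∘ ∈-bucket⁻ i)) (All.tabulate (proj₁ ∘ proj₂ ∘ ∈-bucket⁻ i)) (All.tabulate (ℕₚ.<⇒≤ ∘ proj₁ ∘ proj₂ ∘ ∈-bucket⁻ i)))
    -- (1 + 1/a)(1 + r/h) ≤ 1.001² < 1.01.
    100≤101 : 100 ℕ.* (suc a ℕ.* (h ℕ.+ r)) ℕ.≤ 101 ℕ.* (a ℕ.* h)
    100≤101 = ℕₚ.*-cancelˡ-≤ 10000 (let open ℕₚ.≤-Reasoning in begin
      10000 ℕ.* (100 ℕ.* (suc a ℕ.* (h ℕ.+ r)))    ≡⟨ ℕₚ.*-assoc 10000 100 (suc a ℕ.* (h ℕ.+ r)) ⟨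
      1000000 ℕ.* (suc a ℕ.* (h ℕ.+ r))            ≤⟨ *-mono-scaled 1000 1001 {suc a} {a} {h ℕ.+ r} {h} 1000*suc[a]≤ (scaled-+ 1000 {h} {r} 1000r≤h) ⟩
      1002001 ℕ.* (a ℕ.* h)                        ≤⟨ ℕₚ.*-monoˡ-≤ (a ℕ.* h) (ℕₚ.≤ᵇ⇒≤ 1002001 1010000 _) ⟩
      1010000 ℕ.* (a ℕ.* h)                        ≡⟨ ℕₚ.*-assoc 10000 101 (a ℕ.* h) ⟩
      10000 ℕ.* (101 ℕ.* (a ℕ.* h))                ∎)
    final : 100 ℕ.* (i ℕ.* h ℕ.* (suc a ℕ.* Q)) ℕ.≤ A ℕ.* 101
    final = ℕₚ.≤-trans (ℕₚ.≤-reflexive (e₁ 100 (i ℕ.* h) (suc a) Q))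
      (ℕₚ.≤-trans (ℕₚ.*-monoʳ-≤ (100 ℕ.* suc a) ihQ≤)
      (ℕₚ.≤-trans (ℕₚ.≤-reflexive (e₂ 100 (suc a) (h ℕ.+ r) n))
      (ℕₚ.≤-trans (ℕₚ.*-monoˡ-≤ n 100≤101) (ℕₚ.≤-reflexive (e₃ 101 a h n)))))
      where
      e₁ : ∀ c e a q → c ℕ.* (e ℕ.* (a ℕ.* q)) ≡ c ℕ.* a ℕ.* (e ℕ.* q)
      e₁ = solve-∀
      e₂ : ∀ c a k n → c ℕ.* a ℕ.* (k ℕ.* n) ≡ c ℕ.* (a ℕ.* k) ℕ.* n
      e₂ = solve-∀
      e₃ : ∀ c a h n → c ℕ.* (a ℕ.* h) ℕ.* n ≡ h ℕ.* (a ℕ.* n) ℕ.* c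
      e₃ = solve-∀

  -- The bucket carries the difference between (i + 1)h and ih, so the relative error 7/a on the
  -- subtracted ih has to be small against h. The precision a must therefore outgrow i: this bound
  -- serves finitely many buckets, whereas the upper bound holds for all.
  bucketSum-lower : ∀ i → 1 ℕ.≤ i → 7000 ℕ.* i ℕ.≤ 3 ℕ.* a → ι 99 ≤ ι 100 * (ι (suc i) * bucketSum i)
  bucketSum-lower i 1≤i 7000i≤3a with ∑valuation-lower (suc i ℕ.* h)
  ... | v , v-bound , log-n! = *-cancelˡ (0<ι {X} (ℕₚ.*-mono-≤ {1} {1001 ℕ.* suc a} (s≤s z≤n) (ℕₚ.m^n>0 2 j))) (begin
    ι X * ι 99                                                     ≡⟨ ι-* X 99 ⟨
    ι (X ℕ.* 99)                                                   ≤⟨ ι-mono final ⟩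
    ι (100 ℕ.* (1001 ℕ.* suc i) ℕ.* (a ℕ.* S))                     ≡⟨ ι-* (100 ℕ.* (1001 ℕ.* suc i)) (a ℕ.* S) ⟩
    ι (100 ℕ.* (1001 ℕ.* suc i)) * ι (a ℕ.* S)                     ≤⟨ *-monoˡ (0≤ι (100 ℕ.* (1001 ℕ.* suc i))) ∑≤ ⟩
    ι (100 ℕ.* (1001 ℕ.* suc i)) * (ι (suc a ℕ.* N) * s)           ≡⟨ cong₂ (λ x y → x * (y * s)) (trans (ι-* 100 _) (cong (ι 100 *_) (ι-* 1001 (suc i)))) (ι-* (suc a) N) ⟩
    ι 100 * (ι 1001 * ι (suc i)) * (ι (suc a) * ι N * s)           ≡⟨ solve 6 (λ c d i a n s → c :* (d :* i) :* (a :* n :* s) := d :* a :* n :* (c :* (i :* s))) refl (ι 100) (ι 1001) (ι (suc i)) (ι (suc a)) (ι N) s ⟩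
    ι 1001 * ι (suc a) * ι N * (ι 100 * (ι (suc i) * s))           ≡⟨ cong (_* (ι 100 * (ι (suc i) * s))) (trans (ι-* (1001 ℕ.* suc a) N) (cong (_* ι N) (ι-* 1001 (suc a)))) ⟨
    ι X * (ι 100 * (ι (suc i) * s))                                ∎)
    where
    open ℚₚ.≤-Reasoning
    s = bucketSum i
    ps = bucket i
    j = suc i ℕ.* h
    N = 2 ^ j
    S = sum (map v ps)
    X = 1001 ℕ.* suc a ℕ.* N
    h≤ih : h ℕ.≤ i ℕ.* h
    h≤ih = ℕₚ.m≤n*m h i {{>-nonZero 1≤i}}
    996≤ : 996 ℕ.* N ℕ.≤ 1001 ℕ.* (suc i ℕ.* S)
    996≤ = mertens-simplify a r R h i N S 1000≤a a≤r a≤R 7000i≤3a h-large 1000≤h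
      (mertens-lower r (i ℕ.* h) j (ℕₚ.≤-trans r≤h h≤ih)
        (ℕₚ.≤-trans (ℕₚ.≤-reflexive (ℕₚ.+-comm (i ℕ.* h) r)) (ℕₚ.+-monoˡ-≤ (i ℕ.* h) r≤h)) v v-bound log-n!)
    av≤ : ∀ {p} → Prime p → R ℕ.< p → a ℕ.* v p ℕ.* p ℕ.≤ suc a ℕ.* N
    av≤ {suc p} pp R<p = ℕₚ.≤-trans (ℕₚ.≤-reflexive (lem a (v (suc p)) p))
      (ℕₚ.≤-trans (ℕₚ.*-monoʳ-≤ (v (suc p)) (ℕₚ.+-monoˡ-≤ (a ℕ.* p) (ℕₚ.≤-trans a≤R (ℕ.s≤s⁻¹ R<p))))
      (ℕₚ.≤-trans (ℕₚ.≤-reflexive (lem′ a (v (suc p)) p)) (ℕₚ.*-monoʳ-≤ (suc a) (v-bound pp))))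
      where
      lem : ∀ a v p → a ℕ.* v ℕ.* suc p ≡ v ℕ.* (a ℕ.+ a ℕ.* p)
      lem = solve-∀
      lem′ : ∀ a v p → v ℕ.* (p ℕ.+ a ℕ.* p) ≡ suc a ℕ.* (v ℕ.* p)
      lem′ = solve-∀
    ∑≤ : ι (a ℕ.* S) ≤ ι (suc a ℕ.* N) * s
    ∑≤ = begin
      ι (a ℕ.* S)                              ≡⟨ cong ι (sum-map-*ˡ a v ps) ⟨
      ι (sum (map (λ p → a ℕ.* v p) ps))       ≡⟨ ι-sum (λ p → a ℕ.* v p) ps ⟩
      sumℚ ps (λ p → ι (a ℕ.* v p))            ≤⟨ sumℚ-mono ps term ⟩
      sumℚ ps (λ p → ι (suc a ℕ.* N) * ⅟ p)    ≡⟨ sumℚ-*ˡ (ι (suc a ℕ.* N)) ⅟ ps ⟩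
      ι (suc a ℕ.* N) * s                      ∎
      where
      term : ∀ {p} → p ∈ ps → ι (a ℕ.* v p) ≤ ι (suc a ℕ.* N) * ⅟ p
      term {p} p∈ with ∈-bucket⁻ i p∈
      ... | pp , x<p , _ = ι-≤-ι*⅟ (ℕₚ.<-trans z<s (prime⇒1< pp))
              (av≤ pp (ℕₚ.≤-<-trans (ℕₚ.^-monoʳ-≤ 2 (ℕₚ.≤-trans r≤h h≤ih)) x<p))
    -- 996/1001, divided by the factor 1.001 that the passage from `S` to `s` costs, still exceeds
    -- 99/100.
    final : X ℕ.* 99 ℕ.≤ 100 ℕ.* (1001 ℕ.* suc i) ℕ.* (a ℕ.* S)
    final = ℕₚ.≤-trans (ℕₚ.*-cancelˡ-≤ 1000 99≤)
      (ℕₚ.≤-trans (ℕₚ.≤-reflexive (f₃ a N 100 996))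
      (ℕₚ.≤-trans (ℕₚ.*-monoʳ-≤ (100 ℕ.* a) 996≤) (ℕₚ.≤-reflexive (f₄ 100 a 1001 (suc i) S))))
      where
      f₁ : ∀ d c a N k → k ℕ.* (d ℕ.* a ℕ.* N ℕ.* c) ≡ k ℕ.* a ℕ.* (d ℕ.* c ℕ.* N)
      f₁ = solve-∀
      f₃ : ∀ a N c d → a ℕ.* N ℕ.* (c ℕ.* d) ≡ c ℕ.* a ℕ.* (d ℕ.* N)
      f₃ = solve-∀
      f₄ : ∀ c a d i S → c ℕ.* a ℕ.* (d ℕ.* (i ℕ.* S)) ≡ c ℕ.* (d ℕ.* i) ℕ.* (a ℕ.* S)
      f₄ = solve-∀
      f₅ : ∀ c a d N → c ℕ.* a ℕ.* (d ℕ.* N) ≡ c ℕ.* d ℕ.* (a ℕ.* N)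
      f₅ = solve-∀
      f₆ : ∀ c d a N → c ℕ.* d ℕ.* (a ℕ.* N) ≡ c ℕ.* (a ℕ.* N ℕ.* d)
      f₆ = solve-∀
      99≤ : 1000 ℕ.* (X ℕ.* 99) ℕ.≤ 1000 ℕ.* (a ℕ.* N ℕ.* (100 ℕ.* 996))
      99≤ = ℕₚ.≤-trans (ℕₚ.≤-reflexive (f₁ 1001 99 (suc a) N 1000))
        (ℕₚ.≤-trans (ℕₚ.*-monoˡ-≤ (1001 ℕ.* 99 ℕ.* N) 1000*suc[a]≤)
        (ℕₚ.≤-trans (ℕₚ.≤-reflexive (f₅ 1001 a (1001 ℕ.* 99) N))
        (ℕₚ.≤-trans (ℕₚ.*-monoˡ-≤ (a ℕ.* N) (ℕₚ.≤ᵇ⇒≤ (1001 ℕ.* (1001 ℕ.* 99)) (1000 ℕ.* (100 ℕ.* 996)) _))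
          (ℕₚ.≤-reflexive (f₆ 1000 (100 ℕ.* 996) a N)))))

-- Riemann sums of the logarithm and the size of 1 / (a log a)

logSum-mono : ∀ {a b} m → a ℕ.≤ b → logSum a m ≤ logSum b m
logSum-mono {a} {b} m a≤b = begin
  harmonic (suc m) (pred a ℕ.* suc m)         ≤⟨ p≤p+q (harmonic-nonNeg _ (k ℕ.* suc m)) ⟩
  harmonic (suc m) (pred a ℕ.* suc m) + harmonic (suc m ℕ.+ pred a ℕ.* suc m) (k ℕ.* suc m)
                                              ≡⟨ harmonic-split (suc m) (pred a ℕ.* suc m) (k ℕ.* suc m) ⟨
  harmonic (suc m) (pred a ℕ.* suc m ℕ.+ k ℕ.* suc m)
                                              ≡⟨ cong (harmonic (suc m)) (trans (sym (ℕₚ.*-distribʳ-+ (suc m) (pred a) k)) (cong (ℕ._* suc m) (ℕₚ.m+[n∸m]≡n (ℕₚ.pred-mono-≤ a≤b)))) ⟩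
  harmonic (suc m) (pred b ℕ.* suc m)         ∎
  where
  open ℚₚ.≤-Reasoning
  k = pred b ∸ pred a

-- log (ab) splits into log a and a Riemann sum of log b of mesh 1/(aM).
logSum-* : ∀ a b m → logSum (suc a ℕ.* suc b) m ≡
           logSum (suc a) m + harmonic (suc m ℕ.* suc a) (b ℕ.* suc m ℕ.* suc a)
logSum-* a b m = begin
  harmonic M ((b ℕ.+ a ℕ.* suc b) ℕ.* M)                            ≡⟨ cong (harmonic M) (e₁ a b m) ⟩
  harmonic M (a ℕ.* M ℕ.+ b ℕ.* M ℕ.* suc a)                        ≡⟨ harmonic-split M (a ℕ.* M) (b ℕ.* M ℕ.* suc a) ⟩
  harmonic M (a ℕ.* M) + harmonic (M ℕ.+ a ℕ.* M) (b ℕ.* M ℕ.* suc a)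
                                                                    ≡⟨ cong (λ c → harmonic M (a ℕ.* M) + harmonic c (b ℕ.* M ℕ.* suc a)) (ℕₚ.*-comm (suc a) M) ⟩
  harmonic M (a ℕ.* M) + harmonic (M ℕ.* suc a) (b ℕ.* M ℕ.* suc a) ∎
  where
  open ≡-Reasoning
  M = suc m
  e₁ : ∀ a b m → (b ℕ.+ a ℕ.* suc b) ℕ.* suc m ≡ a ℕ.* suc m ℕ.+ b ℕ.* suc m ℕ.* suc a
  e₁ = solve-∀

-- Right-endpoint sums of 1/t grow under refinement, so superadditivity is exact at every index m;
-- only the reverse inequality needs the mesh error 1/(m + 1).
logSum-*-lower : ∀ a b m → logSum (suc a) m + logSum (suc b) m ≤ logSum (suc a ℕ.* suc b) m
logSum-*-lower a b m = ℚₚ.≤-trans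
  (ℚₚ.+-monoʳ-≤ (logSum (suc a) m) (refine-lower (suc m) (b ℕ.* suc m) a))
  (ℚₚ.≤-reflexive (sym (logSum-* a b m)))

logSum-*-upper : ∀ a b m → logSum (suc a ℕ.* suc b) m ≤ logSum (suc a) m + (logSum (suc b) m + frac 1 m)
logSum-*-upper a b m = ℚₚ.≤-trans (ℚₚ.≤-reflexive (logSum-* a b m)) (ℚₚ.+-monoʳ-≤ (logSum (suc a) m) (begin
  harmonic (suc m ℕ.* suc a) (b ℕ.* suc m ℕ.* suc a)   ≡⟨ cong (harmonic (suc m ℕ.* suc a)) (ℕₚ.*-assoc b (suc m) (suc a)) ⟩
  logSum (suc b) m′                                    ≡⟨ solve 2 (λ x y → x := y :+ (x :- y)) refl (logSum (suc b) m′) (logSum (suc b) m) ⟩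
  logSum (suc b) m + (logSum (suc b) m′ - logSum (suc b) m)  ≤⟨ ℚₚ.+-monoʳ-≤ (logSum (suc b) m) (log-diff (suc b) m′ m) ⟩
  logSum (suc b) m + frac 1 m                          ∎))
  where
  open ℚₚ.≤-Reasoning
  m′ = a ℕ.+ m ℕ.* suc a

ι-suc : ∀ k x → ι (suc k) * x ≡ x + ι k * x
ι-suc k x = trans (cong (_* x) (trans (ι-+ 1 k) (cong (_+ ι k) ι1)))
  (solve 2 (λ k x → (con 1ℚ :+ k) :* x := x :+ k :* x) refl (ι k) x)

ι0 : ι 0 ≡ 0ℚ
ι0 = trans (ι≡frac 0) (frac-0 0)

2^≡suc : ∀ k → 2 ^ k ≡ suc (pred (2 ^ k))
2^≡suc k = sym (ℕₚ.suc-pred (2 ^ k) {{ℕₚ.m^n≢0 2 k}})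

logSum-2^-lower : ∀ k m → ι k * logSum 2 m ≤ logSum (2 ^ k) m
logSum-2^-lower zero m = ℚₚ.≤-reflexive (trans (cong (_* logSum 2 m) ι0) (ℚₚ.*-zeroˡ (logSum 2 m)))
logSum-2^-lower (suc k) m = begin
  ι (suc k) * logSum 2 m               ≡⟨ ι-suc k (logSum 2 m) ⟩
  logSum 2 m + ι k * logSum 2 m        ≤⟨ ℚₚ.+-monoʳ-≤ (logSum 2 m) (logSum-2^-lower k m) ⟩
  logSum 2 m + logSum (2 ^ k) m        ≡⟨ cong (λ n → logSum 2 m + logSum n m) (2^≡suc k) ⟩
  logSum 2 m + logSum (suc (pred (2 ^ k))) m        ≤⟨ logSum-*-lower 1 (pred (2 ^ k)) m ⟩
  logSum (2 ℕ.* suc (pred (2 ^ k))) m  ≡⟨ cong (λ n → logSum (2 ℕ.* n) m) (2^≡suc k) ⟨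
  logSum (2 ^ suc k) m                 ∎
  where open ℚₚ.≤-Reasoning

-- The error grows linearly in k, as the logarithm itself does. Its relative size thus depends on m
-- alone, which allows one threshold for m to serve all integers a at once.
logSum-2^-upper : ∀ k m → logSum (2 ^ k) m ≤ ι k * (logSum 2 m + frac 1 m)
logSum-2^-upper zero m = ℚₚ.≤-reflexive (sym (trans (cong (_* (logSum 2 m + frac 1 m)) ι0) (ℚₚ.*-zeroˡ (logSum 2 m + frac 1 m))))
logSum-2^-upper (suc k) m = begin
  logSum (2 ^ suc k) m                              ≡⟨ cong (λ n → logSum (2 ℕ.* n) m) (2^≡suc k) ⟩
  logSum (2 ℕ.* suc (pred (2 ^ k))) m               ≤⟨ logSum-*-upper 1 (pred (2 ^ k)) m ⟩
  L + (logSum (suc (pred (2 ^ k))) m + frac 1 m)    ≡⟨ cong (λ n → L + (logSum n m + frac 1 m)) (2^≡suc k) ⟨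
  L + (logSum (2 ^ k) m + frac 1 m)                 ≤⟨ ℚₚ.+-monoʳ-≤ L (ℚₚ.+-monoˡ-≤ (frac 1 m) (logSum-2^-upper k m)) ⟩
  L + (ι k * (L + frac 1 m) + frac 1 m)             ≡⟨ solve 3 (λ l x f → l :+ (x :+ f) := l :+ f :+ x) refl L (ι k * (L + frac 1 m)) (frac 1 m) ⟩
  L + frac 1 m + ι k * (L + frac 1 m)               ≡⟨ ι-suc k (L + frac 1 m) ⟨
  ι (suc k) * (L + frac 1 m)                        ∎
  where
  open ℚₚ.≤-Reasoning
  L = logSum 2 m

log2≤1 : ∀ m → logSum 2 m ≤ 1ℚ
log2≤1 m = ℚₚ.≤-trans (harmonic-upper (suc m) (1 ℕ.* suc m) m (ℕₚ.n≤1+n m))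
  (ℚₚ.≤-reflexive (frac-≡ {1 ℕ.* suc m} {m} {1} {0} (ℕₚ.*-identityʳ (1 ℕ.* suc m))))

-- The m-th rational approximation of c / (a log a).
term : ℕ → ℕ → ℕ → ℚ
term m c a = seq (c /[ a log]) m

recip-* : ∀ {u y} (0<u : 0ℚ ℚ.< u) → u ≡ y → recip u 0<u * y ≡ 1ℚ
recip-* {u} 0<u refl = ℚₚ.*-inverseˡ u {{ℚ.>-nonZero 0<u}}

-- Exact at every index: `inv` cuts its argument off at ½, and the approximations of a log a are at
-- least ½ for every m, so the cut-off never acts.
term-* : ∀ m c {a} → 2 ℕ.≤ a → term m c a * (ι a * logSum a m) ≡ ι c
term-* m c {suc (suc n)} (s≤s (s≤s z≤n)) = begin
  fc * R * (ι a * logSum a m)           ≡⟨ cong (λ x → fc * R * (x * logSum a m)) (ι≡frac a) ⟩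
  fc * R * y                            ≡⟨ ℚₚ.*-assoc fc R y ⟩
  fc * (R * y)                          ≡⟨ cong (fc *_) (recip-* (⊔-pos y 0<½) (ℚₚ.p≥q⇒p⊔q≡p (subst (_≤ y) (ℚₚ.+-identityˡ ½) ½≤y))) ⟩
  fc * 1ℚ                               ≡⟨ ℚₚ.*-identityʳ fc ⟩
  fc                                    ≡⟨ ι≡frac c ⟨
  ι c                                   ∎
  where
  open ≡-Reasoning
  a = suc (suc n)
  fc = frac c 0
  y = frac a 0 * logSum a m
  R = recip (y ⊔ ½) (⊔-pos y 0<½)
  ½≤y : 0ℚ + ½ ≤ y
  ½≤y = proj₂ (proj₂ (proj₂ (n·log[n]>0 n))) m z≤n

term-scale : ∀ m c a → term m c a ≡ ι c * term m 1 a
term-scale m c zero = sym (ℚₚ.*-zeroʳ (ι c))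
term-scale m c (suc zero) = sym (ℚₚ.*-zeroʳ (ι c))
term-scale m c (suc (suc n)) = trans (cong (_* R) (sym (ι≡frac c))) (cong (ι c *_) (sym (trans (cong (_* R) (trans (sym (ι≡frac 1)) ι1)) (ℚₚ.*-identityˡ R))))
  where
  y = frac (suc (suc n)) 0 * logSum (suc (suc n)) m
  R = recip (y ⊔ ½) (⊔-pos y 0<½)

term-nonNeg : ∀ m c a → 0ℚ ≤ term m c a
term-nonNeg m c zero = ℚₚ.≤-refl
term-nonNeg m c (suc zero) = ℚₚ.≤-refl
term-nonNeg m c (suc (suc n)) = *-nonNeg (0≤frac c 0)
  (ℚₚ.<⇒≤ (ℚₚ.positive⁻¹ R {{ℚₚ.1/pos⇒pos u {{positive (⊔-pos y 0<½)}}}}))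
  where
  y = frac (suc (suc n)) 0 * logSum (suc (suc n)) m
  u = y ⊔ ½
  R = recip u (⊔-pos y 0<½)

-- Stands for 1 / log 2, in units of which all terms are measured.
κ : ℕ → ℚ
κ m = term m 1 2 * ι 2

0≤κ : ∀ m → 0ℚ ≤ κ m
0≤κ m = *-nonNeg (term-nonNeg m 1 2) (0≤ι 2)

κ*log2 : ∀ m → κ m * logSum 2 m ≡ 1ℚ
κ*log2 m = trans (ℚₚ.*-assoc (term m 1 2) (ι 2) (logSum 2 m)) (trans (term-* m 1 {2} (s≤s (s≤s z≤n))) ι1)

1≤κ : ∀ m → 1ℚ ≤ κ m
1≤κ m = begin
  1ℚ                   ≡⟨ κ*log2 m ⟨
  κ m * logSum 2 m     ≤⟨ *-monoˡ (0≤κ m) (log2≤1 m) ⟩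
  κ m * 1ℚ             ≡⟨ ℚₚ.*-identityʳ (κ m) ⟩
  κ m                  ∎
  where open ℚₚ.≤-Reasoning

-- Rests on log a ≥ k log 2 at index m. The inequality between reciprocals is reached without
-- dividing: a product equal to 1 is inserted, and `term-*` removes a log a at the end.
term-upper : ∀ m {a} k → 2 ℕ.≤ a → 0 ℕ.< k → 2 ^ k ℕ.≤ a → term m 1 a ≤ κ m * ⅟ k * ⅟ a
term-upper m {a} k 2≤a 0<k 2^k≤a = begin
  t                                                 ≡⟨ trans (solve 1 (λ t → t := t :* (con 1ℚ :* con 1ℚ :* con 1ℚ)) refl t)
                                                        (cong (t *_) (sym (cong₂ _*_ (cong₂ _*_ (κ*log2 m) (ι*⅟ 0<k)) (ι*⅟ {a} (ℕₚ.≤-trans (s≤s z≤n) 2≤a))))) ⟩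
  t * (κ m * L * (ι k * ⅟ k) * (ι a * ⅟ a))         ≡⟨ solve 7 (λ t c l k k′ a a′ → t :* (c :* l :* (k :* k′) :* (a :* a′)) := t :* (a :* (k :* l)) :* (c :* k′ :* a′))
                                                        refl t (κ m) L (ι k) (⅟ k) (ι a) (⅟ a) ⟩
  t * (ι a * (ι k * L)) * (κ m * ⅟ k * ⅟ a)         ≤⟨ *-monoʳ (*-nonNeg (*-nonNeg (0≤κ m) (0≤⅟ k)) (0≤⅟ a)) (*-monoˡ (term-nonNeg m 1 a) (*-monoˡ (0≤ι a)
                                                        (ℚₚ.≤-trans (logSum-2^-lower k m) (logSum-mono {2 ^ k} {a} m 2^k≤a)))) ⟩
  t * (ι a * logSum a m) * (κ m * ⅟ k * ⅟ a)        ≡⟨ trans (cong (_* (κ m * ⅟ k * ⅟ a)) (trans (term-* m 1 2≤a) ι1)) (ℚₚ.*-identityˡ _) ⟩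
  κ m * ⅟ k * ⅟ a                                   ∎
  where
  open ℚₚ.≤-Reasoning
  t = term m 1 a
  L = logSum 2 m

-- The origin of the threshold 200: log 2 is at least ½ at every index, so 1/(m + 1) ≤ 1/200 is at
-- most a hundredth of it.
log2-error : ∀ m → 200 ℕ.≤ m → logSum 2 m + frac 1 m ≤ ι 101 * ⅟ 100 * logSum 2 m
log2-error m 200≤m = *-cancelˡ (0<ι {100} (s≤s z≤n)) (begin
  ι 100 * (L + frac 1 m)               ≡⟨ ℚₚ.*-distribˡ-+ (ι 100) L (frac 1 m) ⟩
  ι 100 * L + ι 100 * frac 1 m         ≤⟨ ℚₚ.+-monoʳ-≤ (ι 100 * L) (*-cancelˡ (0<ι {2} (s≤s z≤n)) (begin
    ι 2 * (ι 100 * frac 1 m)             ≡⟨ ℚₚ.*-assoc (ι 2) (ι 100) (frac 1 m) ⟨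
    ι 2 * ι 100 * frac 1 m               ≡⟨ cong₂ _*_ (sym (ι-* 2 100)) (sym (⅟≡frac m)) ⟩
    ι 200 * ⅟ (suc m)                    ≤⟨ ι*⅟-≤ {200} {1} {suc m} z<s (ℕₚ.≤-trans 200≤m (ℕₚ.≤-trans (ℕₚ.n≤1+n m) (ℕₚ.≤-reflexive (sym (ℕₚ.*-identityˡ (suc m)))))) ⟩
    ι 1                                  ≡⟨ trans ι1 (trans (sym (half+half 1ℚ)) (solve 1 (λ x → con 1ℚ :* x :+ con 1ℚ :* x := (con 1ℚ :+ con 1ℚ) :* x) refl ½)) ⟩
    (1ℚ + 1ℚ) * ½                        ≡⟨ cong (_* ½) (trans (ι-+ 1 1) (cong₂ _+_ ι1 ι1)) ⟨
    ι 2 * ½                              ≤⟨ *-monoˡ (0≤ι 2) (log≥½ 0 m) ⟩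
    ι 2 * L                              ∎)) ⟩
  ι 100 * L + L                        ≡⟨ trans (ℚₚ.+-comm (ι 100 * L) L) (sym (ι-suc 100 L)) ⟩
  ι 101 * L                            ≡⟨ trans (sym (ℚₚ.*-identityˡ (ι 101 * L))) (cong (_* (ι 101 * L)) (sym (ι*⅟ {100} z<s))) ⟩
  ι 100 * ⅟ 100 * (ι 101 * L)          ≡⟨ solve 4 (λ a b c l → a :* b :* (c :* l) := a :* (c :* b :* l)) refl (ι 100) (⅟ 100) (ι 101) L ⟩
  ι 100 * (ι 101 * ⅟ 100 * L)          ∎)
  where
  open ℚₚ.≤-Reasoning
  L = logSum 2 m

term-lower : ∀ m {a} k → 200 ℕ.≤ m → 2 ℕ.≤ a → 0 ℕ.< k → a ℕ.≤ 2 ^ k →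
             ι 100 * ⅟ 101 * (κ m * ⅟ k * ⅟ a) ≤ term m 1 a
term-lower m {a} k 200≤m 2≤a 0<k a≤2^k = begin
  ι 100 * ⅟ 101 * W                                   ≡⟨ ℚₚ.*-identityˡ _ ⟨
  1ℚ * (ι 100 * ⅟ 101 * W)                            ≡⟨ cong (_* (ι 100 * ⅟ 101 * W)) (trans (term-* m 1 2≤a) ι1) ⟨
  t * (ι a * logSum a m) * (ι 100 * ⅟ 101 * W)        ≤⟨ *-monoʳ (*-nonNeg (*-nonNeg (0≤ι 100) (0≤⅟ 101)) (*-nonNeg (*-nonNeg (0≤κ m) (0≤⅟ k)) (0≤⅟ a))) (*-monoˡ (term-nonNeg m 1 a) (*-monoˡ (0≤ι a)
                                                          (ℚₚ.≤-trans (logSum-mono {a} {2 ^ k} m a≤2^k) (ℚₚ.≤-trans (logSum-2^-upper k m) (*-monoˡ (0≤ι k) (log2-error m 200≤m)))))) ⟩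
  t * (ι a * (ι k * (ι 101 * ⅟ 100 * L))) * (ι 100 * ⅟ 101 * W)
                                                      ≡⟨ solve 11 (λ t a k d c′ l c d′ x k′ a′ → t :* (a :* (k :* (d :* c′ :* l))) :* (c :* d′ :* (x :* k′ :* a′))
                                                             := t :* (x :* l :* (k :* k′) :* (a :* a′) :* ((c :* c′) :* (d :* d′))))
                                                          refl t (ι a) (ι k) (ι 101) (⅟ 100) L (ι 100) (⅟ 101) (κ m) (⅟ k) (⅟ a) ⟩
  t * (κ m * L * (ι k * ⅟ k) * (ι a * ⅟ a) * (ι 100 * ⅟ 100 * (ι 101 * ⅟ 101)))
                                                      ≡⟨ cong (t *_) (cong₂ _*_ (cong₂ _*_ (cong₂ _*_ (κ*log2 m) (ι*⅟ 0<k)) (ι*⅟ {a} (ℕₚ.≤-trans (s≤s z≤n) 2≤a)))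
                                                          (cong₂ _*_ (ι*⅟ {100} z<s) (ι*⅟ {101} z<s))) ⟩
  t * (1ℚ * 1ℚ * 1ℚ * (1ℚ * 1ℚ))                      ≡⟨ ℚₚ.*-identityʳ t ⟩
  t                                                   ∎
  where
  open ℚₚ.≤-Reasoning
  t = term m 1 a
  L = logSum 2 m
  W = κ m * ⅟ k * ⅟ a

-- Prime divisors, products of two primes and the exchanged set

-- `ω n` is by definition the length of this list, so bounds on `ω` reduce to membership.
primeDivisors : ℕ → List ℕ
primeDivisors n = filter (λ p → prime? p ×-dec p ∣? n) (upTo (suc n))

∈-primeDivisors⁺ : ∀ {p n} → .{{ℕ.NonZero n}} → Prime p → p ∣ n → p ∈ primeDivisors n
∈-primeDivisors⁺ {p} {n} pp p∣n = ∈-filter⁺ (λ p → prime? p ×-dec p ∣? n) (∈-upTo⁺ (s≤s (∣⇒≤ p∣n))) (pp , p∣n)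

1≤length : ∀ {x} {xs : List ℕ} → x ∈ xs → 1 ℕ.≤ length xs
1≤length (here _)  = s≤s z≤n
1≤length (there _) = s≤s z≤n

2≤length : ∀ {x y} {xs : List ℕ} → x ≢ y → x ∈ xs → y ∈ xs → 2 ℕ.≤ length xs
2≤length x≢y (here refl) (here refl) = contradiction refl x≢y
2≤length x≢y (here refl) (there y∈)  = s≤s (1≤length y∈)
2≤length x≢y (there x∈)  (here refl) = s≤s (1≤length x∈)
2≤length x≢y (there x∈)  (there y∈)  = ℕₚ.m≤n⇒m≤1+n (2≤length x≢y x∈ y∈)

length≤1 : ∀ {x : ℕ} {xs} → Unique xs → (∀ {y} → y ∈ xs → y ≡ x) → length xs ℕ.≤ 1
length≤1 [] _ = z≤n
length≤1 (_ ∷ []) _ = s≤s z≤n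
length≤1 ((y≢z ∷ _) ∷ _ ∷ _) eq = contradiction (trans (eq (here refl)) (sym (eq (there (here refl))))) y≢z

ω-prime : ∀ {p} → Prime p → ω p ≡ 1
ω-prime {p} pp = ℕₚ.≤-antisym
  (length≤1 (Uniqueₚ.filter⁺ P? (Uniqueₚ.upTo⁺ (suc p)))
    (λ q∈ → let pq , q∣p = proj₂ (∈-filter⁻ P? {xs = upTo (suc p)} q∈) in prime∣prime⇒≡ pq pp q∣p))
  (1≤length (∈-primeDivisors⁺ {{prime⇒nonZero pp}} pp ∣-refl))
  where
  P? = λ q → prime? q ×-dec q ∣? p

prime*prime≢0 : ∀ {p q} → Prime p → Prime q → ℕ.NonZero (p ℕ.* q)
prime*prime≢0 pp pq = ℕₚ.m*n≢0 _ _ {{prime⇒nonZero pp}} {{prime⇒nonZero pq}}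

1≤ω-semiprime : ∀ {p q} → Prime p → Prime q → 1 ℕ.≤ ω (p ℕ.* q)
1≤ω-semiprime {p} {q} pp pq = 1≤length (∈-primeDivisors⁺ {{prime*prime≢0 pp pq}} pp (m∣m*n q))

2≤ω-semiprime : ∀ {p q} → Prime p → Prime q → p ≢ q → 2 ℕ.≤ ω (p ℕ.* q)
2≤ω-semiprime {p} {q} pp pq p≢q = 2≤length p≢q
  (∈-primeDivisors⁺ {{prime*prime≢0 pp pq}} pp (m∣m*n q)) (∈-primeDivisors⁺ {{prime*prime≢0 pp pq}} pq (n∣m*n p))

-- Pairing p only with itself and later entries produces each unordered pair once, so the list can
-- be free of repetitions, as a sum over a set demands.
semiprimes : List ℕ → List ℕ
semiprimes []       = []
semiprimes (p ∷ ps) = map (p ℕ.*_) (p ∷ ps) ++ semiprimes ps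

∈-semiprimes⁻ : ∀ ps {a} → a ∈ semiprimes ps → ∃[ p ] ∃[ q ] p ∈ ps × q ∈ ps × a ≡ p ℕ.* q
∈-semiprimes⁻ (p ∷ ps) a∈ with ∈-++⁻ (map (p ℕ.*_) (p ∷ ps)) a∈
... | inj₁ a∈ˡ = let q , q∈ , eq = ∈-map⁻ (p ℕ.*_) a∈ˡ in p , q , here refl , q∈ , eq
... | inj₂ a∈ʳ = let p′ , q′ , p′∈ , q′∈ , eq = ∈-semiprimes⁻ ps a∈ʳ in p′ , q′ , there p′∈ , there q′∈ , eq

-- The head p divides every product of its own row and, by Euclid's lemma, no product of two later
-- primes.
semiprimes-unique : ∀ ps → Unique ps → All Prime ps → Unique (semiprimes ps)
semiprimes-unique [] _ _ = []
semiprimes-unique (p ∷ ps) u@(p∉ps ∷ u′) (pp ∷ prs) = Uniqueₚ.++⁺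
  (Uniqueₚ.map⁺ (ℕₚ.*-cancelˡ-≡ _ _ p {{prime⇒nonZero pp}}) u)
  (semiprimes-unique ps u′ prs) disjoint
  where
  absurd : ∀ {q r} → q ∈ ps → r ∈ ps → ¬ p ∣ q ℕ.* r
  absurd {q} {r} q∈ r∈ d with euclidsLemma q r pp d
  ... | inj₁ p∣q = All.lookup p∉ps q∈ (prime∣prime⇒≡ pp (All.lookup prs q∈) p∣q)
  ... | inj₂ p∣r = All.lookup p∉ps r∈ (prime∣prime⇒≡ pp (All.lookup prs r∈) p∣r)
  disjoint : ∀ {a} → ¬ (a ∈ map (p ℕ.*_) (p ∷ ps) × a ∈ semiprimes ps)
  disjoint (a∈ , a∈′) with ∈-map⁻ (p ℕ.*_) a∈ | ∈-semiprimes⁻ ps a∈′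
  ... | s , _ , refl | q , r , q∈ , r∈ , eq = absurd q∈ r∈ (subst (p ∣_) eq (m∣m*n s))

-- The weight ω counts each product of two distinct primes twice and each square
-- once, so the sum runs over ordered pairs.
∑semiprimes-lower : ∀ (F : ℕ → ℚ) → (∀ a → 0ℚ ≤ F a) → ∀ ps → Unique ps → All Prime ps →
  sumℚ ps (λ p → sumℚ ps (λ q → F (p ℕ.* q))) ≤ sumℚ (semiprimes ps) (λ a → ι (ω a) * F a)
∑semiprimes-lower F 0≤F [] _ _ = ℚₚ.≤-refl
∑semiprimes-lower F 0≤F (p ∷ ps) (p∉ps ∷ u) (pp ∷ prs) = begin
  G p p + sumℚ ps (G p) + sumℚ ps (λ q → G q p + sumℚ ps (G q))
    ≡⟨ cong (G p p + sumℚ ps (G p) +_) (trans (sumℚ-+ (λ q → G q p) (λ q → sumℚ ps (G q)) ps)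
         (cong (_+ sumℚ ps (λ q → sumℚ ps (G q))) (sumℚ-cong ps (λ {q} _ → cong F (ℕₚ.*-comm q p))))) ⟩
  G p p + sumℚ ps (G p) + (sumℚ ps (G p) + sumℚ ps (λ q → sumℚ ps (G q)))
    ≡⟨ solve 3 (λ a b c → a :+ b :+ (b :+ c) := a :+ (b :+ b) :+ c) refl (G p p) (sumℚ ps (G p)) (sumℚ ps (λ q → sumℚ ps (G q))) ⟩
  G p p + (sumℚ ps (G p) + sumℚ ps (G p)) + sumℚ ps (λ q → sumℚ ps (G q))
    ≤⟨ ℚₚ.+-mono-≤ (ℚₚ.+-mono-≤ square (ℚₚ.≤-trans (ℚₚ.≤-reflexive (sym (sumℚ-+ (G p) (G p) ps))) (sumℚ-mono ps pair)))
         (∑semiprimes-lower F 0≤F ps u prs) ⟩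
  W (p ℕ.* p) + sumℚ ps (W ∘ (p ℕ.*_)) + sumℚ (semiprimes ps) W
    ≡⟨ cong (λ x → W (p ℕ.* p) + x + sumℚ (semiprimes ps) W) (sumℚ-map W (p ℕ.*_) ps) ⟨
  sumℚ (map (p ℕ.*_) (p ∷ ps)) W + sumℚ (semiprimes ps) W
    ≡⟨ sumℚ-++ W (map (p ℕ.*_) (p ∷ ps)) (semiprimes ps) ⟨
  sumℚ (semiprimes (p ∷ ps)) W ∎
  where
  open ℚₚ.≤-Reasoning
  G : ℕ → ℕ → ℚ
  G p q = F (p ℕ.* q)
  W : ℕ → ℚ
  W a = ι (ω a) * F a
  square : G p p ≤ W (p ℕ.* p)
  square = ℚₚ.≤-trans (ℚₚ.≤-reflexive (trans (sym (ℚₚ.*-identityˡ (G p p))) (cong (_* G p p) (sym ι1))))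
    (*-monoʳ (0≤F (p ℕ.* p)) (ι-mono (1≤ω-semiprime pp pp)))
  pair : ∀ {q} → q ∈ ps → G p q + G p q ≤ W (p ℕ.* q)
  pair {q} q∈ = ℚₚ.≤-trans (ℚₚ.≤-reflexive (sym (trans (ι-suc 1 (G p q)) (cong (G p q +_) (trans (cong (_* G p q) ι1) (ℚₚ.*-identityˡ (G p q)))))))
    (*-monoʳ (0≤F (p ℕ.* q)) (ι-mono (2≤ω-semiprime pp (All.lookup prs q∈) (All.lookup p∉ps q∈))))

module _ (y : ℕ) where

  Exchanged : Pred ℕ 0ℓ
  Exchanged a = (Prime a × a ℕ.≤ y) ⊎ (∃[ p ] ∃[ q ] Prime p × Prime q × y ℕ.< p × y ℕ.< q × a ≡ p ℕ.* q)

  -- Both sides have two prime factors: a common p cancels and leaves one prime dividing another.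
  semiprime∣semiprime⇒≡ : ∀ {p q p′ q′} → Prime p → Prime q → Prime p′ → Prime q′ →
                          p ℕ.* q ∣ p′ ℕ.* q′ → p ℕ.* q ≡ p′ ℕ.* q′
  semiprime∣semiprime⇒≡ {p} {q} {p′} {q′} pp pq pp′ pq′ d with euclidsLemma p′ q′ pp (∣-trans (m∣m*n q) d)
  ... | inj₁ p∣p′ with refl ← prime∣prime⇒≡ pp pp′ p∣p′ =
    cong (p ℕ.*_) (prime∣prime⇒≡ pq pq′ (*-cancelˡ-∣ p {{prime⇒nonZero pp}} d))
  ... | inj₂ p∣q′ with refl ← prime∣prime⇒≡ pp pq′ p∣q′ =
    trans (cong (p ℕ.*_) (prime∣prime⇒≡ pq pp′ (*-cancelˡ-∣ p {{prime⇒nonZero pp}} (subst (p ℕ.* q ∣_) (ℕₚ.*-comm p′ p) d)))) (ℕₚ.*-comm p p′)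

  -- In the mixed cases some prime would be at most y and greater than y at once.
  exchanged-primitive : Primitive Exchanged
  exchanged-primitive (inj₁ (pa , _)) (inj₁ (pb , _)) d = prime∣prime⇒≡ pa pb d
  exchanged-primitive (inj₁ (pa , a≤y)) (inj₂ (p , q , pp , pq , y<p , y<q , refl)) d with euclidsLemma p q pa d
  ... | inj₁ a∣p = contradiction (subst (y ℕ.<_) (sym (prime∣prime⇒≡ pa pp a∣p)) y<p) (ℕₚ.≤⇒≯ a≤y)
  ... | inj₂ a∣q = contradiction (subst (y ℕ.<_) (sym (prime∣prime⇒≡ pa pq a∣q)) y<q) (ℕₚ.≤⇒≯ a≤y)
  exchanged-primitive (inj₂ (p , q , pp , _ , y<p , _ , refl)) (inj₁ (pb , b≤y)) d =
    contradiction (subst (y ℕ.<_) (prime∣prime⇒≡ pp pb (∣-trans (m∣m*n q) d)) y<p) (ℕₚ.≤⇒≯ b≤y)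
  exchanged-primitive (inj₂ (p , q , pp , pq , _ , _ , refl)) (inj₂ (p′ , q′ , pp′ , pq′ , _ , _ , refl)) d =
    semiprime∣semiprime⇒≡ pp pq pp′ pq′ d

  exchanged-positive : ∀ {a} → Exchanged a → 0 ℕ.< a
  exchanged-positive (inj₁ (pa , _)) = ℕₚ.<-trans z<s (prime⇒1< pa)
  exchanged-positive (inj₂ (p , q , pp , pq , _ , _ , refl)) = ℕ.>-nonZero⁻¹ (p ℕ.* q) {{prime*prime≢0 pp pq}}

  1∉exchanged : ¬ Exchanged 1
  1∉exchanged (inj₁ (p1 , _)) = ¬prime[1] p1
  1∉exchanged (inj₂ (p , q , pp , _ , _ , _ , eq)) = ¬prime[1] (subst Prime (∣1⇒≡1 (subst (p ∣_) (sym eq) (m∣m*n q))) pp)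

  lowPrimes++semiprimes : ℕ → List ℕ
  lowPrimes++semiprimes z = primes 0 y ++ semiprimes (primes y z)

  lowPrimes++semiprimes-∈ : ∀ {z} → y ℕ.≤ z → All Exchanged (lowPrimes++semiprimes z)
  lowPrimes++semiprimes-∈ {z} y≤z = Allₚ.++⁺
    (All.tabulate λ p∈ → let pp , _ , p≤y = ∈-primes⁻ {0} {y} z≤n p∈ in inj₁ (pp , p≤y))
    (All.tabulate λ a∈ → let p , q , p∈ , q∈ , eq = ∈-semiprimes⁻ (primes y z) a∈
                             pp , y<p , _ = ∈-primes⁻ y≤z p∈
                             pq , y<q , _ = ∈-primes⁻ y≤z q∈
                         in inj₂ (p , q , pp , pq , y<p , y<q , eq))

  lowPrimes++semiprimes-unique : ∀ {z} → y ℕ.≤ z → Unique (lowPrimes++semiprimes z)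
  lowPrimes++semiprimes-unique {z} y≤z = Uniqueₚ.++⁺ (primes-unique 0 y)
    (semiprimes-unique (primes y z) (primes-unique y z) (All.tabulate (proj₁ ∘ ∈-primes⁻ y≤z))) disjoint
    where
    disjoint : ∀ {a} → ¬ (a ∈ primes 0 y × a ∈ semiprimes (primes y z))
    disjoint (a∈ , a∈′) with ∈-primes⁻ {0} {y} z≤n a∈ | ∈-semiprimes⁻ (primes y z) a∈′
    ... | pa , _ , a≤y | p , q , p∈ , _ , refl with ∈-primes⁻ y≤z p∈
    ... | pp , y<p , _ = contradiction (subst (y ℕ.<_) (prime∣prime⇒≡ pp pa (m∣m*n q)) y<p) (ℕₚ.≤⇒≯ a≤y)

-- The numerical sums over bucket indices

⅟-* : ∀ {a b} → 0 ℕ.< a → 0 ℕ.< b → ⅟ (a ℕ.* b) ≡ ⅟ a * ⅟ b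
⅟-* {a} {b} 0<a 0<b = begin
  ⅟ (a ℕ.* b)                                    ≡⟨ trans (solve 1 (λ x → x := con 1ℚ :* con 1ℚ :* x) refl (⅟ (a ℕ.* b)))
                                                      (cong (_* ⅟ (a ℕ.* b)) (sym (cong₂ _*_ (ι*⅟ 0<a) (ι*⅟ 0<b)))) ⟩
  ι a * ⅟ a * (ι b * ⅟ b) * ⅟ (a ℕ.* b)          ≡⟨ solve 5 (λ a x b y z → a :* x :* (b :* y) :* z := x :* y :* (a :* b :* z)) refl (ι a) (⅟ a) (ι b) (⅟ b) (⅟ (a ℕ.* b)) ⟩
  ⅟ a * ⅟ b * (ι a * ι b * ⅟ (a ℕ.* b))          ≡⟨ cong (λ x → ⅟ a * ⅟ b * (x * ⅟ (a ℕ.* b))) (ι-* a b) ⟨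
  ⅟ a * ⅟ b * (ι (a ℕ.* b) * ⅟ (a ℕ.* b))        ≡⟨ trans (cong (⅟ a * ⅟ b *_) (ι*⅟ (ℕₚ.*-mono-≤ 0<a 0<b))) (ℚₚ.*-identityʳ (⅟ a * ⅟ b)) ⟩
  ⅟ a * ⅟ b                                      ∎
  where open ≡-Reasoning

-- With i = k + 1 this is 1/i² < 1/(i² - 1/4) = 2/(2i - 1) - 2/(2i + 1). Summed from i = 10 on, it
-- yields the constant 2/19.
⅟²-telescope : ∀ k → ⅟ (suc k) * ⅟ (suc k) + ι 2 * ⅟ (2 ℕ.* suc k ℕ.+ 1) ≤ ι 2 * ⅟ (2 ℕ.* k ℕ.+ 1)
⅟²-telescope k = *-cancelˡ (0<ι {i ℕ.* i ℕ.* (u ℕ.* w)} (ℕₚ.*-mono-≤ {1} {i ℕ.* i} (s≤s z≤n) (ℕₚ.*-mono-≤ 0<u 0<w))) (begin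
  ι (i ℕ.* i ℕ.* (u ℕ.* w)) * (⅟ i * ⅟ i + ι 2 * ⅟ w)
    ≡⟨ cong (_* (⅟ i * ⅟ i + ι 2 * ⅟ w)) expand ⟩
  ι i * ι i * (ι u * ι w) * (⅟ i * ⅟ i + ι 2 * ⅟ w)
    ≡⟨ solve 7 (λ i u w i′ c u′ w′ → i :* i :* (u :* w) :* (i′ :* i′ :+ c :* w′) := (i :* i′) :* (i :* i′) :* (u :* w) :+ i :* i :* u :* c :* (w :* w′))
         refl (ι i) (ι u) (ι w) (⅟ i) (ι 2) (⅟ u) (⅟ w) ⟩
  ι i * ⅟ i * (ι i * ⅟ i) * (ι u * ι w) + ι i * ι i * ι u * ι 2 * (ι w * ⅟ w)
    ≡⟨ cong₂ (λ x y → x * x * (ι u * ι w) + ι i * ι i * ι u * ι 2 * y) (ι*⅟ {i} z<s) (ι*⅟ 0<w) ⟩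
  1ℚ * 1ℚ * (ι u * ι w) + ι i * ι i * ι u * ι 2 * 1ℚ
    ≡⟨ trans (cong₂ _+_ (trans (ℚₚ.*-identityˡ (ι u * ι w)) (sym (ι-* u w)))
         (trans (ℚₚ.*-identityʳ _) (sym (trans (ι-* (i ℕ.* i ℕ.* u) 2) (cong (_* ι 2) (trans (ι-* (i ℕ.* i) u) (cong (_* ι u) (ι-* i i))))))))
         (sym (ι-+ (u ℕ.* w) (i ℕ.* i ℕ.* u ℕ.* 2))) ⟩
  ι (u ℕ.* w ℕ.+ i ℕ.* i ℕ.* u ℕ.* 2)
    ≤⟨ ι-mono (ℕₚ.≤-trans (ℕₚ.n≤1+n _) (ℕₚ.≤-reflexive (identity k))) ⟩
  ι (i ℕ.* i ℕ.* w ℕ.* 2)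
    ≡⟨ trans (ι-* (i ℕ.* i ℕ.* w) 2) (cong (_* ι 2) (trans (ι-* (i ℕ.* i) w) (cong (_* ι w) (ι-* i i)))) ⟩
  ι i * ι i * ι w * ι 2
    ≡⟨ ℚₚ.*-identityʳ _ ⟨
  ι i * ι i * ι w * ι 2 * 1ℚ
    ≡⟨ cong (ι i * ι i * ι w * ι 2 *_) (ι*⅟ 0<u) ⟨
  ι i * ι i * ι w * ι 2 * (ι u * ⅟ u)
    ≡⟨ solve 5 (λ i w c u u′ → i :* i :* w :* c :* (u :* u′) := i :* i :* (u :* w) :* (c :* u′)) refl (ι i) (ι w) (ι 2) (ι u) (⅟ u) ⟩
  ι i * ι i * (ι u * ι w) * (ι 2 * ⅟ u)
    ≡⟨ cong (_* (ι 2 * ⅟ u)) expand ⟨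
  ι (i ℕ.* i ℕ.* (u ℕ.* w)) * (ι 2 * ⅟ u) ∎)
  where
  open ℚₚ.≤-Reasoning
  i = suc k
  u = 2 ℕ.* k ℕ.+ 1
  w = 2 ℕ.* suc k ℕ.+ 1
  0<u : 0 ℕ.< u
  0<u = ℕₚ.m≤n+m 1 (2 ℕ.* k)
  0<w : 0 ℕ.< w
  0<w = ℕₚ.m≤n+m 1 (2 ℕ.* suc k)
  expand : ι (i ℕ.* i ℕ.* (u ℕ.* w)) ≡ ι i * ι i * (ι u * ι w)
  expand = trans (ι-* (i ℕ.* i) (u ℕ.* w)) (cong₂ _*_ (ι-* i i) (ι-* u w))
  identity : ∀ k → suc ((2 ℕ.* k ℕ.+ 1) ℕ.* (2 ℕ.* suc k ℕ.+ 1) ℕ.+ suc k ℕ.* suc k ℕ.* (2 ℕ.* k ℕ.+ 1) ℕ.* 2)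
                 ≡ suc k ℕ.* suc k ℕ.* (2 ℕ.* suc k ℕ.+ 1) ℕ.* 2
  identity = solve-∀

∑⅟²-upper : ∀ k l → sumℚ (range k l) (λ i → ⅟ i * ⅟ i) ≤ ι 2 * ⅟ (2 ℕ.* k ℕ.+ 1)
∑⅟²-upper k zero = *-nonNeg (0≤ι 2) (0≤⅟ (2 ℕ.* k ℕ.+ 1))
∑⅟²-upper k (suc l) = ℚₚ.≤-trans (ℚₚ.+-monoʳ-≤ (⅟ (suc k) * ⅟ (suc k)) (∑⅟²-upper (suc k) l)) (⅟²-telescope k)

-- The summand 1 / (ij(i + j)) shifted by one in both indices: lower bounds use the upper end 2^((i
-- + 1)h) of a bucket, both for its reciprocal sum and for log pq.
kernel : ℕ → ℕ → ℚ
kernel i j = ⅟ (suc i) * (⅟ (suc j) * ⅟ (suc i ℕ.+ suc j))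

-- The kernel scaled by `D` and rounded down, so that the 390² terms are added as natural numbers
-- when the bound is checked by evaluation. Rounding loses less than 390²/D in total. `suc (pred …)`
-- exhibits a nonzero divisor.
kernelℕ : ℕ → ℕ → ℕ → ℕ
kernelℕ D i j = D ℕ./ suc (pred (suc i ℕ.* suc j ℕ.* (suc i ℕ.+ suc j)))

kernelℕ-lower : ∀ D i j → ι (kernelℕ D i j) ≤ ι D * kernel i j
kernelℕ-lower D i j = subst (λ x → ι (D ℕ./ suc c) ≤ ι D * x)
  (trans (⅟-* {suc i ℕ.* suc j} {suc i ℕ.+ suc j} z<s z<s) (trans (cong (_* ⅟ (suc i ℕ.+ suc j)) (⅟-* {suc i} {suc j} z<s z<s)) (ℚₚ.*-assoc (⅟ (suc i)) (⅟ (suc j)) _)))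
  (ι-≤-ι*⅟ {D} {D ℕ./ suc c} {suc c} z<s (div-*-≤ D (suc c) z<s))
  where
  c = pred (suc i ℕ.* suc j ℕ.* (suc i ℕ.+ suc j))

∑∑kernel : List ℕ → ℚ
∑∑kernel is = sumℚ is (λ i → sumℚ is (kernel i))

∑∑kernelℕ : ℕ → List ℕ → ℕ
∑∑kernelℕ D is = sum (map (λ i → sum (map (kernelℕ D i) is)) is)

∑∑kernelℕ-lower : ∀ D is → ι (∑∑kernelℕ D is) ≤ ι D * ∑∑kernel is
∑∑kernelℕ-lower D is = begin
  ι (∑∑kernelℕ D is)                                   ≡⟨ ι-sum (λ i → sum (map (kernelℕ D i) is)) is ⟩
  sumℚ is (λ i → ι (sum (map (kernelℕ D i) is)))       ≤⟨ sumℚ-mono is (λ {i} _ → begin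
    ι (sum (map (kernelℕ D i) is))                       ≡⟨ ι-sum (kernelℕ D i) is ⟩
    sumℚ is (λ j → ι (kernelℕ D i j))                    ≤⟨ sumℚ-mono is (λ {j} _ → kernelℕ-lower D i j) ⟩
    sumℚ is (λ j → ι D * kernel i j)                     ≡⟨ sumℚ-*ˡ (ι D) (kernel i) is ⟩
    ι D * sumℚ is (kernel i)                             ∎) ⟩
  sumℚ is (λ i → ι D * sumℚ is (kernel i))             ≡⟨ sumℚ-*ˡ (ι D) (λ i → sumℚ is (kernel i)) is ⟩
  ι D * ∑∑kernel is                                    ∎
  where open ℚₚ.≤-Reasoning

indices : List ℕ
indices = range 9 390

∑∑kernel-lower : ι 111000000 * ⅟ 1000000000 ≤ ∑∑kernel indices
∑∑kernel-lower = begin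
  ι 111000000 * ⅟ D                        ≤⟨ *-monoʳ (0≤⅟ D) (ℚₚ.≤-trans (ι-mono (ℕₚ.≤ᵇ⇒≤ 111000000 (∑∑kernelℕ D indices) _)) (∑∑kernelℕ-lower D indices)) ⟩
  ι D * ∑∑kernel indices * ⅟ D             ≡⟨ solve 3 (λ d x e → d :* x :* e := d :* e :* x) refl (ι D) (∑∑kernel indices) (⅟ D) ⟩
  ι D * ⅟ D * ∑∑kernel indices             ≡⟨ trans (cong (_* ∑∑kernel indices) (ι*⅟ {D} z<s)) (ℚₚ.*-identityˡ _) ⟩
  ∑∑kernel indices                         ∎
  where
  open ℚₚ.≤-Reasoning
  D = 1000000000

≤∑ : ∀ {p} ps → p ∈ ps → p ℕ.≤ sum ps
≤∑ (p ∷ ps) (here refl) = ℕₚ.m≤m+n p (sum ps)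
≤∑ (q ∷ ps) (there p∈)  = ℕₚ.m≤n⇒m≤o+n q (≤∑ ps p∈)

-- Comparison of finite sums at a fixed index m

module Gap (a r h : ℕ) (1000≤a : 1000 ℕ.≤ a) (a≤r : a ℕ.≤ r) (7000*399≤3a : 7000 ℕ.* 399 ℕ.≤ 3 ℕ.* a)
           (h-large : 1000 ℕ.* (2 ℕ.+ 2 ^ r ℕ.* suc r ℕ.+ 8 ℕ.* r) ℕ.≤ h) (0<h : 0 ℕ.< h) where

  open Buckets a r h 1000≤a a≤r h-large

  private
    ρ τ θ : ℚ
    ρ = ι 99 * ⅟ 100
    τ = ι 101 * ⅟ 100
    θ = ι 100 * ⅟ 101
    0≤ρ : 0ℚ ≤ ρ
    0≤ρ = *-nonNeg (0≤ι 99) (0≤⅟ 100)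
    0≤θ : 0ℚ ≤ θ
    0≤θ = *-nonNeg (0≤ι 100) (0≤⅟ 101)

  2^ : ℕ → ℕ
  2^ i = 2 ^ (i ℕ.* h)

  bucketSum≤ : ∀ i → 1 ℕ.≤ i → bucketSum i ≤ τ * ⅟ i
  bucketSum≤ i 1≤i = begin
    s                                            ≡⟨ trans (solve 1 (λ s → s := con 1ℚ :* con 1ℚ :* s) refl s) (cong (_* s) (sym (cong₂ _*_ (ι*⅟ {100} z<s) (ι*⅟ 1≤i)))) ⟩
    ι 100 * ⅟ 100 * (ι i * ⅟ i) * s              ≡⟨ solve 5 (λ c c′ i i′ s → c :* c′ :* (i :* i′) :* s := c :* (i :* s) :* (c′ :* i′)) refl (ι 100) (⅟ 100) (ι i) (⅟ i) s ⟩
    ι 100 * (ι i * s) * (⅟ 100 * ⅟ i)            ≤⟨ *-monoʳ (*-nonNeg (0≤⅟ 100) (0≤⅟ i)) (bucketSum-upper i) ⟩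
    ι 101 * (⅟ 100 * ⅟ i)                        ≡⟨ ℚₚ.*-assoc (ι 101) (⅟ 100) (⅟ i) ⟨
    τ * ⅟ i                                      ∎
    where
    open ℚₚ.≤-Reasoning
    s = bucketSum i

  ≤bucketSum : ∀ i → 1 ℕ.≤ i → i ℕ.≤ 399 → ρ * ⅟ (suc i) ≤ bucketSum i
  ≤bucketSum i 1≤i i≤399 = begin
    ι 99 * ⅟ 100 * ⅟ (suc i)                     ≡⟨ ℚₚ.*-assoc (ι 99) (⅟ 100) (⅟ (suc i)) ⟩
    ι 99 * (⅟ 100 * ⅟ (suc i))                   ≤⟨ *-monoʳ (*-nonNeg (0≤⅟ 100) (0≤⅟ (suc i))) (bucketSum-lower i 1≤i (ℕₚ.≤-trans (ℕₚ.*-monoʳ-≤ 7000 i≤399) 7000*399≤3a)) ⟩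
    ι 100 * (ι (suc i) * s) * (⅟ 100 * ⅟ (suc i)) ≡⟨ solve 5 (λ c c′ i i′ s → c :* (i :* s) :* (c′ :* i′) := c :* c′ :* (i :* i′) :* s) refl (ι 100) (⅟ 100) (ι (suc i)) (⅟ (suc i)) s ⟩
    ι 100 * ⅟ 100 * (ι (suc i) * ⅟ (suc i)) * s  ≡⟨ trans (cong (_* s) (cong₂ _*_ (ι*⅟ {100} z<s) (ι*⅟ {suc i} z<s))) (solve 1 (λ s → con 1ℚ :* con 1ℚ :* s := s) refl s) ⟩
    s                                            ∎
    where
    open ℚₚ.≤-Reasoning
    s = bucketSum i

  2^-mono : ∀ {i j} → i ℕ.≤ j → 2^ i ℕ.≤ 2^ j
  2^-mono i≤j = ℕₚ.^-monoʳ-≤ 2 (ℕₚ.*-monoˡ-≤ h i≤j)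

  concat-buckets : ∀ k l → concatMap bucket (range k l) ≡ primes (2^ (suc k)) (2^ (suc (k ℕ.+ l)))
  concat-buckets k zero = sym (trans (cong (λ b → primes (2^ (suc k)) (2^ (suc b))) (ℕₚ.+-identityʳ k)) (primes-empty (2^ (suc k))))
    where
    primes-empty : ∀ x → primes x x ≡ []
    primes-empty x rewrite ℕₚ.n∸n≡0 x = refl
  concat-buckets k (suc l) = begin
    bucket (suc k) ++ concatMap bucket (range (suc k) l)                      ≡⟨ cong (bucket (suc k) ++_) (concat-buckets (suc k) l) ⟩
    bucket (suc k) ++ primes (2^ (suc (suc k))) (2^ (suc (suc k ℕ.+ l)))      ≡⟨ primes-++ (bucket-bounds (suc k)) (2^-mono {suc (suc k)} {suc (suc k ℕ.+ l)} (s≤s (ℕₚ.m≤m+n (suc k) l))) ⟨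
    primes (2^ (suc k)) (2^ (suc (suc k ℕ.+ l)))                              ≡⟨ cong (λ b → primes (2^ (suc k)) (2^ (suc b))) (ℕₚ.+-suc k l) ⟨
    primes (2^ (suc k)) (2^ (suc (k ℕ.+ suc l)))                              ∎
    where open ≡-Reasoning

  module _ (m : ℕ) (200≤m : 200 ℕ.≤ m) where

    private
      K : ℚ
      K = κ m * ⅟ h
      0≤K : 0ℚ ≤ K
      0≤K = *-nonNeg (0≤κ m) (0≤⅟ h)
      t : ℕ → ℚ
      t = term m 1

    bucketTerm-upper : ∀ i → 1 ℕ.≤ i → sumℚ (bucket i) t ≤ K * τ * (⅟ i * ⅟ i)
    bucketTerm-upper i 1≤i = begin
      sumℚ (bucket i) t                                       ≤⟨ sumℚ-mono (bucket i) bound ⟩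
      sumℚ (bucket i) (λ p → κ m * ⅟ (i ℕ.* h) * ⅟ p)         ≡⟨ sumℚ-*ˡ (κ m * ⅟ (i ℕ.* h)) ⅟ (bucket i) ⟩
      κ m * ⅟ (i ℕ.* h) * bucketSum i                         ≤⟨ *-monoˡ (*-nonNeg (0≤κ m) (0≤⅟ (i ℕ.* h))) (bucketSum≤ i 1≤i) ⟩
      κ m * ⅟ (i ℕ.* h) * (τ * ⅟ i)                           ≡⟨ cong (λ x → κ m * x * (τ * ⅟ i)) (⅟-* 1≤i 0<h) ⟩
      κ m * (⅟ i * ⅟ h) * (τ * ⅟ i)                           ≡⟨ solve 4 (λ k i h t → k :* (i :* h) :* (t :* i) := k :* h :* t :* (i :* i)) refl (κ m) (⅟ i) (⅟ h) τ ⟩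
      K * τ * (⅟ i * ⅟ i)                                     ∎
      where
      open ℚₚ.≤-Reasoning
      bound : ∀ {p} → p ∈ bucket i → t p ≤ κ m * ⅟ (i ℕ.* h) * ⅟ p
      bound p∈ = let pp , x<p , _ = ∈-bucket⁻ i p∈ in term-upper m (i ℕ.* h) (prime⇒1< pp) (ℕₚ.*-mono-≤ 1≤i 0<h) (ℕₚ.<⇒≤ x<p)

    tail-upper : ∀ k l → sumℚ (concatMap bucket (range k l)) t ≤ K * τ * (ι 2 * ⅟ (2 ℕ.* k ℕ.+ 1))
    tail-upper k l = begin
      sumℚ (concatMap bucket (range k l)) t                   ≡⟨ sumℚ-concatMap t bucket (range k l) ⟩
      sumℚ (range k l) (λ i → sumℚ (bucket i) t)              ≤⟨ sumℚ-mono (range k l) (λ {i} i∈ → bucketTerm-upper i (ℕₚ.≤-trans (s≤s z≤n) (proj₁ (∈-range⁻ k l i∈)))) ⟩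
      sumℚ (range k l) (λ i → K * τ * (⅟ i * ⅟ i))            ≡⟨ sumℚ-*ˡ (K * τ) (λ i → ⅟ i * ⅟ i) (range k l) ⟩
      K * τ * sumℚ (range k l) (λ i → ⅟ i * ⅟ i)              ≤⟨ *-monoˡ (*-nonNeg 0≤K (*-nonNeg (0≤ι 101) (0≤⅟ 100))) (∑⅟²-upper k l) ⟩
      K * τ * (ι 2 * ⅟ (2 ℕ.* k ℕ.+ 1))                       ∎
      where open ℚₚ.≤-Reasoning

    semiprimeTerm-lower : ∀ {i j p q} → p ∈ bucket i → q ∈ bucket j →
                          θ * K * ⅟ (suc i ℕ.+ suc j) * ⅟ p * ⅟ q ≤ t (p ℕ.* q)
    semiprimeTerm-lower {i} {j} {p} {q} p∈ q∈ with ∈-bucket⁻ i p∈ | ∈-bucket⁻ j q∈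
    ... | pp , _ , p≤ | pq , _ , q≤ = begin
      θ * (κ m * ⅟ h) * ⅟ e * ⅟ p * ⅟ q                       ≡⟨ solve 6 (λ θ k h e p q → θ :* (k :* h) :* e :* p :* q := θ :* (k :* (e :* h) :* (p :* q))) refl θ (κ m) (⅟ h) (⅟ e) (⅟ p) (⅟ q) ⟩
      θ * (κ m * (⅟ e * ⅟ h) * (⅟ p * ⅟ q))                   ≡⟨ cong₂ (λ x y → θ * (κ m * x * y)) (⅟-* {e} z<s 0<h) (⅟-* {p} (ℕₚ.<-trans z<s (prime⇒1< pp)) (ℕₚ.<-trans z<s (prime⇒1< pq))) ⟨
      θ * (κ m * ⅟ (e ℕ.* h) * ⅟ (p ℕ.* q))                   ≤⟨ term-lower m (e ℕ.* h) 200≤m (ℕₚ.≤-trans (prime⇒1< pp) (ℕₚ.m≤m*n p q {{prime⇒nonZero pq}})) (ℕₚ.*-mono-≤ {1} {e} (s≤s z≤n) 0<h)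
                                                                (ℕₚ.≤-trans (ℕₚ.*-mono-≤ p≤ q≤) (ℕₚ.≤-reflexive (trans (sym (ℕₚ.^-distribˡ-+-* 2 (suc i ℕ.* h) (suc j ℕ.* h)))
                                                                  (cong (2 ^_) (sym (ℕₚ.*-distribʳ-+ h (suc i) (suc j))))))) ⟩
      t (p ℕ.* q)                                             ∎
      where
      open ℚₚ.≤-Reasoning
      e = suc i ℕ.+ suc j

    module _ (is : List ℕ) (is-bounds : ∀ {i} → i ∈ is → 1 ℕ.≤ i × i ℕ.≤ 399) where

      private
        S = concatMap bucket is
        row : ℕ → ℚ
        row i = sumℚ is (λ j → ⅟ (suc j) * ⅟ (suc i ℕ.+ suc j))

      0≤row : ∀ i → 0ℚ ≤ row i
      0≤row i = sumℚ-nonNeg is (λ {j} _ → *-nonNeg (0≤⅟ (suc j)) (0≤⅟ (suc i ℕ.+ suc j)))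

      -- The q-sum is bounded bucket by bucket, and the bound depends on p only through 1/p and its
      -- bucket index. The sum over p can therefore use the bound on `bucketSum` a second time,
      -- which is why `ρ` occurs twice in the end.
      row-lower : ∀ {i p} → p ∈ bucket i → θ * K * ρ * row i * ⅟ p ≤ sumℚ S (λ q → t (p ℕ.* q))
      row-lower {i} {p} p∈ = begin
        θ * K * ρ * row i * ⅟ p                                               ≡⟨ solve 3 (λ x r p → x :* r :* p := x :* p :* r) refl (θ * K * ρ) (row i) (⅟ p) ⟩
        θ * K * ρ * ⅟ p * row i                                               ≡⟨ sumℚ-*ˡ (θ * K * ρ * ⅟ p) _ is ⟨
        sumℚ is (λ j → θ * K * ρ * ⅟ p * (⅟ (suc j) * ⅟ (suc i ℕ.+ suc j)))   ≤⟨ sumℚ-mono is bound ⟩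
        sumℚ is (λ j → sumℚ (bucket j) (λ q → t (p ℕ.* q)))                   ≡⟨ sumℚ-concatMap (λ q → t (p ℕ.* q)) bucket is ⟨
        sumℚ S (λ q → t (p ℕ.* q))                                            ∎
        where
        open ℚₚ.≤-Reasoning
        bound : ∀ {j} → j ∈ is → θ * K * ρ * ⅟ p * (⅟ (suc j) * ⅟ (suc i ℕ.+ suc j)) ≤ sumℚ (bucket j) (λ q → t (p ℕ.* q))
        bound {j} j∈ = begin
          θ * K * ρ * ⅟ p * (⅟ (suc j) * c)                     ≡⟨ solve 6 (λ θ k r p j c → θ :* k :* r :* p :* (j :* c) := θ :* k :* c :* p :* (r :* j)) refl θ K ρ (⅟ p) (⅟ (suc j)) c ⟩
          θ * K * c * ⅟ p * (ρ * ⅟ (suc j))                     ≤⟨ *-monoˡ (*-nonNeg (*-nonNeg (*-nonNeg 0≤θ 0≤K) (0≤⅟ (suc i ℕ.+ suc j))) (0≤⅟ p)) (≤bucketSum j (proj₁ (is-bounds j∈)) (proj₂ (is-bounds j∈))) ⟩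
          θ * K * c * ⅟ p * bucketSum j                         ≡⟨ sumℚ-*ˡ (θ * K * c * ⅟ p) ⅟ (bucket j) ⟨
          sumℚ (bucket j) (λ q → θ * K * c * ⅟ p * ⅟ q)         ≤⟨ sumℚ-mono (bucket j) (semiprimeTerm-lower p∈) ⟩
          sumℚ (bucket j) (λ q → t (p ℕ.* q))                   ∎
          where
          c = ⅟ (suc i ℕ.+ suc j)

      table-lower : K * (θ * (ρ * (ρ * ∑∑kernel is))) ≤ sumℚ S (λ p → sumℚ S (λ q → t (p ℕ.* q)))
      table-lower = begin
        K * (θ * (ρ * (ρ * ∑∑kernel is)))                       ≡⟨ solve 4 (λ k θ r x → k :* (θ :* (r :* (r :* x))) := θ :* k :* r :* r :* x) refl K θ ρ (∑∑kernel is) ⟩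
        θ * K * ρ * ρ * ∑∑kernel is                             ≡⟨ sumℚ-*ˡ (θ * K * ρ * ρ) (λ i → sumℚ is (kernel i)) is ⟨
        sumℚ is (λ i → θ * K * ρ * ρ * sumℚ is (kernel i))      ≤⟨ sumℚ-mono is bound ⟩
        sumℚ is (λ i → sumℚ (bucket i) (λ p → sumℚ S (λ q → t (p ℕ.* q))))  ≡⟨ sumℚ-concatMap (λ p → sumℚ S (λ q → t (p ℕ.* q))) bucket is ⟨
        sumℚ S (λ p → sumℚ S (λ q → t (p ℕ.* q)))               ∎
        where
        open ℚₚ.≤-Reasoning
        bound : ∀ {i} → i ∈ is → θ * K * ρ * ρ * sumℚ is (kernel i) ≤ sumℚ (bucket i) (λ p → sumℚ S (λ q → t (p ℕ.* q)))
        bound {i} i∈ = begin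
          θ * K * ρ * ρ * sumℚ is (kernel i)                    ≡⟨ cong (θ * K * ρ * ρ *_) (sumℚ-*ˡ (⅟ (suc i)) _ is) ⟩
          θ * K * ρ * ρ * (⅟ (suc i) * row i)                   ≡⟨ solve 4 (λ x r i w → x :* r :* (i :* w) := x :* w :* (r :* i)) refl (θ * K * ρ) ρ (⅟ (suc i)) (row i) ⟩
          θ * K * ρ * row i * (ρ * ⅟ (suc i))                   ≤⟨ *-monoˡ (*-nonNeg (*-nonNeg (*-nonNeg 0≤θ 0≤K) 0≤ρ) (0≤row i)) (≤bucketSum i (proj₁ (is-bounds i∈)) (proj₂ (is-bounds i∈))) ⟩
          θ * K * ρ * row i * bucketSum i                       ≡⟨ sumℚ-*ˡ (θ * K * ρ * row i) ⅟ (bucket i) ⟨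
          sumℚ (bucket i) (λ p → θ * K * ρ * row i * ⅟ p)       ≤⟨ sumℚ-mono (bucket i) row-lower ⟩
          sumℚ (bucket i) (λ p → sumℚ S (λ q → t (p ℕ.* q)))    ∎

    -- One bound for all finite sets of primes: the tail estimate does not depend on the number of
    -- buckets needed to cover `ps`.
    primeSum-upper : ∀ ps → Unique ps → All Prime ps →
                     sumℚ ps (λ p → term m (ω p) p) ≤ sumℚ (primes 0 (2^ 10)) t + K * (τ * (ι 2 * ⅟ 19))
    primeSum-upper ps u prs = begin
      sumℚ ps (λ p → term m (ω p) p)                          ≡⟨ sumℚ-cong ps (λ {p} p∈ → cong (λ c → term m c p) (ω-prime (All.lookup prs p∈))) ⟩
      sumℚ ps t                                               ≤⟨ sumℚ-⊆ (term-nonNeg m 1) (primes 0 (2^ (10 ℕ.+ l))) u ps⊆ ⟩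
      sumℚ (primes 0 (2^ (10 ℕ.+ l))) t                       ≡⟨ cong (λ xs → sumℚ xs t) (trans (primes-++ {0} {2^ 10} {2^ (10 ℕ.+ l)} z≤n (2^-mono {10} {10 ℕ.+ l} (ℕₚ.m≤m+n 10 l))) (cong (primes 0 (2^ 10) ++_) (sym (concat-buckets 9 l)))) ⟩
      sumℚ (primes 0 (2^ 10) ++ concatMap bucket (range 9 l)) t  ≡⟨ sumℚ-++ t (primes 0 (2^ 10)) _ ⟩
      sumℚ (primes 0 (2^ 10)) t + sumℚ (concatMap bucket (range 9 l)) t
                                                              ≤⟨ ℚₚ.+-monoʳ-≤ (sumℚ (primes 0 (2^ 10)) t) (tail-upper 9 l) ⟩
      sumℚ (primes 0 (2^ 10)) t + K * τ * (ι 2 * ⅟ 19)        ≡⟨ cong (sumℚ (primes 0 (2^ 10)) t +_) (ℚₚ.*-assoc K τ (ι 2 * ⅟ 19)) ⟩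
      sumℚ (primes 0 (2^ 10)) t + K * (τ * (ι 2 * ⅟ 19))      ∎
      where
      open ℚₚ.≤-Reasoning
      -- Crude but enough: each p in `ps` is at most l, and l < 2^l ≤ 2^((10 + l)h).
      l = sum ps
      l≤ : l ℕ.≤ (10 ℕ.+ l) ℕ.* h
      l≤ = ℕₚ.≤-trans (ℕₚ.m≤n+m l 10) (ℕₚ.m≤m*n (10 ℕ.+ l) h {{>-nonZero 0<h}})
      ps⊆ : ∀ {p} → p ∈ ps → p ∈ primes 0 (2^ (10 ℕ.+ l))
      ps⊆ {p} p∈ = ∈-primes⁺ pp (ℕₚ.<-trans z<s (prime⇒1< pp))
        (ℕₚ.≤-trans (≤∑ ps p∈) (ℕₚ.≤-trans (ℕₚ.<⇒≤ (n<2^n l)) (ℕₚ.^-monoʳ-≤ 2 l≤)))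
        where pp = All.lookup prs p∈

    exchangedSum-lower : sumℚ (primes 0 (2^ 10)) t + K * (θ * (ρ * (ρ * ∑∑kernel indices)))
                         ≤ sumℚ (lowPrimes++semiprimes (2^ 10) (2^ 400)) (λ a → term m (ω a) a)
    exchangedSum-lower = begin
      sumℚ low t + K * (θ * (ρ * (ρ * ∑∑kernel indices)))     ≤⟨ ℚₚ.+-mono-≤ (ℚₚ.≤-reflexive (sumℚ-cong low (λ {p} p∈ → cong (λ c → term m c p) (sym (ω-prime (proj₁ (∈-primes⁻ {0} {2^ 10} z≤n p∈)))))))
                                                                  (table-lower indices (λ i∈ → let l , u = ∈-range⁻ 9 390 i∈ in ℕₚ.≤-trans (s≤s z≤n) l , u)) ⟩
      sumℚ low W + sumℚ S (λ p → sumℚ S (λ q → t (p ℕ.* q)))  ≡⟨ cong (λ xs → sumℚ low W + sumℚ xs (λ p → sumℚ xs (λ q → t (p ℕ.* q)))) (concat-buckets 9 390) ⟩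
      sumℚ low W + sumℚ S′ (λ p → sumℚ S′ (λ q → t (p ℕ.* q)))
                                                              ≤⟨ ℚₚ.+-monoʳ-≤ (sumℚ low W) (∑semiprimes-lower t (term-nonNeg m 1) S′ (primes-unique (2^ 10) (2^ 400))
                                                                   (All.tabulate (proj₁ ∘ ∈-primes⁻ {2^ 10} {2^ 400} (2^-mono {10} {400} (ℕₚ.m≤m+n 10 390))))) ⟩
      sumℚ low W + sumℚ (semiprimes S′) (λ a → ι (ω a) * t a) ≡⟨ cong (sumℚ low W +_) (sumℚ-cong (semiprimes S′) (λ {a} _ → sym (term-scale m (ω a) a))) ⟩
      sumℚ low W + sumℚ (semiprimes S′) W                     ≡⟨ sumℚ-++ W low (semiprimes S′) ⟨
      sumℚ (low ++ semiprimes S′) W                           ∎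
      where
      open ℚₚ.≤-Reasoning
      low = primes 0 (2^ 10)
      S = concatMap bucket indices
      S′ = primes (2^ 10) (2^ 400)
      W : ℕ → ℚ
      W a = term m (ω a) a

    -- The surplus arises in units of `K`, which depends on m. As `κ m` ≥ 1, it is at least
    -- 1/(1000h), a gap common to all m and all `ps`.
    gap : ∀ ps → Unique ps → All Prime ps →
          sumℚ ps (λ p → term m (ω p) p) + ⅟ h * ⅟ 1000
          ≤ sumℚ (lowPrimes++semiprimes (2^ 10) (2^ 400)) (λ a → term m (ω a) a)
    gap ps u prs = begin
      sumℚ ps (λ p → term m (ω p) p) + ⅟ h * ⅟ 1000           ≤⟨ ℚₚ.+-mono-≤ (primeSum-upper ps u prs) (*-monoʳ (0≤⅟ 1000) ⅟h≤K) ⟩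
      low + K * (τ * (ι 2 * ⅟ 19)) + K * ⅟ 1000               ≡⟨ solve 4 (λ l k x y → l :+ k :* x :+ k :* y := l :+ k :* (x :+ y)) refl low K (τ * (ι 2 * ⅟ 19)) (⅟ 1000) ⟩
      low + K * (τ * (ι 2 * ⅟ 19) + ⅟ 1000)                   ≤⟨ ℚₚ.+-monoʳ-≤ low (*-monoˡ 0≤K (ℚₚ.≤-trans constants
                                                                   (*-monoˡ 0≤θ (*-monoˡ 0≤ρ (*-monoˡ 0≤ρ ∑∑kernel-lower))))) ⟩
      low + K * (θ * (ρ * (ρ * ∑∑kernel indices)))            ≤⟨ exchangedSum-lower ⟩
      sumℚ (lowPrimes++semiprimes (2^ 10) (2^ 400)) (λ a → term m (ω a) a) ∎
      where
      open ℚₚ.≤-Reasoning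
      low = sumℚ (primes 0 (2^ 10)) t
      ⅟h≤K : ⅟ h ≤ K
      ⅟h≤K = ℚₚ.≤-trans (ℚₚ.≤-reflexive (sym (ℚₚ.*-identityˡ (⅟ h)))) (*-monoʳ (0≤⅟ h) (1≤κ m))

-- From finite sums to suprema

<⇒≱ : ∀ {p q} → p ℚ.< q → ¬ q ≤ p
<⇒≱ p<q q≤p = ℚₚ.<-irrefl refl (ℚₚ.<-≤-trans p<q q≤p)

p≤∣p∣ : ∀ p → p ≤ ∣ p ∣
p≤∣p∣ p with ℚₚ.≤-total 0ℚ p
... | inj₁ 0≤p = ℚₚ.≤-reflexive (sym (ℚₚ.0≤p⇒∣p∣≡p 0≤p))
... | inj₂ p≤0 = ℚₚ.≤-trans p≤0 (ℚₚ.0≤∣p∣ p)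

seq-sumℝ : ∀ (f : ℕ → ℝ) xs m → seq (sumℝ (map f xs)) m ≡ sumℚ xs (λ x → seq (f x) m)
seq-sumℝ f [] m = refl
seq-sumℝ f (x ∷ xs) m = cong (seq (f x) m +_) (seq-sumℝ f xs m)

+-cancelˡ-≤ : ∀ a {b c} → a + b ≤ a + c → b ≤ c
+-cancelˡ-≤ a {b} {c} le = subst₂ _≤_ (lem a b) (lem a c) (ℚₚ.+-monoʳ-≤ (- a) le)
  where
  lem : ∀ a b → - a + (a + b) ≡ b
  lem a b = trans (sym (ℚₚ.+-assoc (- a) a b)) (trans (cong (_+ b) (ℚₚ.+-inverseˡ a)) (ℚₚ.+-identityˡ b))

-- A gap γ that is uniform in m and in the finite subsets of `B` yields a separating rational,
-- without knowing that the sum over `B` converges. With δ = γ/4 and `M` past the Cauchy threshold,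
-- take q = X(M) - 2δ: the sum over `as` stays above q + δ, while any sum over `B` is eventually at
-- most X(M) + δ - 4δ, which is less than q.
∑->∞ : ∀ {A B : Pred ℕ 0ℓ} (f : ℕ → ℝ) as → Unique as → All A as → ∀ {γ} → 0ℚ ℚ.< γ → ∀ N →
       (∀ m → N ℕ.≤ m → ∀ bs → Unique bs → All B bs →
          sumℚ bs (λ b → seq (f b) m) + γ ≤ sumℚ as (λ a → seq (f a) m)) →
       ∑ A f >∞ ∑ B f
∑->∞ {A} {B} f as u all {γ} 0<γ N gap = separate (γ * ½ * ½) (half-pos (half-pos 0<γ))
  (trans (cong₂ _+_ (half+half (γ * ½)) (half+half (γ * ½))) (half+half γ))
  (cauchy (sumℝ (map f as)) (γ * ½ * ½) (half-pos (half-pos 0<γ)))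
  where
  open ℚₚ.≤-Reasoning
  X : ℕ → ℚ
  X = seq (sumℝ (map f as))
  e₁ : ∀ x y d → x - (d + d) + d ≡ x - y + (y - d)
  e₁ = solve 3 (λ x y d → x :- (d :+ d) :+ d := x :- y :+ (y :- d)) refl
  e₂ : ∀ y d → d + (y - d) ≡ y
  e₂ = solve 2 (λ y d → d :+ (y :- d) := y) refl
  e₃ : ∀ x d e → x - (d + d) - d + (d + e) ≡ x - (d + d) + e
  e₃ = solve 3 (λ x d e → x :- (d :+ d) :- d :+ (d :+ e) := x :- (d :+ d) :+ e) refl
  e₄ : ∀ y g → y ≡ y + g - g
  e₄ = solve 2 (λ y g → y := y :+ g :- g) refl
  e₅ : ∀ x y g → x - g ≡ x - y + (y - g)
  e₅ = solve 3 (λ x y g → x :- g := x :- y :+ (y :- g)) refl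
  e₆ : ∀ x d → d + (x - (d + d + (d + d))) ≡ x - (d + d) - d + 0ℚ
  e₆ = solve 2 (λ x d → d :+ (x :- (d :+ d :+ (d :+ d))) := x :- (d :+ d) :- d :+ con 0ℚ) refl
  separate : ∀ δ → 0ℚ ℚ.< δ → δ + δ + (δ + δ) ≡ γ →
             ∃[ N₁ ] (∀ m n → N₁ ℕ.≤ m → N₁ ℕ.≤ n → ∣ X m - X n ∣ ℚ.< δ) → ∑ A f >∞ ∑ B f
  separate δ 0<δ 4δ≡γ (N₁ , close) = q , (as , u , all , δ , 0<δ , N₁ , above) , below
    where
    M = N ℕ.⊔ N₁
    N₁≤M = ℕₚ.m≤n⊔m N N₁
    q = X M - (δ + δ)
    above : ∀ n → N₁ ℕ.≤ n → q + δ ≤ X n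
    above n N₁≤n = begin
      X M - (δ + δ) + δ            ≡⟨ e₁ (X M) (X n) δ ⟩
      X M - X n + (X n - δ)        ≤⟨ ℚₚ.+-monoˡ-≤ (X n - δ) (ℚₚ.≤-trans (p≤∣p∣ (X M - X n)) (ℚₚ.<⇒≤ (close M n N₁≤M N₁≤n))) ⟩
      δ + (X n - δ)                ≡⟨ e₂ (X n) δ ⟩
      X n                          ∎
    below : ¬ cut (∑ B f) q
    below (bs , ub , allb , ε , 0<ε , N₂ , h) = <⇒≱ (+-pos 0<δ 0<ε) (+-cancelˡ-≤ (X M - (δ + δ) - δ) (begin
      X M - (δ + δ) - δ + (δ + ε)         ≡⟨ e₃ (X M) δ ε ⟩
      q + ε                               ≤⟨ h n (ℕₚ.m≤n⊔m M N₂) ⟩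
      seq (sumℝ (map f bs)) n             ≡⟨ seq-sumℝ f bs n ⟩
      Y                                   ≡⟨ e₄ Y γ ⟩
      Y + γ - γ                           ≤⟨ ℚₚ.+-monoˡ-≤ (- γ) (gap n (ℕₚ.≤-trans (ℕₚ.m≤m⊔n N N₁) M≤n) bs ub allb) ⟩
      sumℚ as (λ a → seq (f a) n) - γ     ≡⟨ cong (_- γ) (seq-sumℝ f as n) ⟨
      X n - γ                             ≡⟨ e₅ (X n) (X M) γ ⟩
      X n - X M + (X M - γ)               ≤⟨ ℚₚ.+-monoˡ-≤ (X M - γ) (ℚₚ.≤-trans (p≤∣p∣ (X n - X M)) (ℚₚ.<⇒≤ (close n M (ℕₚ.≤-trans N₁≤M M≤n) N₁≤M))) ⟩
      δ + (X M - γ)                       ≡⟨ cong (λ g → δ + (X M - g)) 4δ≡γ ⟨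
      δ + (X M - (δ + δ + (δ + δ)))       ≡⟨ e₆ (X M) δ ⟩
      X M - (δ + δ) - δ + 0ℚ              ∎))
      where
      n = M ℕ.⊔ N₂
      M≤n = ℕₚ.m≤m⊔n M N₂
      Y = sumℚ bs (λ b → seq (f b) n)

∑-cong : ∀ {A : Pred ℕ 0ℓ} {f g : ℕ → ℝ} → (∀ {a} → A a → f a ≡ g a) → ∑ A f ≈∞ ∑ A g
∑-cong {A} {f} {g} f≗g = (λ { {q} (as , u , all , lt) → as , u , all , subst (fromℚ q <ℝ_) (cong sumℝ (eq all)) lt })
                       , (λ { {q} (as , u , all , lt) → as , u , all , subst (fromℚ q <ℝ_) (cong sumℝ (sym (eq all))) lt })
  where
  eq : ∀ {as} → All A as → map f as ≡ map g as
  eq []         = refl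
  eq (a ∷ all)  = cong₂ _∷_ (f≗g a) (eq all)

-- `a` is kept variable so that 2^a and the powers built on it are never evaluated. The remaining
-- parameters are r = a and the least h that `h-large` admits.
exchanged-∑ : ∀ a → 1000 ℕ.≤ a → 7000 ℕ.* 399 ℕ.≤ 3 ℕ.* a →
              ∃[ y ] ∑ (Exchanged y) (λ n → ω n /[ n log]) >∞ ∑ Prime (λ p → ω p /[ p log])
exchanged-∑ a 1000≤a 7000*399≤3a = y , ∑->∞ (λ n → ω n /[ n log])
    (lowPrimes++semiprimes y z) (lowPrimes++semiprimes-unique y y≤z) (lowPrimes++semiprimes-∈ y y≤z)
    (*-pos (0<⅟ 0<h) (0<⅟ {1000} z<s)) 200 (Gap.gap a a h 1000≤a ℕₚ.≤-refl 7000*399≤3a ℕₚ.≤-refl 0<h)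
  where
  h = 1000 ℕ.* (2 ℕ.+ 2 ^ a ℕ.* suc a ℕ.+ 8 ℕ.* a)
  y = 2 ^ (10 ℕ.* h)
  z = 2 ^ (400 ℕ.* h)
  0<h : 0 ℕ.< h
  0<h = s≤s z≤n
  y≤z : y ℕ.≤ z
  y≤z = ℕₚ.^-monoʳ-≤ 2 (ℕₚ.*-monoˡ-≤ h (ℕₚ.m≤m+n 10 390))
  0<⅟ : ∀ {n} → 0 ℕ.< n → 0ℚ ℚ.< ⅟ n
  0<⅟ {n} 0<n = ℚₚ.≰⇒> λ ⅟≤0 → <⇒≱ 0<1 (ℚₚ.≤-trans (ℚₚ.≤-reflexive (sym (ι*⅟ 0<n)))
    (ℚₚ.≤-trans (*-monoˡ (0≤ι n) ⅟≤0) (ℚₚ.≤-reflexive (ℚₚ.*-zeroʳ (ι n)))))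

proposition2 : ∃[ A ] (∀ {a} → A a → 0 < a)
    × Primitive A
    × ¬ (A ≐ ｛ 1 ｝)
    × (∑ A (λ a → ω a /[ a log]) >∞ ∑ Prime (λ p → ω p /[ p log]))
    × (∑ Prime (λ p → ω p /[ p log]) ≈∞ ∑ Prime (λ p → 1 /[ p log]))
-- The last bucket index 399 requires a ≥ 931000; a million is a round choice.
proposition2 = assemble (exchanged-∑ 1000000 (ℕₚ.≤ᵇ⇒≤ 1000 1000000 _) (ℕₚ.≤ᵇ⇒≤ (7000 ℕ.* 399) (3 ℕ.* 1000000) _))
  where
  assemble : ∃[ y ] ∑ (Exchanged y) (λ a → ω a /[ a log]) >∞ ∑ Prime (λ p → ω p /[ p log]) → _
  assemble (y , exceeds) = Exchanged y , (λ {_} → exchanged-positive y) , (λ {_} {_} → exchanged-primitive y)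
    , (λ (_ , ｛1｝⊆) → 1∉exchanged y (｛1｝⊆ refl))
    , exceeds
    , ∑-cong (λ {p} pp → cong (_/[ p log]) (ω-prime pp))
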